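{- Let $l\ge 1$, let $a_j,b_j,k_j$ $(1\le j\le l)$ be integers with $k_j\ge 1$ and $a_1\cdots a_l\ne 0$, and let $f(t)=\prod_{j=1}^{l}(a_jt^{k_j}-b_j)\in\mathbb{Z}[t]$. Then there is a constant $c=c(k_1,\ldots,k_l)>0$ such that there are polynomials $g\in\mathbb{Z}[t]$ of arbitrarily large degree $d$ for which $f(g(t))$ factors as a product of polynomials of degree at most $cd/(\log\log d)^{1/l}$. Consequently $f$ admits polysmoothness $\varepsilon$ for every $\varepsilon>0$.
   Context: A polynomial $f\in\mathbb{Z}[t]$ of positive degree admits polysmoothness $\theta$ (for a real $\theta\ge 0$) if there exists a non-constant polynomial $g\in\mathbb{Z}[t]$ such that every irreducible factor of $f(g(t))$ has degree at most $\theta\,(\deg f)(\deg g)$. -}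

module Defs where

open import Algebra.Bundles.Raw using (RawSemiring)
import Algebra.Definitions.RawMonoid as RawMonoidDefs
import Algebra.Definitions.RawSemiring as RawSemiringDefs
open import Data.Bool.Base using (if_then_else_)
open import Data.Fin.Base using (Fin)
open import Data.Integer.Base as ℤ using (ℤ; 0ℤ; 1ℤ)
import Data.Integer.Properties as ℤ
open import Data.List.Base using (List; []; _∷_; map)
open import Data.List.Relation.Unary.All using (all?)
open import Data.Nat.Base as ℕ using (ℕ; zero; suc; _!)
open import Data.Nat.Properties using (_!≢0)
open import Data.Product.Base using (∃-syntax; _×_; _,_)
open import Data.Rational.Base as ℚ using (ℚ; 0ℚ; 1ℚ)
import Data.Rational.Properties as ℚ
open import Data.Sum.Base using (_⊎_; inj₁; inj₂)
open import Function.Bundles using (_⇔_; mk⇔)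
open import Level using (0ℓ)
open import Relation.Binary.Definitions using (tri<; tri≈; tri>)
open import Relation.Binary.PropositionalEquality using (_≡_; refl)
open import Relation.Nullary using (¬_)
open import Relation.Nullary.Decidable using (does)

------------------------------------------------------------------------
-- ℤ[t]

-- Coefficient lists, constant term first.  Lists differing only by
-- trailing zeros denote the same polynomial and are identified by _≈_.
Poly : Set
Poly = List ℤ

coeff : Poly → ℕ → ℤ
coeff []      _       = 0ℤ
coeff (a ∷ p) zero    = a
coeff (a ∷ p) (suc n) = coeff p n

infix 4 _≈_
_≈_ : Poly → Poly → Set
p ≈ q = ∀ n → coeff p n ≡ coeff q n

-- The zero polynomial gets degree 0.
deg : Poly → ℕ
deg []      = 0
deg (a ∷ p) = if does (all? (ℤ._≟ 0ℤ) p) then 0 else suc (deg p)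

C : ℤ → Poly
C a = a ∷ []

X : Poly
X = 0ℤ ∷ 1ℤ ∷ []

infixl 6 _+ᵖ_
_+ᵖ_ : Poly → Poly → Poly
[]      +ᵖ q       = q
(a ∷ p) +ᵖ []      = a ∷ p
(a ∷ p) +ᵖ (b ∷ q) = (a ℤ.+ b) ∷ (p +ᵖ q)

infixl 7 _*ᵖ_
_*ᵖ_ : Poly → Poly → Poly
[]      *ᵖ q = []
(a ∷ p) *ᵖ q = map (a ℤ.*_) q +ᵖ (0ℤ ∷ (p *ᵖ q))

-- Composition f(g(t)).
infix 8 _⟨_⟩
_⟨_⟩ : Poly → Poly → Poly
[]      ⟨ g ⟩ = []
(a ∷ f) ⟨ g ⟩ = C a +ᵖ g *ᵖ (f ⟨ g ⟩)

polyRawSemiring : RawSemiring 0ℓ 0ℓ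
polyRawSemiring = record
  { Carrier = Poly
  ; _≈_     = _≈_
  ; _+_     = _+ᵖ_
  ; _*_     = _*ᵖ_
  ; 0#      = []
  ; 1#      = C 1ℤ
  }

-- Irreducibility and divisibility are those of the ring ℤ[t].  Irreducible
-- integer constants are thus irreducible polynomials, but they have degree 0.
open RawSemiringDefs polyRawSemiring public
  using (_^_; Irreducible; _∣_)
  renaming (product to ∏ᵖ)

open RawMonoidDefs ℤ.*-1-rawMonoid public
  using ()
  renaming (sum to ∏ᶻ)

binomialProduct : ∀ {l} (a b : Fin l → ℤ) (k : Fin l → ℕ) → Poly
binomialProduct a b k = ∏ᵖ (λ j → C (a j) *ᵖ X ^ k j +ᵖ C (ℤ.- b j))

------------------------------------------------------------------------
-- Real numbers

-- A real x is represented by the rationals below it and those above it.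
record Cut : Set₁ where
  field
    lower : ℚ → Set   -- lower q means q < x
    upper : ℚ → Set   -- upper q means x < q

open Cut public

-- Dedekind reals.  A cut which only occurs in a compound expression is left
-- as a Cut: the operations below give both halves of the result directly.
record ℝ : Set₁ where
  field
    cut             : Cut
    lower-inhabited : ∃[ q ] lower cut q
    upper-inhabited : ∃[ q ] upper cut q
    lower-rounded   : ∀ q → lower cut q ⇔ (∃[ r ] q ℚ.< r × lower cut r)
    upper-rounded   : ∀ q → upper cut q ⇔ (∃[ r ] r ℚ.< q × upper cut r)
    disjoint        : ∀ q → ¬ (lower cut q × upper cut q)
    located         : ∀ q r → q ℚ.< r → lower cut q ⊎ upper cut r

infix 4 _≤ᶜ_ _<ᶜ_

_≤ᶜ_ : Cut → Cut → Set
x ≤ᶜ y = ∀ q → lower x q → lower y q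

_<ᶜ_ : Cut → Cut → Set
x <ᶜ y = ∃[ q ] upper x q × lower y q

fromℚ : ℚ → Cut
fromℚ p = record { lower = ℚ._< p ; upper = p ℚ.<_ }

fromℕ : ℕ → Cut
fromℕ n = fromℚ (ℤ.+ n ℚ./ 1)

0ᶜ : Cut
0ᶜ = fromℚ 0ℚ

ℚ⇒ℝ : ℚ → ℝ
ℚ⇒ℝ p = record
  { cut             = fromℚ p
  ; lower-inhabited = p ℚ.- 1ℚ , p-1<p
  ; upper-inhabited = p ℚ.+ 1ℚ , p<p+1
  ; lower-rounded   = λ q → mk⇔ ℚ.<-dense (λ (_ , q<r , r<p) → ℚ.<-trans q<r r<p)
  ; upper-rounded   = λ q → mk⇔
      (λ p<q → let r , p<r , r<q = ℚ.<-dense p<q in r , r<q , p<r)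
      (λ (_ , r<q , p<r) → ℚ.<-trans p<r r<q)
  ; disjoint        = λ q (q<p , p<q) → ℚ.<-asym q<p p<q
  ; located         = located
  }
  where
  p-1<p : p ℚ.- 1ℚ ℚ.< p
  p-1<p = ℚ.<-≤-trans (ℚ.+-monoʳ-< p (ℚ.negative⁻¹ (ℚ.- 1ℚ)))
                      (ℚ.≤-reflexive (ℚ.+-identityʳ p))

  p<p+1 : p ℚ.< p ℚ.+ 1ℚ
  p<p+1 = ℚ.≤-<-trans (ℚ.≤-reflexive (Eq.sym (ℚ.+-identityʳ p)))
                      (ℚ.+-monoʳ-< p (ℚ.positive⁻¹ 1ℚ))
    where import Relation.Binary.PropositionalEquality as Eq

  located : ∀ q r → q ℚ.< r → q ℚ.< p ⊎ p ℚ.< r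
  located q r q<r with ℚ.<-cmp q p
  ... | tri< q<p _ _    = inj₁ q<p
  ... | tri≈ _ refl _   = inj₂ q<r
  ... | tri> _ _ p<q    = inj₂ (ℚ.<-trans p<q q<r)

-- Correct for factors ≥ 0.
infixl 7 _*ᶜ_ _/ᶜ_
_*ᶜ_ : Cut → Cut → Cut
lower (x *ᶜ y) q = q ℚ.< 0ℚ ⊎
  (∃[ r ] ∃[ s ] 0ℚ ℚ.< r × 0ℚ ℚ.< s × lower x r × lower y s × q ℚ.< r ℚ.* s)
upper (x *ᶜ y) q = ∃[ r ] ∃[ s ] upper x r × upper y s × r ℚ.* s ℚ.< q

-- Correct for a numerator ≥ 0 and a denominator > 0.
_/ᶜ_ : Cut → Cut → Cut
lower (x /ᶜ y) q = ∃[ r ] ∃[ s ] lower x r × 0ℚ ℚ.< s × upper y s × q ℚ.* s ℚ.< r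
upper (x /ᶜ y) q = ∃[ r ] ∃[ s ] upper x r × 0ℚ ℚ.< s × lower y s × r ℚ.< q ℚ.* s

infixr 8 _^ℚ_
_^ℚ_ : ℚ → ℕ → ℚ
_^ℚ_ = RawSemiringDefs._^_ ℚ.+-*-rawSemiring

-- The l-th root x^{1/l}; correct for x ≥ 0 and l ≥ 1.
root : ℕ → Cut → Cut
lower (root l x) q = q ℚ.< 0ℚ ⊎ lower x (q ^ℚ l)
upper (root l x) q = 0ℚ ℚ.< q × upper x (q ^ℚ l)

-- The limit of a convergent sequence.
lim : (ℕ → ℚ) → Cut
lower (lim u) q = ∃[ r ] q ℚ.< r × (∃[ N ] ∀ n → N ℕ.≤ n → r ℚ.≤ u n)
upper (lim u) q = ∃[ r ] r ℚ.< q × (∃[ N ] ∀ n → N ℕ.≤ n → u n ℚ.≤ r)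

expPartialSum : ℚ → ℕ → ℚ
expPartialSum q zero    = 0ℚ
expPartialSum q (suc n) =
  expPartialSum q n ℚ.+ q ^ℚ n ℚ.* ((ℤ.+ 1 ℚ./ (n !)) ⦃ n !≢0 ⦄)

exp : ℚ → Cut
exp q = lim (expPartialSum q)

-- The natural logarithm of x > 0: q < log x iff exp q < x, and
-- log x < q iff x < exp q.
log : Cut → Cut
lower (log x) q = exp q <ᶜ x
upper (log x) q = x <ᶜ exp q

------------------------------------------------------------------------
-- Polysmoothness

-- The first two components are the conditions under which the notion is
-- defined: f has positive degree and θ ≥ 0.
AdmitsPolysmoothness : Poly → ℝ → Set
AdmitsPolysmoothness f θ =
  0 ℕ.< deg f × 0ᶜ ≤ᶜ ℝ.cut θ ×
  (∃[ g ] 0 ℕ.< deg g ×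
    (∀ h → Irreducible h → h ∣ f ⟨ g ⟩ →
      fromℕ (deg h) ≤ᶜ ℝ.cut θ *ᶜ fromℕ (deg f) *ᶜ fromℕ (deg g)))

{-# OPTIONS --safe #-}

-- Take g = γ tᵈ with d = (2ᴱ)!.  If N₁, …, Nₗ are pairwise coprime divisors
-- of d and Nⱼ is coprime to kⱼ, then γ can be chosen such that each
-- aⱼ γ^kⱼ / bⱼ is an Nⱼ-th power βⱼ^Nⱼ.  The j-th factor of f(g(t)) is then
-- bⱼ (y^Nⱼ − 1) with y = βⱼ t^(d kⱼ/Nⱼ); for Nⱼ a product of distinct primes
-- it splits into cyclotomic factors in y of degree at most φ(Nⱼ) d kⱼ/Nⱼ.
--
-- Let K ≥ kⱼ for all j.  The primes in (K, 2ᴱ] are distributed greedily over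
-- the Nⱼ so that the ratios Nⱼ/φ(Nⱼ) stay within a factor 2 of each other.
-- By Euler's product their product is at least 1/K times the harmonic sum up
-- to 2ᴱ, hence of order E, which in turn is of order log log d.  So
-- φ(Nⱼ)/Nⱼ = O((log log d)^(-1/l)).
--
-- An irreducible h ∈ ℤ[t] dividing a product divides, up to a constant, one of
-- the factors (Gauss's lemma), so no irreducible factor of f(g(t)) has larger
-- degree than the factors found.
module Submission where

-- The exponent 1/l is the price of a single γ for all factors. The conditions on γ are solved one
-- after another by choosing exponents, which works for pairwise coprime Nⱼ only, so the primes have
-- to be shared out. As the product of the ratios Nⱼ/φ(Nⱼ) is all that Euler's product controls, an
-- unbalanced distribution would leave some factor of f(g(t)) with a large irreducible part. Primes
-- that may divide some kⱼ cannot be used at all. In Euler's product they are replaced by all the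
-- integers in their range, whose contribution telescopes; the loss is a factor depending on the kⱼ
-- only, and hence so does c. The factorial is a crude common multiple of the Nⱼ, but two logarithms
-- reduce it to O(E); only an upper bound for log log d is required. Both conclusions follow from
-- the inequality `SmallDegree` between natural numbers: the first compares E with log log d, the
-- second just takes E large. All algebra stays in ℤ[t]. Divisions are exact because of
-- comaximality, or are pseudo-divisions whose constant multipliers are carried along.

-- The commutative ring ℤ[t] of coefficient lists modulo trailing zeros

module PolynomialRing where
  open import Defs
  open import Algebra.Bundles using (CommutativeMonoid; CommutativeRing)
  import Algebra.Properties.CommutativeSemigroup
  import Relation.Binary.Reasoning.Setoid
  open import Data.Integer.Base as ℤ using (ℤ; 0ℤ; 1ℤ)
  import Data.Integer.Properties as ℤ
  open import Data.List.Base using ([]; _∷_; map)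
  open import Data.Maybe.Base as Maybe using (Maybe; just; nothing)
  open import Data.Nat.Base using (zero; suc)
  open import Data.Product.Base using (_,_)
  open import Level using (0ℓ)
  open import Relation.Binary.PropositionalEquality
  open import Relation.Binary.Structures using (IsEquivalence)
  open import Tactic.RingSolver.Core.AlmostCommutativeRing using (AlmostCommutativeRing; fromCommutativeRing)

  -- _≈_ unfolds to a function type, from which the two polynomials cannot be
  -- inferred; they can from this record.
  infix 4 _≋_
  record _≋_ (p q : Poly) : Set where
    constructor mk
    field at : p ≈ q
  open _≋_

  ≋-isEquivalence : IsEquivalence _≋_
  ≋-isEquivalence = record
    { refl  = mk λ _ → refl
    ; sym   = λ (mk e) → mk λ n → sym (e n)
    ; trans = λ (mk e) (mk f) → mk λ n → trans (e n) (f n)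
    }

  module ≋ = IsEquivalence ≋-isEquivalence

  ∷-cong : ∀ {a b p q} → a ≡ b → p ≋ q → a ∷ p ≋ b ∷ q
  ∷-cong a≡b p≋q = mk λ where
    zero    → a≡b
    (suc n) → at p≋q n

  0∷[]≋[] : 0ℤ ∷ [] ≋ []
  0∷[]≋[] = mk λ where
    zero    → refl
    (suc n) → refl

  coeff-+ : ∀ p q n → coeff (p +ᵖ q) n ≡ coeff p n ℤ.+ coeff q n
  coeff-+ []      q       n       = sym (ℤ.+-identityˡ _)
  coeff-+ (a ∷ p) []      n       = sym (ℤ.+-identityʳ _)
  coeff-+ (a ∷ p) (b ∷ q) zero    = refl
  coeff-+ (a ∷ p) (b ∷ q) (suc n) = coeff-+ p q n

  coeff-scale : ∀ a p n → coeff (map (a ℤ.*_) p) n ≡ a ℤ.* coeff p n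
  coeff-scale a []      n       = sym (ℤ.*-zeroʳ a)
  coeff-scale a (b ∷ p) zero    = refl
  coeff-scale a (b ∷ p) (suc n) = coeff-scale a p n

  +ᵖ-cong : ∀ {p p′ q q′} → p ≋ p′ → q ≋ q′ → p +ᵖ q ≋ p′ +ᵖ q′
  +ᵖ-cong {p} {p′} {q} {q′} (mk e) (mk f) = mk λ n →
    trans (coeff-+ p q n) (trans (cong₂ ℤ._+_ (e n) (f n)) (sym (coeff-+ p′ q′ n)))

  +ᵖ-assoc : ∀ p q r → (p +ᵖ q) +ᵖ r ≋ p +ᵖ (q +ᵖ r)
  +ᵖ-assoc p q r = mk λ n → begin
    coeff ((p +ᵖ q) +ᵖ r) n                    ≡⟨ coeff-+ (p +ᵖ q) r n ⟩
    coeff (p +ᵖ q) n ℤ.+ coeff r n             ≡⟨ cong (ℤ._+ coeff r n) (coeff-+ p q n) ⟩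
    coeff p n ℤ.+ coeff q n ℤ.+ coeff r n      ≡⟨ ℤ.+-assoc (coeff p n) (coeff q n) (coeff r n) ⟩
    coeff p n ℤ.+ (coeff q n ℤ.+ coeff r n)    ≡⟨ cong (ℤ._+_ (coeff p n)) (coeff-+ q r n) ⟨
    coeff p n ℤ.+ coeff (q +ᵖ r) n             ≡⟨ coeff-+ p (q +ᵖ r) n ⟨
    coeff (p +ᵖ (q +ᵖ r)) n                    ∎
    where open ≡-Reasoning

  +ᵖ-comm : ∀ p q → p +ᵖ q ≋ q +ᵖ p
  +ᵖ-comm p q = mk λ n →
    trans (coeff-+ p q n) (trans (ℤ.+-comm (coeff p n) (coeff q n)) (sym (coeff-+ q p n)))

  +ᵖ-identityʳ : ∀ p → p +ᵖ [] ≋ p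
  +ᵖ-identityʳ []      = ≋.refl
  +ᵖ-identityʳ (a ∷ p) = ≋.refl

  infix 8 -ᵖ_
  -ᵖ_ : Poly → Poly
  -ᵖ_ = map (ℤ.-_)

  coeff-neg : ∀ p n → coeff (-ᵖ p) n ≡ ℤ.- coeff p n
  coeff-neg []      n       = refl
  coeff-neg (a ∷ p) zero    = refl
  coeff-neg (a ∷ p) (suc n) = coeff-neg p n

  +ᵖ-inverseʳ : ∀ p → p +ᵖ (-ᵖ p) ≋ []
  +ᵖ-inverseʳ p = mk λ n →
    trans (coeff-+ p (-ᵖ p) n)
      (trans (cong (ℤ._+_ (coeff p n)) (coeff-neg p n)) (ℤ.+-inverseʳ (coeff p n)))

  -ᵖ-cong : ∀ {p q} → p ≋ q → -ᵖ p ≋ -ᵖ q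
  -ᵖ-cong {p} {q} (mk e) = mk λ n →
    trans (coeff-neg p n) (trans (cong ℤ.-_ (e n)) (sym (coeff-neg q n)))

  infixr 7 _·_
  _·_ : ℤ → Poly → Poly
  a · p = map (a ℤ.*_) p

  ·-cong : ∀ {a b p q} → a ≡ b → p ≋ q → a · p ≋ b · q
  ·-cong {a} {b} {p} {q} refl (mk e) = mk λ n →
    trans (coeff-scale a p n) (trans (cong (a ℤ.*_) (e n)) (sym (coeff-scale b q n)))

  0·p≋[] : ∀ p → 0ℤ · p ≋ []
  0·p≋[] p = mk λ n → coeff-scale 0ℤ p n

  ·-distribˡ : ∀ a p q → a · (p +ᵖ q) ≋ a · p +ᵖ a · q
  ·-distribˡ a p q = mk λ n → begin
    coeff (a · (p +ᵖ q)) n                     ≡⟨ coeff-scale a (p +ᵖ q) n ⟩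
    a ℤ.* coeff (p +ᵖ q) n                     ≡⟨ cong (a ℤ.*_) (coeff-+ p q n) ⟩
    a ℤ.* (coeff p n ℤ.+ coeff q n)            ≡⟨ ℤ.*-distribˡ-+ a (coeff p n) (coeff q n) ⟩
    a ℤ.* coeff p n ℤ.+ a ℤ.* coeff q n        ≡⟨ cong₂ ℤ._+_ (coeff-scale a p n) (coeff-scale a q n) ⟨
    coeff (a · p) n ℤ.+ coeff (a · q) n        ≡⟨ coeff-+ (a · p) (a · q) n ⟨
    coeff (a · p +ᵖ a · q) n                   ∎
    where open ≡-Reasoning

  ·-distribʳ : ∀ a b p → (a ℤ.+ b) · p ≋ a · p +ᵖ b · p
  ·-distribʳ a b p = mk λ n → begin
    coeff ((a ℤ.+ b) · p) n                    ≡⟨ coeff-scale (a ℤ.+ b) p n ⟩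
    (a ℤ.+ b) ℤ.* coeff p n                    ≡⟨ ℤ.*-distribʳ-+ (coeff p n) a b ⟩
    a ℤ.* coeff p n ℤ.+ b ℤ.* coeff p n        ≡⟨ cong₂ ℤ._+_ (coeff-scale a p n) (coeff-scale b p n) ⟨
    coeff (a · p) n ℤ.+ coeff (b · p) n        ≡⟨ coeff-+ (a · p) (b · p) n ⟨
    coeff (a · p +ᵖ b · p) n                   ∎
    where open ≡-Reasoning

  ·-assoc : ∀ a b p → a · b · p ≋ (a ℤ.* b) · p
  ·-assoc a b p = mk λ n →
    trans (coeff-scale a (b · p) n)
      (trans (cong (a ℤ.*_) (coeff-scale b p n))
        (trans (sym (ℤ.*-assoc a b (coeff p n))) (sym (coeff-scale (a ℤ.* b) p n))))

  1·p≋p : ∀ p → 1ℤ · p ≋ p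
  1·p≋p p = mk λ n → trans (coeff-scale 1ℤ p n) (ℤ.*-identityˡ (coeff p n))

  +ᵖ-commutativeMonoid : CommutativeMonoid 0ℓ 0ℓ
  +ᵖ-commutativeMonoid = record
    { Carrier = Poly
    ; _≈_     = _≋_
    ; _∙_     = _+ᵖ_
    ; ε       = []
    ; isCommutativeMonoid = record
      { isMonoid = record
        { isSemigroup = record
          { isMagma = record { isEquivalence = ≋-isEquivalence ; ∙-cong = +ᵖ-cong }
          ; assoc   = +ᵖ-assoc
          }
        ; identity = (λ _ → ≋.refl) , +ᵖ-identityʳ
        }
      ; comm = +ᵖ-comm
      }
    }

  open Algebra.Properties.CommutativeSemigroup
    (CommutativeMonoid.commutativeSemigroup +ᵖ-commutativeMonoid)
    using (interchange; x∙yz≈y∙xz)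

  module ≋-Reasoning = Relation.Binary.Reasoning.Setoid
    (CommutativeMonoid.setoid +ᵖ-commutativeMonoid)

  +ᵖ-congˡ : ∀ p {q r} → q ≋ r → p +ᵖ q ≋ p +ᵖ r
  +ᵖ-congˡ p = +ᵖ-cong (≋.refl {p})

  ≋[]-tail : ∀ {a p} → a ∷ p ≋ [] → p ≋ []
  ≋[]-tail (mk e) = mk λ n → e (suc n)

  -- A list of zeros need not be the empty list. The cases of `*ᵖ-congʳ` in which the two lists
  -- differ in length come down to this.
  zero-*ᵖ : ∀ {p} q → p ≋ [] → p *ᵖ q ≋ []
  zero-*ᵖ {[]}    q e = ≋.refl
  zero-*ᵖ {a ∷ p} q e =
    ≋.trans (+ᵖ-cong (≋.trans (·-cong (at e 0) (≋.refl {q})) (0·p≋[] q))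
                     (∷-cong refl (zero-*ᵖ q (≋[]-tail e))))
            0∷[]≋[]

  *ᵖ-congʳ : ∀ {p p′} q → p ≋ p′ → p *ᵖ q ≋ p′ *ᵖ q
  *ᵖ-congʳ {[]}    {p′}     q e = ≋.sym (zero-*ᵖ q (≋.sym e))
  *ᵖ-congʳ {a ∷ p} {[]}     q e = zero-*ᵖ q e
  *ᵖ-congʳ {a ∷ p} {b ∷ p′} q e =
    +ᵖ-cong (·-cong (at e 0) (≋.refl {q}))
            (∷-cong refl (*ᵖ-congʳ {p} {p′} q (mk λ n → at e (suc n))))

  *ᵖ-congˡ : ∀ p {q q′} → q ≋ q′ → p *ᵖ q ≋ p *ᵖ q′
  *ᵖ-congˡ []      e = ≋.refl
  *ᵖ-congˡ (a ∷ p) e = +ᵖ-cong (·-cong {a} refl e) (∷-cong refl (*ᵖ-congˡ p e))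

  *ᵖ-distribʳ : ∀ r p q → (p +ᵖ q) *ᵖ r ≋ p *ᵖ r +ᵖ q *ᵖ r
  *ᵖ-distribʳ r []      q       = ≋.refl
  *ᵖ-distribʳ r (a ∷ p) []      = ≋.sym (+ᵖ-identityʳ _)
  *ᵖ-distribʳ r (a ∷ p) (b ∷ q) = begin
    (a ℤ.+ b) · r +ᵖ (0ℤ ∷ (p +ᵖ q) *ᵖ r)
      ≈⟨ +ᵖ-cong (·-distribʳ a b r) (∷-cong refl (*ᵖ-distribʳ r p q)) ⟩
    (a · r +ᵖ b · r) +ᵖ ((0ℤ ∷ p *ᵖ r) +ᵖ (0ℤ ∷ q *ᵖ r))
      ≈⟨ interchange (a · r) (b · r) (0ℤ ∷ p *ᵖ r) (0ℤ ∷ q *ᵖ r) ⟩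
    (a ∷ p) *ᵖ r +ᵖ (b ∷ q) *ᵖ r
      ∎
    where open ≋-Reasoning

  ·-*ᵖ : ∀ a p q → a · (p *ᵖ q) ≋ (a · p) *ᵖ q
  ·-*ᵖ a []      q = ≋.refl
  ·-*ᵖ a (b ∷ p) q = begin
    a · (b · q +ᵖ (0ℤ ∷ p *ᵖ q))           ≈⟨ ·-distribˡ a (b · q) (0ℤ ∷ p *ᵖ q) ⟩
    a · b · q +ᵖ a · (0ℤ ∷ p *ᵖ q)         ≈⟨ +ᵖ-cong (·-assoc a b q) (∷-cong (ℤ.*-zeroʳ a) (·-*ᵖ a p q)) ⟩
    (a ℤ.* b) · q +ᵖ (0ℤ ∷ (a · p) *ᵖ q)   ∎
    where open ≋-Reasoning

  0∷-*ᵖ : ∀ p q → (0ℤ ∷ p) *ᵖ q ≋ 0ℤ ∷ (p *ᵖ q)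
  0∷-*ᵖ p q = +ᵖ-cong (0·p≋[] q) (≋.refl {0ℤ ∷ p *ᵖ q})

  *ᵖ-assoc : ∀ p q r → (p *ᵖ q) *ᵖ r ≋ p *ᵖ (q *ᵖ r)
  *ᵖ-assoc []      q r = ≋.refl
  *ᵖ-assoc (a ∷ p) q r = begin
    (a · q +ᵖ (0ℤ ∷ p *ᵖ q)) *ᵖ r
      ≈⟨ *ᵖ-distribʳ r (a · q) (0ℤ ∷ p *ᵖ q) ⟩
    (a · q) *ᵖ r +ᵖ (0ℤ ∷ p *ᵖ q) *ᵖ r
      ≈⟨ +ᵖ-cong (≋.sym (·-*ᵖ a q r)) (≋.trans (0∷-*ᵖ (p *ᵖ q) r) (∷-cong refl (*ᵖ-assoc p q r))) ⟩
    (a ∷ p) *ᵖ (q *ᵖ r)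
      ∎
    where open ≋-Reasoning

  -- The recursion of `_*ᵖ_` mirrored to its second argument; commutativity is then a plain
  -- induction.
  *ᵖ-∷ : ∀ p b q → p *ᵖ (b ∷ q) ≋ b · p +ᵖ (0ℤ ∷ p *ᵖ q)
  *ᵖ-∷ []      b q = ≋.sym 0∷[]≋[]
  *ᵖ-∷ (a ∷ p) b q = ∷-cong (cong (ℤ._+ 0ℤ) (ℤ.*-comm a b)) (begin
    a · q +ᵖ p *ᵖ (b ∷ q)                  ≈⟨ +ᵖ-congˡ (a · q) (*ᵖ-∷ p b q) ⟩
    a · q +ᵖ (b · p +ᵖ (0ℤ ∷ p *ᵖ q))      ≈⟨ x∙yz≈y∙xz (a · q) (b · p) (0ℤ ∷ p *ᵖ q) ⟩
    b · p +ᵖ (a ∷ p) *ᵖ q                  ∎)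
    where open ≋-Reasoning

  *ᵖ-zeroʳ : ∀ p → p *ᵖ [] ≋ []
  *ᵖ-zeroʳ []      = ≋.refl
  *ᵖ-zeroʳ (a ∷ p) = ≋.trans (∷-cong refl (*ᵖ-zeroʳ p)) 0∷[]≋[]

  *ᵖ-comm : ∀ p q → p *ᵖ q ≋ q *ᵖ p
  *ᵖ-comm []      q = ≋.sym (*ᵖ-zeroʳ q)
  *ᵖ-comm (a ∷ p) q =
    ≋.trans (+ᵖ-congˡ (a · q) (∷-cong refl (*ᵖ-comm p q))) (≋.sym (*ᵖ-∷ q a p))

  C-* : ∀ a p → C a *ᵖ p ≋ a · p
  C-* a p = ≋.trans (+ᵖ-congˡ (a · p) 0∷[]≋[]) (+ᵖ-identityʳ (a · p))

  *ᵖ-identityˡ : ∀ p → C 1ℤ *ᵖ p ≋ p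
  *ᵖ-identityˡ p = ≋.trans (C-* 1ℤ p) (1·p≋p p)

  polyRing : CommutativeRing 0ℓ 0ℓ
  polyRing = record
    { Carrier = Poly
    ; _≈_     = _≋_
    ; _+_     = _+ᵖ_
    ; _*_     = _*ᵖ_
    ; -_      = -ᵖ_
    ; 0#      = []
    ; 1#      = C 1ℤ
    ; isCommutativeRing = record
      { isRing = record
        { +-isAbelianGroup = record
          { isGroup = record
            { isMonoid = CommutativeMonoid.isMonoid +ᵖ-commutativeMonoid
            ; inverse  = (λ p → ≋.trans (+ᵖ-comm (-ᵖ p) p) (+ᵖ-inverseʳ p)) , +ᵖ-inverseʳ
            ; ⁻¹-cong  = -ᵖ-cong
            }
          ; comm = +ᵖ-comm
          }
        ; *-cong     = λ {p} {p′} {q} {q′} e f → ≋.trans (*ᵖ-congʳ q e) (*ᵖ-congˡ p′ f)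
        ; *-assoc    = *ᵖ-assoc
        ; *-identity = *ᵖ-identityˡ , λ p → ≋.trans (*ᵖ-comm p (C 1ℤ)) (*ᵖ-identityˡ p)
        ; distrib    =
            (λ p q r → ≋.trans (*ᵖ-comm p (q +ᵖ r))
               (≋.trans (*ᵖ-distribʳ p q r) (+ᵖ-cong (*ᵖ-comm q p) (*ᵖ-comm r p))))
          , *ᵖ-distribʳ
        }
      ; *-comm = *ᵖ-comm
      }
    }

  isZero? : ∀ p → Maybe ([] ≋ p)
  isZero? []              = just ≋.refl
  isZero? (ℤ.+ zero ∷ p)  = Maybe.map (λ e → ≋.trans (≋.sym 0∷[]≋[]) (∷-cong refl e)) (isZero? p)
  isZero? (_ ∷ p)         = nothing

  polySolverRing : AlmostCommutativeRing 0ℓ 0ℓ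
  polySolverRing = fromCommutativeRing polyRing isZero?

-- Degrees, cancellation and composition

module Degree where
  open import Defs
  open PolynomialRing
  open import Algebra.Bundles using (CommutativeRing)
  open import Data.Empty using (⊥-elim)
  open import Data.Fin.Base using (Fin; zero; suc)
  open import Data.Integer.Base as ℤ using (ℤ; 0ℤ; 1ℤ)
  import Data.Integer.Properties as ℤ
  open import Data.List.Base using ([]; _∷_)
  open import Data.List.Relation.Unary.All using (All; []; _∷_; all?)
  open import Data.Nat.Base as ℕ using (ℕ; zero; suc; _≤_; z≤n; s≤s)
  import Data.Nat.Properties as ℕ
  open import Data.Product.Base using (∃-syntax; _×_; _,_; proj₁; proj₂)
  open import Data.Sum.Base using (_⊎_; inj₁; inj₂; [_,_]′)
  open import Function.Base using (_∘_)
  open import Relation.Binary.PropositionalEquality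
  open import Relation.Nullary using (¬_; yes; no; contradiction)
  open import Relation.Nullary.Decidable using (dec-true; dec-false)
  import Tactic.RingSolver as Solver

  open CommutativeRing polyRing public
    using ()
    renaming (*-cong to *ᵖ-cong; *-identityʳ to *ᵖ-identityʳ; distribˡ to *ᵖ-distribˡ)

  DegreeBelow : ℕ → Poly → Set
  DegreeBelow n p = ∀ i → n ≤ i → coeff p i ≡ 0ℤ

  -- `deg` gives the zero polynomial degree 0 and is not additive there. The relation excludes zero,
  -- so it is additive under products and certifies that a polynomial can be cancelled.
  record HasDegree (p : Poly) (n : ℕ) : Set where
    constructor hasDegree
    field
      leading≢0 : coeff p n ≢ 0ℤ
      vanishing : DegreeBelow (suc n) p
  open HasDegree public

  degreeBelow-cong : ∀ {n p q} → p ≋ q → DegreeBelow n p → DegreeBelow n q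
  degreeBelow-cong (mk e) z i n≤i = trans (sym (e i)) (z i n≤i)

  degreeBelow-+ : ∀ {n} p q → DegreeBelow n p → DegreeBelow n q → DegreeBelow n (p +ᵖ q)
  degreeBelow-+ p q y z i n≤i = trans (coeff-+ p q i) (cong₂ ℤ._+_ (y i n≤i) (z i n≤i))

  degreeBelow-scale : ∀ {n} a p → DegreeBelow n p → DegreeBelow n (a · p)
  degreeBelow-scale a p z i n≤i =
    trans (coeff-scale a p i) (trans (cong (a ℤ.*_) (z i n≤i)) (ℤ.*-zeroʳ a))

  degreeBelow-∷ : ∀ {n} a p → DegreeBelow n p → DegreeBelow (suc n) (a ∷ p)
  degreeBelow-∷ a p z (suc i) (s≤s n≤i) = z i n≤i

  degreeBelow-tail : ∀ {n} a p → DegreeBelow (suc n) (a ∷ p) → DegreeBelow n p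
  degreeBelow-tail a p z i n≤i = z (suc i) (s≤s n≤i)

  degreeBelow-0 : ∀ p → DegreeBelow 0 p → p ≋ []
  degreeBelow-0 p z = mk λ i → z i z≤n

  -- Only bounds on the degrees are assumed, so that factors which may vanish are covered, such as
  -- the constant `C a₀` in `pseudo-divide`.
  leading-* : ∀ {m n} p q → DegreeBelow (suc m) p → DegreeBelow (suc n) q →
    coeff (p *ᵖ q) (m ℕ.+ n) ≡ coeff p m ℤ.* coeff q n × DegreeBelow (suc (m ℕ.+ n)) (p *ᵖ q)
  leading-* {m} {n} [] q y z = sym (ℤ.*-zeroˡ (coeff q n)) , λ _ _ → refl
  leading-* {zero} {n} (a ∷ p) q y z =
    trans (_≋_.at a·q n) (coeff-scale a q n) ,
    degreeBelow-cong (≋.sym a·q) (degreeBelow-scale a q z)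
    where
    a·q : (a ∷ p) *ᵖ q ≋ a · q
    a·q = ≋.trans
      (+ᵖ-congˡ (a · q)
        (≋.trans (∷-cong refl (zero-*ᵖ q (degreeBelow-0 p (degreeBelow-tail a p y)))) 0∷[]≋[]))
      (+ᵖ-identityʳ (a · q))
  leading-* {suc m} {n} (a ∷ p) q y z =
    (begin
      coeff (a · q +ᵖ (0ℤ ∷ p *ᵖ q)) (suc (m ℕ.+ n))
        ≡⟨ coeff-+ (a · q) (0ℤ ∷ p *ᵖ q) (suc (m ℕ.+ n)) ⟩
      coeff (a · q) (suc (m ℕ.+ n)) ℤ.+ coeff (p *ᵖ q) (m ℕ.+ n)
        ≡⟨ cong₂ ℤ._+_ (degreeBelow-scale a q z _ (s≤s (ℕ.m≤n+m n m))) (proj₁ ih) ⟩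
      0ℤ ℤ.+ coeff p m ℤ.* coeff q n
        ≡⟨ ℤ.+-identityˡ _ ⟩
      coeff p m ℤ.* coeff q n
        ∎) ,
    degreeBelow-+ (a · q) (0ℤ ∷ p *ᵖ q)
      (λ i le → degreeBelow-scale a q z i (ℕ.≤-trans (s≤s (ℕ.m≤n+m n (suc m))) le))
      (degreeBelow-∷ 0ℤ (p *ᵖ q) (proj₂ ih))
    where
    open ≡-Reasoning
    ih = leading-* p q (degreeBelow-tail a p y) z

  hasDegree-cong : ∀ {p q n} → p ≋ q → HasDegree p n → HasDegree q n
  hasDegree-cong e (hasDegree l b) =
    hasDegree (l ∘ trans (_≋_.at e _)) (degreeBelow-cong e b)

  hasDegree-* : ∀ {p q m n} → HasDegree p m → HasDegree q n → HasDegree (p *ᵖ q) (m ℕ.+ n)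
  hasDegree-* {p} {q} (hasDegree k y) (hasDegree l z) with leading-* p q y z
  ... | top , b = hasDegree ([ k , l ]′ ∘ ℤ.i*j≡0⇒i≡0∨j≡0 _ ∘ trans (sym top)) b

  hasDegree? : ∀ p → p ≋ [] ⊎ ∃[ n ] HasDegree p n
  hasDegree? [] = inj₁ ≋.refl
  hasDegree? (a ∷ p) with hasDegree? p | a ℤ.≟ 0ℤ
  ... | inj₂ (n , hasDegree l b) | _ = inj₂ (suc n , hasDegree l (degreeBelow-∷ a p b))
  ... | inj₁ e | yes refl = inj₁ (≋.trans (∷-cong refl e) 0∷[]≋[])
  ... | inj₁ e | no a≢0   = inj₂ (0 , hasDegree a≢0 (degreeBelow-∷ a p λ i _ → _≋_.at e i))

  ¬hasDegree-0 : ∀ {p n} → p ≋ [] → ¬ HasDegree p n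
  ¬hasDegree-0 e d = leading≢0 d (_≋_.at e _)

  hasDegree-unique : ∀ {p m n} → HasDegree p m → HasDegree p n → m ≡ n
  hasDegree-unique d d′ = ℕ.≤-antisym (bound d d′) (bound d′ d)
    where
    bound : ∀ {p m n} → HasDegree p m → HasDegree p n → m ≤ n
    bound d d′ = ℕ.≮⇒≥ (leading≢0 d ∘ vanishing d′ _)

  hasDegree-factor : ∀ {f n} p q → HasDegree f n → f ≋ p *ᵖ q →
    ∃[ a ] ∃[ b ] HasDegree p a × HasDegree q b × a ℕ.+ b ≡ n
  hasDegree-factor p q d f≋pq with hasDegree? p | hasDegree? q
  ... | inj₁ e        | _             = ⊥-elim (¬hasDegree-0 (≋.trans f≋pq (zero-*ᵖ q e)) d)
  ... | inj₂ _        | inj₁ e        =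
    ⊥-elim (¬hasDegree-0 (≋.trans f≋pq (≋.trans (*ᵖ-congˡ p e) (*ᵖ-zeroʳ p))) d)
  ... | inj₂ (a , dp) | inj₂ (b , dq) =
    a , b , dp , dq , hasDegree-unique (hasDegree-cong (≋.sym f≋pq) (hasDegree-* dp dq)) d

  all-zero⇒≋[] : ∀ {p} → All (_≡ 0ℤ) p → p ≋ []
  all-zero⇒≋[] []         = ≋.refl
  all-zero⇒≋[] (refl ∷ z) = ≋.trans (∷-cong refl (all-zero⇒≋[] z)) 0∷[]≋[]

  ≋[]⇒all-zero : ∀ p → p ≋ [] → All (_≡ 0ℤ) p
  ≋[]⇒all-zero []      e = []
  ≋[]⇒all-zero (a ∷ p) e = _≋_.at e 0 ∷ ≋[]⇒all-zero p (≋[]-tail e)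

  deg-0 : ∀ p → p ≋ [] → deg p ≡ 0
  deg-0 []      e = refl
  deg-0 (a ∷ p) e
    rewrite dec-true (all? (ℤ._≟ 0ℤ) p) (≋[]⇒all-zero p (≋[]-tail e)) = refl

  hasDegree⇒deg : ∀ {n} p → HasDegree p n → deg p ≡ n
  hasDegree⇒deg []      d = contradiction refl (leading≢0 d)
  hasDegree⇒deg {zero} (a ∷ p) d
    rewrite dec-true (all? (ℤ._≟ 0ℤ) p)
              (≋[]⇒all-zero p (degreeBelow-0 p (degreeBelow-tail a p (vanishing d)))) = refl
  hasDegree⇒deg {suc n} (a ∷ p) d
    rewrite dec-false (all? (ℤ._≟ 0ℤ) p) (λ z → leading≢0 d (_≋_.at (all-zero⇒≋[] z) n)) =
    cong suc (hasDegree⇒deg p (hasDegree (leading≢0 d) (degreeBelow-tail a p (vanishing d))))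

  hasDegree-C : ∀ {a} → a ≢ 0ℤ → HasDegree (C a) 0
  hasDegree-C {a} a≢0 = hasDegree a≢0 (degreeBelow-∷ a [] λ _ _ → refl)

  hasDegree-1 : HasDegree (C 1ℤ) 0
  hasDegree-1 = hasDegree-C λ ()

  hasDegree-X : HasDegree X 1
  hasDegree-X = hasDegree (λ ()) (degreeBelow-∷ 0ℤ (C 1ℤ) (degreeBelow-∷ 1ℤ [] λ _ _ → refl))

  hasDegree-^ : ∀ {p m} n → HasDegree p m → HasDegree (p ^ n) (n ℕ.* m)
  hasDegree-^ zero    d = hasDegree-1
  hasDegree-^ (suc n) d = hasDegree-* d (hasDegree-^ n d)

  hasDegree-X^ : ∀ n → HasDegree (X ^ n) n
  hasDegree-X^ n = subst (HasDegree (X ^ n)) (ℕ.*-identityʳ n) (hasDegree-^ n hasDegree-X)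

  hasDegree-+C : ∀ {p n} b → HasDegree p (suc n) → HasDegree (p +ᵖ C b) (suc n)
  hasDegree-+C {p} {n} b (hasDegree l z) = hasDegree
    (l ∘ trans (sym (trans (coeff-+ p (C b) (suc n)) (ℤ.+-identityʳ _))))
    (degreeBelow-+ p (C b) z (λ { (suc i) _ → refl }))

  -- If q - r had a degree, so would its product with p, which vanishes.
  *ᵖ-cancelˡ : ∀ {p n} q r → HasDegree p n → p *ᵖ q ≋ p *ᵖ r → q ≋ r
  *ᵖ-cancelˡ {p} q r d e with hasDegree? (q +ᵖ -ᵖ r)
  ... | inj₂ (_ , d′) = ⊥-elim (¬hasDegree-0 vanish (hasDegree-* d d′))
    where
    expand : ∀ p q r → p *ᵖ (q +ᵖ -ᵖ r) ≋ p *ᵖ q +ᵖ -ᵖ (p *ᵖ r)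
    expand = Solver.solve-∀ polySolverRing
    vanish : p *ᵖ (q +ᵖ -ᵖ r) ≋ []
    vanish = ≋.trans (expand p q r)
      (≋.trans (+ᵖ-cong e (≋.refl { -ᵖ (p *ᵖ r)})) (+ᵖ-inverseʳ (p *ᵖ r)))
  ... | inj₁ z = ≋.trans (regroup q r) (+ᵖ-cong z (≋.refl {r}))
    where
    regroup : ∀ q r → q ≋ (q +ᵖ -ᵖ r) +ᵖ r
    regroup = Solver.solve-∀ polySolverRing

  C-*C : ∀ a b → C (a ℤ.* b) ≋ C a *ᵖ C b
  C-*C a b = ∷-cong (sym (ℤ.+-identityʳ (a ℤ.* b))) ≋.refl

  ⟨⟩-+ : ∀ p q g → (p +ᵖ q) ⟨ g ⟩ ≋ p ⟨ g ⟩ +ᵖ q ⟨ g ⟩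
  ⟨⟩-+ []      q       g = ≋.refl
  ⟨⟩-+ (a ∷ p) []      g = ≋.sym (+ᵖ-identityʳ _)
  ⟨⟩-+ (a ∷ p) (b ∷ q) g = begin
    (C a +ᵖ C b) +ᵖ g *ᵖ (p +ᵖ q) ⟨ g ⟩
      ≈⟨ +ᵖ-congˡ (C a +ᵖ C b) (*ᵖ-congˡ g (⟨⟩-+ p q g)) ⟩
    (C a +ᵖ C b) +ᵖ g *ᵖ (p ⟨ g ⟩ +ᵖ q ⟨ g ⟩)
      ≈⟨ regroup (C a) (C b) g (p ⟨ g ⟩) (q ⟨ g ⟩) ⟩
    (C a +ᵖ g *ᵖ p ⟨ g ⟩) +ᵖ (C b +ᵖ g *ᵖ q ⟨ g ⟩)
      ∎
    where
    open ≋-Reasoning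
    regroup : ∀ a b g p q → (a +ᵖ b) +ᵖ g *ᵖ (p +ᵖ q) ≋ (a +ᵖ g *ᵖ p) +ᵖ (b +ᵖ g *ᵖ q)
    regroup = Solver.solve-∀ polySolverRing

  ⟨⟩-· : ∀ a p g → (a · p) ⟨ g ⟩ ≋ C a *ᵖ p ⟨ g ⟩
  ⟨⟩-· a []      g = ≋.sym (*ᵖ-zeroʳ (C a))
  ⟨⟩-· a (b ∷ p) g = begin
    C (a ℤ.* b) +ᵖ g *ᵖ (a · p) ⟨ g ⟩
      ≈⟨ +ᵖ-cong (C-*C a b) (*ᵖ-congˡ g (⟨⟩-· a p g)) ⟩
    C a *ᵖ C b +ᵖ g *ᵖ (C a *ᵖ p ⟨ g ⟩)
      ≈⟨ regroup (C a) (C b) g (p ⟨ g ⟩) ⟩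
    C a *ᵖ (C b +ᵖ g *ᵖ p ⟨ g ⟩)
      ∎
    where
    open ≋-Reasoning
    regroup : ∀ a b g p → a *ᵖ b +ᵖ g *ᵖ (a *ᵖ p) ≋ a *ᵖ (b +ᵖ g *ᵖ p)
    regroup = Solver.solve-∀ polySolverRing

  ⟨⟩-* : ∀ p q g → (p *ᵖ q) ⟨ g ⟩ ≋ p ⟨ g ⟩ *ᵖ q ⟨ g ⟩
  ⟨⟩-* []      q g = ≋.refl
  ⟨⟩-* (a ∷ p) q g = begin
    (a · q +ᵖ (0ℤ ∷ p *ᵖ q)) ⟨ g ⟩
      ≈⟨ ⟨⟩-+ (a · q) (0ℤ ∷ p *ᵖ q) g ⟩
    (a · q) ⟨ g ⟩ +ᵖ (C 0ℤ +ᵖ g *ᵖ (p *ᵖ q) ⟨ g ⟩)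
      ≈⟨ +ᵖ-cong (⟨⟩-· a q g) (+ᵖ-cong 0∷[]≋[] (*ᵖ-congˡ g (⟨⟩-* p q g))) ⟩
    C a *ᵖ q ⟨ g ⟩ +ᵖ g *ᵖ (p ⟨ g ⟩ *ᵖ q ⟨ g ⟩)
      ≈⟨ regroup (C a) (q ⟨ g ⟩) g (p ⟨ g ⟩) ⟩
    (C a +ᵖ g *ᵖ p ⟨ g ⟩) *ᵖ q ⟨ g ⟩
      ∎
    where
    open ≋-Reasoning
    regroup : ∀ a q g p → a *ᵖ q +ᵖ g *ᵖ (p *ᵖ q) ≋ (a +ᵖ g *ᵖ p) *ᵖ q
    regroup = Solver.solve-∀ polySolverRing

  ⟨⟩-C : ∀ a g → C a ⟨ g ⟩ ≋ C a
  ⟨⟩-C a g = ≋.trans (+ᵖ-congˡ (C a) (*ᵖ-zeroʳ g)) ≋.refl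

  ⟨⟩-X : ∀ g → X ⟨ g ⟩ ≋ g
  ⟨⟩-X g = ≋.trans (+ᵖ-cong 0∷[]≋[] (≋.trans (*ᵖ-congˡ g (⟨⟩-C 1ℤ g)) (*ᵖ-identityʳ g))) ≋.refl

  ^-cong : ∀ {p q} n → p ≋ q → p ^ n ≋ q ^ n
  ^-cong zero    e = ≋.refl
  ^-cong (suc n) e = *ᵖ-cong e (^-cong n e)

  ⟨⟩-^ : ∀ p n g → (p ^ n) ⟨ g ⟩ ≋ (p ⟨ g ⟩) ^ n
  ⟨⟩-^ p zero    g = ⟨⟩-C 1ℤ g
  ⟨⟩-^ p (suc n) g = ≋.trans (⟨⟩-* p (p ^ n) g) (*ᵖ-congˡ (p ⟨ g ⟩) (⟨⟩-^ p n g))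

  ⟨⟩-∏ : ∀ {n} (p : Fin n → Poly) g → ∏ᵖ p ⟨ g ⟩ ≋ ∏ᵖ (λ i → p i ⟨ g ⟩)
  ⟨⟩-∏ {zero}  p g = ⟨⟩-C 1ℤ g
  ⟨⟩-∏ {suc n} p g =
    ≋.trans (⟨⟩-* (p zero) (∏ᵖ (p ∘ suc)) g) (*ᵖ-congˡ (p zero ⟨ g ⟩) (⟨⟩-∏ (p ∘ suc) g))

-- Gauss's lemma and the degrees of irreducible factors

module IrreducibleFactors where
  open import Defs
  open PolynomialRing
  open Degree
  open import Algebra.Definitions.RawMagma using (_,_)
  open import Data.Empty using (⊥-elim)
  open import Data.Fin.Base using (Fin; zero; suc)
  open import Data.Integer.Base as ℤ using (ℤ; 0ℤ; 1ℤ; +_; ∣_∣)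
  import Data.Integer.Divisibility.Signed as ℤ∣
  import Data.Integer.Properties as ℤ
  open import Data.List.Base using (List; []; _∷_)
  open import Data.List.Relation.Unary.All using (All; []; _∷_)
  import Data.Nat.ListAction as List
  open import Data.Nat.Base as ℕ using (ℕ; zero; suc; _≤_; _<_; z≤n; s≤s)
  open import Data.Nat.Primality using (Prime; euclidsLemma; prime⇒nonZero)
  open import Data.Nat.Primality.Factorisation using (factorise)
  open Data.Nat.Primality.Factorisation.PrimeFactorisation
  import Data.Nat.Properties as ℕ
  open import Data.Product.Base using (∃-syntax; _×_; _,_; proj₂)
  open import Data.Sum.Base as Sum using (_⊎_; inj₁; inj₂; [_,_]′)
  open import Function.Base using (_∘_)
  open import Relation.Binary.PropositionalEquality
  open import Relation.Nullary using (yes; no)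
  import Tactic.RingSolver as Solver

  infix 4 _∣ᶜ_
  -- A factorisation rather than a condition on the coefficients: `clear-primes` continues with the
  -- cofactor.
  _∣ᶜ_ : ℤ → Poly → Set
  c ∣ᶜ p = ∃[ p′ ] C c *ᵖ p′ ≋ p

  ∣ᶜ-∷ : ∀ {c} a p → c ℤ∣.∣ a → c ∣ᶜ p → c ∣ᶜ a ∷ p
  ∣ᶜ-∷ {c} a p (ℤ∣.divides x eq) (p′ , e) =
    x ∷ p′ ,
    ≋.trans (C-* c (x ∷ p′))
      (∷-cong (trans (ℤ.*-comm c x) (sym eq)) (≋.trans (≋.sym (C-* c p′)) e))

  ∣ᶜ-head : ∀ {c a p} → c ∣ᶜ a ∷ p → c ℤ∣.∣ a
  ∣ᶜ-head {c} (p′ , e) = ℤ∣.divides (coeff p′ 0)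
    (trans (sym (_≋_.at e 0))
      (trans (_≋_.at (C-* c p′) 0) (trans (coeff-scale c p′ 0) (ℤ.*-comm c (coeff p′ 0)))))

  ∣ᶜ-tail : ∀ {c a p} → c ∣ᶜ a ∷ p → c ∣ᶜ p
  ∣ᶜ-tail {c} ([] , e) = [] , ≋.trans (*ᵖ-zeroʳ (C c)) (≋.sym (≋[]-tail (≋.trans (≋.sym e) (*ᵖ-zeroʳ (C c)))))
  ∣ᶜ-tail {c} {a} {p} (x ∷ p′ , e) =
    p′ , ≋.trans (C-* c p′) (mk λ n → trans (sym (_≋_.at (C-* c (x ∷ p′)) (suc n))) (_≋_.at e (suc n)))

  ∣ᶜ-cancel : ∀ {c a} p q r → c ℤ∣.∣ a → c ∣ᶜ r → r ≋ a · p +ᵖ (0ℤ ∷ q) → c ∣ᶜ q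
  ∣ᶜ-cancel {c} p q r (ℤ∣.divides x refl) (r′ , e) f =
    ∣ᶜ-tail {c} {0ℤ} {q} (r′ +ᵖ -ᵖ (C x *ᵖ p) , (begin
      C c *ᵖ (r′ +ᵖ -ᵖ (C x *ᵖ p))                      ≈⟨ expand (C c) r′ (C x) p ⟩
      C c *ᵖ r′ +ᵖ -ᵖ ((C x *ᵖ C c) *ᵖ p)               ≈⟨ +ᵖ-cong (≋.trans e f) (-ᵖ-cong (≋.trans (*ᵖ-congʳ p (≋.sym (C-*C x c))) (C-* (x ℤ.* c) p))) ⟩
      (x ℤ.* c) · p +ᵖ (0ℤ ∷ q) +ᵖ -ᵖ ((x ℤ.* c) · p)   ≈⟨ drop ((x ℤ.* c) · p) (0ℤ ∷ q) ⟩
      0ℤ ∷ q                                            ∎))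
    where
    open ≋-Reasoning
    expand : ∀ c r x p → c *ᵖ (r +ᵖ -ᵖ (x *ᵖ p)) ≋ c *ᵖ r +ᵖ -ᵖ ((x *ᵖ c) *ᵖ p)
    expand = Solver.solve-∀ polySolverRing
    drop : ∀ s q → s +ᵖ q +ᵖ -ᵖ s ≋ q
    drop = Solver.solve-∀ polySolverRing

  prime-∣-* : ∀ {π} a b → Prime π → + π ℤ∣.∣ a ℤ.* b → + π ℤ∣.∣ a ⊎ + π ℤ∣.∣ b
  prime-∣-* {π} a b pr d with euclidsLemma ∣ a ∣ ∣ b ∣ pr (subst (π ℕ∣.∣_) (ℤ.abs-* a b) (ℤ∣.∣⇒∣ᵤ d))
    where import Data.Nat.Divisibility as ℕ∣
  ... | inj₁ x = inj₁ (ℤ∣.∣ᵤ⇒∣ x)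
  ... | inj₂ y = inj₂ (ℤ∣.∣ᵤ⇒∣ y)

  -- The constant term of the product is ab. If π divides neither a nor b, it does not divide ab. If
  -- it divides a, then dropping a from its factor leaves a product that π still divides, and
  -- induction applies to the shorter factor; likewise for b.
  gauss : ∀ {π} p q → Prime π → + π ∣ᶜ p *ᵖ q → + π ∣ᶜ p ⊎ + π ∣ᶜ q
  gauss {π} []      q       pr d = inj₁ ([] , *ᵖ-zeroʳ (C (+ π)))
  gauss {π} (a ∷ p) []      pr d = inj₂ ([] , *ᵖ-zeroʳ (C (+ π)))
  gauss {π} (a ∷ p) (b ∷ q) pr d = step (gauss p (b ∷ q) pr) (gauss (a ∷ p) q pr)
    where
    step : (+ π ∣ᶜ p *ᵖ (b ∷ q) → + π ∣ᶜ p ⊎ + π ∣ᶜ b ∷ q) → (+ π ∣ᶜ (a ∷ p) *ᵖ q → + π ∣ᶜ a ∷ p ⊎ + π ∣ᶜ q) →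
      + π ∣ᶜ a ∷ p ⊎ + π ∣ᶜ b ∷ q
    step ih₁ ih₂ with + π ℤ∣.∣? a | + π ℤ∣.∣? b
    ... | yes π∣a | _ = Sum.map₁ (∣ᶜ-∷ a p π∣a)
      (ih₁ (∣ᶜ-cancel (b ∷ q) (p *ᵖ (b ∷ q)) ((a ∷ p) *ᵖ (b ∷ q)) π∣a d ≋.refl))
    ... | no _ | yes π∣b = Sum.map₂ (∣ᶜ-∷ b q π∣b)
      (ih₂ (∣ᶜ-cancel (a ∷ p) ((a ∷ p) *ᵖ q) ((a ∷ p) *ᵖ (b ∷ q)) π∣b d (*ᵖ-∷ (a ∷ p) b q)))
    ... | no π∤a | no π∤b =
      ⊥-elim ([ π∤a , π∤b ]′ (prime-∣-* a b pr (subst (+ π ℤ∣.∣_) (ℤ.+-identityʳ (a ℤ.* b)) (∣ᶜ-head d))))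

  NonzeroConstant : Poly → Set
  NonzeroConstant κ = HasDegree κ 0

  -- c h = e e′ in ℤ[t] gives a factorisation of h itself: by Gauss's lemma
  -- the prime factors of c can be cancelled one at a time.
  record Cleared (h e e′ : Poly) : Set where
    constructor cleared
    field
      κ κ′ e₁ e₁′ : Poly
      const  : NonzeroConstant κ
      const′ : NonzeroConstant κ′
      e≋     : e ≋ κ *ᵖ e₁
      e′≋    : e′ ≋ κ′ *ᵖ e₁′
      h≋     : h ≋ e₁ *ᵖ e₁′

  clear-primes : ∀ ps → All Prime ps → ∀ h e e′ → C (+ List.product ps) *ᵖ h ≋ e *ᵖ e′ → Cleared h e e′
  clear-primes [] [] h e e′ eq = cleared (C 1ℤ) (C 1ℤ) e e′ hasDegree-1 hasDegree-1
    (≋.sym (*ᵖ-identityˡ e)) (≋.sym (*ᵖ-identityˡ e′)) (≋.trans (≋.sym (*ᵖ-identityˡ h)) eq)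
  clear-primes (π ∷ ps) (pr ∷ prs) h e e′ eq = step (gauss e e′ pr (C (+ List.product ps) *ᵖ h , pull))
    where
    open ≋-Reasoning
    assoc′ : ∀ p q r → p *ᵖ (q *ᵖ r) ≋ (p *ᵖ q) *ᵖ r
    assoc′ = Solver.solve-∀ polySolverRing
    swap : ∀ p q r → (p *ᵖ q) *ᵖ r ≋ q *ᵖ (p *ᵖ r)
    swap = Solver.solve-∀ polySolverRing
    dπ : NonzeroConstant (C (+ π))
    dπ = hasDegree-C λ π≡0 → ℕ.≢-nonZero⁻¹ π ⦃ prime⇒nonZero pr ⦄ (ℤ.+-injective π≡0)
    pull : C (+ π) *ᵖ (C (+ List.product ps) *ᵖ h) ≋ e *ᵖ e′
    pull = begin
      C (+ π) *ᵖ (C (+ List.product ps) *ᵖ h)  ≈⟨ assoc′ (C (+ π)) (C (+ List.product ps)) h ⟩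
      (C (+ π) *ᵖ C (+ List.product ps)) *ᵖ h  ≈⟨ *ᵖ-congʳ h (C-*C (+ π) (+ List.product ps)) ⟨
      C (+ π ℤ.* + List.product ps) *ᵖ h       ≡⟨ cong (λ c → C c *ᵖ h) (ℤ.pos-* π (List.product ps)) ⟨
      C (+ List.product (π ∷ ps)) *ᵖ h         ≈⟨ eq ⟩
      e *ᵖ e′                                  ∎
    π∤₁ : ∀ f → C (+ π) *ᵖ f ≋ e → C (+ List.product ps) *ᵖ h ≋ f *ᵖ e′
    π∤₁ f e≋ = *ᵖ-cancelˡ _ _ dπ (begin
      C (+ π) *ᵖ (C (+ List.product ps) *ᵖ h)  ≈⟨ pull ⟩
      e *ᵖ e′                                  ≈⟨ *ᵖ-congʳ e′ e≋ ⟨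
      (C (+ π) *ᵖ f) *ᵖ e′                     ≈⟨ assoc′ (C (+ π)) f e′ ⟨
      C (+ π) *ᵖ (f *ᵖ e′)                     ∎)
    π∤₂ : ∀ f → C (+ π) *ᵖ f ≋ e′ → C (+ List.product ps) *ᵖ h ≋ e *ᵖ f
    π∤₂ f e′≋ = *ᵖ-cancelˡ _ _ dπ (begin
      C (+ π) *ᵖ (C (+ List.product ps) *ᵖ h)  ≈⟨ pull ⟩
      e *ᵖ e′                                  ≈⟨ *ᵖ-congˡ e e′≋ ⟨
      e *ᵖ (C (+ π) *ᵖ f)                      ≈⟨ assoc′ e (C (+ π)) f ⟩
      (e *ᵖ C (+ π)) *ᵖ f                      ≈⟨ swap e (C (+ π)) f ⟩
      C (+ π) *ᵖ (e *ᵖ f)                      ∎)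
    times-π₁ : ∀ f → C (+ π) *ᵖ f ≋ e → Cleared h f e′ → Cleared h e e′
    times-π₁ f e≋ (cleared κ κ′ e₁ e₁′ c c′ f≋ e′≋ h≋) =
      cleared (C (+ π) *ᵖ κ) κ′ e₁ e₁′ (hasDegree-* dπ c) c′
        (≋.trans (≋.sym e≋) (≋.trans (*ᵖ-congˡ (C (+ π)) f≋) (assoc′ (C (+ π)) κ e₁))) e′≋ h≋
    times-π₂ : ∀ f → C (+ π) *ᵖ f ≋ e′ → Cleared h e f → Cleared h e e′
    times-π₂ f e′≋ (cleared κ κ′ e₁ e₁′ c c′ e≋ f≋ h≋) =
      cleared κ (C (+ π) *ᵖ κ′) e₁ e₁′ c (hasDegree-* dπ c′) e≋
        (≋.trans (≋.sym e′≋) (≋.trans (*ᵖ-congˡ (C (+ π)) f≋) (assoc′ (C (+ π)) κ′ e₁′))) h≋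
    step : + π ∣ᶜ e ⊎ + π ∣ᶜ e′ → Cleared h e e′
    step (inj₁ (f , e≋))  = times-π₁ f e≋ (clear-primes ps prs h f e′ (π∤₁ f e≋))
    step (inj₂ (f , e′≋)) = times-π₂ f e′≋ (clear-primes ps prs h e f (π∤₂ f e′≋))

  constant-≋ : ∀ p → DegreeBelow 1 p → p ≋ C (coeff p 0)
  constant-≋ p z = mk λ where
    zero    → refl
    (suc n) → z (suc n) (s≤s z≤n)

  clear : ∀ {κ} h e e′ → NonzeroConstant κ → κ *ᵖ h ≋ e *ᵖ e′ → Cleared h e e′
  clear {κ} h e e′ d eq = result
    where
    open ≋-Reasoning
    a = coeff κ 0
    κ≋a = constant-≋ κ (vanishing d)
    -- Prime factorisations exist for |a| only. The sign s of a is moved into e, and s² = 1 brings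
    -- it back at the end.
    sgn : ∃[ s ] C (+ ∣ a ∣) ≋ C s *ᵖ C a × NonzeroConstant (C s) × C s *ᵖ C s ≋ C 1ℤ
    sgn with a
    ... | + n      = 1ℤ , ≋.sym (*ᵖ-identityˡ (C (+ n))) , hasDegree-1 , ≋.refl
    ... | ℤ.-[1+ n ] = ℤ.- 1ℤ , mk (λ { zero → cong +_ (cong suc (sym (trans (ℕ.+-identityʳ _) (ℕ.+-identityʳ n)))) ; (suc _) → refl }) , hasDegree-C (λ ()) , ≋.refl
    factors? = factorise ∣ a ∣ ⦃ ℕ.≢-nonZero (leading≢0 d ∘ ℤ.∣i∣≡0⇒i≡0) ⦄
    result : Cleared h e e′
    result with sgn
    ... | s , ∣a∣≋ , ds , ss
      with clear-primes (factors factors?) (factorsPrime factors?) h (C s *ᵖ e) e′ (begin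
        C (+ List.product (factors factors?)) *ᵖ h  ≡⟨ cong (λ n → C (+ n) *ᵖ h) (isFactorisation factors?) ⟨
        C (+ ∣ a ∣) *ᵖ h      ≈⟨ *ᵖ-congʳ h ∣a∣≋ ⟩
        (C s *ᵖ C a) *ᵖ h     ≈⟨ *ᵖ-assoc (C s) (C a) h ⟩
        C s *ᵖ (C a *ᵖ h)     ≈⟨ *ᵖ-congˡ (C s) (*ᵖ-congʳ {κ} h κ≋a) ⟨
        C s *ᵖ (κ *ᵖ h)       ≈⟨ *ᵖ-congˡ (C s) eq ⟩
        C s *ᵖ (e *ᵖ e′)      ≈⟨ *ᵖ-assoc (C s) e e′ ⟨
        (C s *ᵖ e) *ᵖ e′      ∎)
    ... | cleared κ₁ κ′ e₁ e₁′ c c′ se≋ e′≋ h≋ =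
      cleared (C s *ᵖ κ₁) κ′ e₁ e₁′ (hasDegree-* ds c) c′
        (begin
          e                       ≈⟨ *ᵖ-identityˡ e ⟨
          C 1ℤ *ᵖ e               ≈⟨ *ᵖ-congʳ e ss ⟨
          (C s *ᵖ C s) *ᵖ e       ≈⟨ *ᵖ-assoc (C s) (C s) e ⟩
          C s *ᵖ (C s *ᵖ e)       ≈⟨ *ᵖ-congˡ (C s) se≋ ⟩
          C s *ᵖ (κ₁ *ᵖ e₁)       ≈⟨ *ᵖ-assoc (C s) κ₁ e₁ ⟨
          (C s *ᵖ κ₁) *ᵖ e₁       ∎)
        e′≋ h≋

  -- Horner's scheme on the dividend. From κ a = q b + r one gets κ (a₀ + t a) = t q b + s with s =
  -- κ a₀ + t r of degree at most m. Its coefficient σ at tᵐ is removed by passing to β s - σ b,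
  -- where β is the leading coefficient of b; so κ is a power of β.
  pseudo-divide : ∀ {b m} → HasDegree b m → ∀ a →
    ∃[ κ ] ∃[ q ] ∃[ r ] NonzeroConstant κ × κ *ᵖ a ≋ q *ᵖ b +ᵖ r × DegreeBelow m r
  pseudo-divide d [] = C 1ℤ , [] , [] , hasDegree-1 , *ᵖ-zeroʳ (C 1ℤ) , λ _ _ → refl
  pseudo-divide {b} {m} d (a₀ ∷ a) with pseudo-divide d a
  ... | κ , q , r , dκ , eq , r<m =
    C β *ᵖ κ , C β *ᵖ (X *ᵖ q) +ᵖ C σ , C β *ᵖ s +ᵖ -ᵖ (C σ *ᵖ b) ,
    hasDegree-* (hasDegree-C (leading≢0 d)) dκ , division , reduced
    where
    open ≋-Reasoning
    β = coeff b m
    s = κ *ᵖ C a₀ +ᵖ X *ᵖ r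
    σ = coeff s m
    X* : ∀ p → X *ᵖ p ≋ 0ℤ ∷ p
    X* p = ≋.trans (0∷-*ᵖ (C 1ℤ) p) (∷-cong refl (*ᵖ-identityˡ p))
    expand : ∀ β κ x a a₀ → (β *ᵖ κ) *ᵖ (a₀ +ᵖ x *ᵖ a) ≋ β *ᵖ (κ *ᵖ a₀ +ᵖ x *ᵖ (κ *ᵖ a))
    expand = Solver.solve-∀ polySolverRing
    regroup : ∀ β κ x a₀ q b r σ →
      β *ᵖ (κ *ᵖ a₀ +ᵖ x *ᵖ (q *ᵖ b +ᵖ r)) ≋
      (β *ᵖ (x *ᵖ q) +ᵖ σ) *ᵖ b +ᵖ (β *ᵖ (κ *ᵖ a₀ +ᵖ x *ᵖ r) +ᵖ -ᵖ (σ *ᵖ b))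
    regroup = Solver.solve-∀ polySolverRing
    division : (C β *ᵖ κ) *ᵖ (a₀ ∷ a) ≋ (C β *ᵖ (X *ᵖ q) +ᵖ C σ) *ᵖ b +ᵖ (C β *ᵖ s +ᵖ -ᵖ (C σ *ᵖ b))
    division = begin
      (C β *ᵖ κ) *ᵖ (a₀ ∷ a)
        ≈⟨ *ᵖ-congˡ (C β *ᵖ κ) (≋.trans (∷-cong (sym (ℤ.+-identityʳ a₀)) ≋.refl) (+ᵖ-congˡ (C a₀) (≋.sym (X* a)))) ⟩
      (C β *ᵖ κ) *ᵖ (C a₀ +ᵖ X *ᵖ a)
        ≈⟨ expand (C β) κ X a (C a₀) ⟩
      C β *ᵖ (κ *ᵖ C a₀ +ᵖ X *ᵖ (κ *ᵖ a))
        ≈⟨ *ᵖ-congˡ (C β) (+ᵖ-congˡ (κ *ᵖ C a₀) (*ᵖ-congˡ X eq)) ⟩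
      C β *ᵖ (κ *ᵖ C a₀ +ᵖ X *ᵖ (q *ᵖ b +ᵖ r))
        ≈⟨ regroup (C β) κ X (C a₀) q b r (C σ) ⟩
      (C β *ᵖ (X *ᵖ q) +ᵖ C σ) *ᵖ b +ᵖ (C β *ᵖ s +ᵖ -ᵖ (C σ *ᵖ b))
        ∎
    s≤m : DegreeBelow (suc m) s
    s≤m = degreeBelow-+ (κ *ᵖ C a₀) (X *ᵖ r)
      (λ i m<i → proj₂ (leading-* {0} {0} κ (C a₀) (vanishing dκ) (λ { (suc _) _ → refl })) i (ℕ.≤-trans (s≤s z≤n) m<i))
      (degreeBelow-cong (≋.sym (X* r)) (degreeBelow-∷ 0ℤ r r<m))
    value : ∀ i → coeff (C β *ᵖ s +ᵖ -ᵖ (C σ *ᵖ b)) i ≡ β ℤ.* coeff s i ℤ.- σ ℤ.* coeff b i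
    value i = trans (coeff-+ (C β *ᵖ s) (-ᵖ (C σ *ᵖ b)) i)
      (cong₂ ℤ._+_
        (trans (_≋_.at (C-* β s) i) (coeff-scale β s i))
        (trans (coeff-neg (C σ *ᵖ b) i) (cong ℤ.-_ (trans (_≋_.at (C-* σ b) i) (coeff-scale σ b i)))))
    reduced : DegreeBelow m (C β *ᵖ s +ᵖ -ᵖ (C σ *ᵖ b))
    reduced i m≤i with ℕ.m≤n⇒m<n∨m≡n m≤i
    ... | inj₂ refl = trans (value i) (trans (cong (ℤ._- σ ℤ.* β) (ℤ.*-comm β σ)) (ℤ.+-inverseʳ (σ ℤ.* β)))
    ... | inj₁ m<i  = trans (value i)
      (cong₂ ℤ._-_ (trans (cong (β ℤ.*_) (s≤m i m<i)) (ℤ.*-zeroʳ β))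
                   (trans (cong (σ ℤ.*_) (vanishing d i m<i)) (ℤ.*-zeroʳ σ)))

  degreeBelow-bound : ∀ {p m n} → DegreeBelow m p → HasDegree p n → n < m
  degreeBelow-bound z d = ℕ.≰⇒> (leading≢0 d ∘ z _)

  infix 4 _∈⟨_,_⟩ _∣ₚ_
  _∈⟨_,_⟩ : Poly → Poly → Poly → Set
  e ∈⟨ h , p ⟩ = ∃[ U ] ∃[ V ] e ≋ U *ᵖ h +ᵖ V *ᵖ p

  -- Divisibility in ℚ[t], with denominators cleared.
  _∣ₚ_ : Poly → Poly → Set
  e ∣ₚ p = ∃[ κ ] ∃[ p′ ] NonzeroConstant κ × κ *ᵖ p ≋ e *ᵖ p′

  remainder-∈ : ∀ {h p e κ q r U V} → e ≋ U *ᵖ h +ᵖ V *ᵖ p → ∀ x y →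
    κ *ᵖ (x *ᵖ h +ᵖ y *ᵖ p) ≋ q *ᵖ e +ᵖ r → r ∈⟨ h , p ⟩
  remainder-∈ {h} {p} {e} {κ} {q} {r} {U} {V} e∈ x y eq =
    κ *ᵖ x +ᵖ -ᵖ (q *ᵖ U) , κ *ᵖ y +ᵖ -ᵖ (q *ᵖ V) , (begin
      r                                                      ≈⟨ isolate (q *ᵖ e) r ⟩
      (q *ᵖ e +ᵖ r) +ᵖ -ᵖ (q *ᵖ e)
        ≈⟨ +ᵖ-cong (≋.sym eq) (-ᵖ-cong (*ᵖ-congˡ q e∈)) ⟩
      κ *ᵖ (x *ᵖ h +ᵖ y *ᵖ p) +ᵖ -ᵖ (q *ᵖ (U *ᵖ h +ᵖ V *ᵖ p))
        ≈⟨ collect κ x y h p q U V ⟩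
      (κ *ᵖ x +ᵖ -ᵖ (q *ᵖ U)) *ᵖ h +ᵖ (κ *ᵖ y +ᵖ -ᵖ (q *ᵖ V)) *ᵖ p  ∎)
    where
    open ≋-Reasoning
    isolate : ∀ s r → r ≋ (s +ᵖ r) +ᵖ -ᵖ s
    isolate = Solver.solve-∀ polySolverRing
    collect : ∀ κ x y h p q U V → κ *ᵖ (x *ᵖ h +ᵖ y *ᵖ p) +ᵖ -ᵖ (q *ᵖ (U *ᵖ h +ᵖ V *ᵖ p)) ≋
      (κ *ᵖ x +ᵖ -ᵖ (q *ᵖ U)) *ᵖ h +ᵖ (κ *ᵖ y +ᵖ -ᵖ (q *ᵖ V)) *ᵖ p
    collect = Solver.solve-∀ polySolverRing

  1*h+0*p : ∀ h p → C 1ℤ *ᵖ h +ᵖ [] *ᵖ p ≋ h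
  1*h+0*p h p = ≋.trans (+ᵖ-identityʳ (C 1ℤ *ᵖ h)) (*ᵖ-identityˡ h)

  0*h+1*p : ∀ h p → [] *ᵖ h +ᵖ C 1ℤ *ᵖ p ≋ p
  0*h+1*p h p = *ᵖ-identityˡ p

  -- An element of least degree in the ideal generated by h and p divides both over ℚ: a nonzero
  -- pseudo-remainder by e would lie in the ideal and have smaller degree. The bound n makes this
  -- descent structural.
  pseudo-gcd-below : ∀ h p n e m → m < n → HasDegree e m → e ∈⟨ h , p ⟩ →
    ∃[ g ] g ∈⟨ h , p ⟩ × g ∣ₚ h × g ∣ₚ p
  pseudo-gcd-below h p (suc n) e m (s≤s m≤n) d (U , V , e∈)
    with pseudo-divide d h | pseudo-divide d p
  ... | κ , q , r , dκ , eq , r<m | κ′ , q′ , r′ , dκ′ , eq′ , r′<m = step (hasDegree? r) (hasDegree? r′)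
    where
    exact : ∀ {x} (κ q r : Poly) → NonzeroConstant κ → κ *ᵖ x ≋ q *ᵖ e +ᵖ r → r ≋ [] → e ∣ₚ x
    exact κ q r dκ eq z =
      κ , q , dκ , ≋.trans eq (≋.trans (+ᵖ-congˡ (q *ᵖ e) z) (≋.trans (+ᵖ-identityʳ (q *ᵖ e)) (*ᵖ-comm q e)))
    smaller : ∀ {r k} → DegreeBelow m r → HasDegree r k → k < n
    smaller {r} r<m dr = ℕ.<-≤-trans (degreeBelow-bound {r} r<m dr) m≤n
    r∈ : r ∈⟨ h , p ⟩
    r∈ = remainder-∈ {h} {p} {e} {κ} {q} {r} {U} {V} e∈ (C 1ℤ) [] (≋.trans (*ᵖ-congˡ κ (1*h+0*p h p)) eq)
    r′∈ : r′ ∈⟨ h , p ⟩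
    r′∈ = remainder-∈ {h} {p} {e} {κ′} {q′} {r′} {U} {V} e∈ [] (C 1ℤ) (≋.trans (*ᵖ-congˡ κ′ (0*h+1*p h p)) eq′)
    step : r ≋ [] ⊎ ∃[ k ] HasDegree r k → r′ ≋ [] ⊎ ∃[ k ] HasDegree r′ k →
      ∃[ g ] g ∈⟨ h , p ⟩ × g ∣ₚ h × g ∣ₚ p
    step (inj₂ (k , dr)) _ = pseudo-gcd-below h p n r k (smaller r<m dr) dr r∈
    step (inj₁ z) (inj₂ (k , dr)) = pseudo-gcd-below h p n r′ k (smaller r′<m dr) dr r′∈
    step (inj₁ z) (inj₁ z′) = e , (U , V , e∈) , exact {h} κ q r dκ eq z , exact {p} κ′ q′ r′ dκ′ eq′ z′

  unit-constant : ∀ {e} → e ∣ C 1ℤ → NonzeroConstant e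
  unit-constant {e} (q , eq) with hasDegree-factor q e hasDegree-1 (≋.sym (mk eq))
  ... | zero , zero , _ , d , _ = d

  constant-gcd : ∀ {h p q w e} → NonzeroConstant e → e ∈⟨ h , p ⟩ → p *ᵖ q ≋ h *ᵖ w → h ∣ₚ q
  constant-gcd {h} {p} {q} {w} {e} d (U , V , e∈) pq≋hw = e , U *ᵖ q +ᵖ V *ᵖ w , d , (begin
    e *ᵖ q                                ≈⟨ *ᵖ-congʳ q e∈ ⟩
    (U *ᵖ h +ᵖ V *ᵖ p) *ᵖ q               ≈⟨ expand U h V p q ⟩
    h *ᵖ (U *ᵖ q) +ᵖ V *ᵖ (p *ᵖ q)        ≈⟨ +ᵖ-congˡ (h *ᵖ (U *ᵖ q)) (*ᵖ-congˡ V pq≋hw) ⟩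
    h *ᵖ (U *ᵖ q) +ᵖ V *ᵖ (h *ᵖ w)        ≈⟨ collect h U q V w ⟩
    h *ᵖ (U *ᵖ q +ᵖ V *ᵖ w)               ∎)
    where
    open ≋-Reasoning
    expand : ∀ U h V p q → (U *ᵖ h +ᵖ V *ᵖ p) *ᵖ q ≋ h *ᵖ (U *ᵖ q) +ᵖ V *ᵖ (p *ᵖ q)
    expand = Solver.solve-∀ polySolverRing
    collect : ∀ h U q V w → h *ᵖ (U *ᵖ q) +ᵖ V *ᵖ (h *ᵖ w) ≋ h *ᵖ (U *ᵖ q +ᵖ V *ᵖ w)
    collect = Solver.solve-∀ polySolverRing

  constant-cofactor : ∀ {h p e κ h′} → NonzeroConstant h′ → κ *ᵖ h ≋ e *ᵖ h′ → e ∣ₚ p → h ∣ₚ p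
  constant-cofactor {h} {p} {e} {κ} {h′} d κh≋ (κ′ , p′ , dκ′ , κ′p≋) =
    h′ *ᵖ κ′ , κ *ᵖ p′ , hasDegree-* d dκ′ , (begin
      (h′ *ᵖ κ′) *ᵖ p                       ≈⟨ *ᵖ-assoc h′ κ′ p ⟩
      h′ *ᵖ (κ′ *ᵖ p)                       ≈⟨ *ᵖ-congˡ h′ κ′p≋ ⟩
      h′ *ᵖ (e *ᵖ p′)                       ≈⟨ pair h′ e p′ ⟩
      (e *ᵖ h′) *ᵖ p′                       ≈⟨ *ᵖ-congʳ p′ κh≋ ⟨
      (κ *ᵖ h) *ᵖ p′                        ≈⟨ pair′ κ h p′ ⟩
      h *ᵖ (κ *ᵖ p′)                        ∎)
    where
    open ≋-Reasoning
    pair : ∀ h e p → h *ᵖ (e *ᵖ p) ≋ (e *ᵖ h) *ᵖ p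
    pair = Solver.solve-∀ polySolverRing
    pair′ : ∀ κ h p → (κ *ᵖ h) *ᵖ p ≋ h *ᵖ (κ *ᵖ p)
    pair′ = Solver.solve-∀ polySolverRing

  -- Let e be a gcd of h and p over ℚ. Clearing constants in κ h = e h′ yields a factorisation of h
  -- in ℤ[t], one factor of which is a unit. Either e is constant, and a Bézout relation multiplied
  -- by q shows that h divides q; or h′ is constant, so that h is e up to constants and divides p.
  irreducible-∣-* : ∀ {h n} p q w → Irreducible h → HasDegree h n → p *ᵖ q ≋ h *ᵖ w → h ∣ₚ p ⊎ h ∣ₚ q
  irreducible-∣-* {h} {n} p q w irr dh pq≋hw =
    let e , e∈ , (κ , h′ , dκ , κh≋) , e∣p =
          pseudo-gcd-below h p (suc n) h n ℕ.≤-refl dh (C 1ℤ , [] , ≋.sym (1*h+0*p h p))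
    in split {e} {κ} {h′} e∈ κh≋ e∣p (clear h e h′ dκ κh≋)
    where
    split : ∀ {e κ h′} → e ∈⟨ h , p ⟩ → κ *ᵖ h ≋ e *ᵖ h′ → e ∣ₚ p → Cleared h e h′ → h ∣ₚ p ⊎ h ∣ₚ q
    split {e} {κ} {h′} e∈ κh≋ e∣p (cleared μ μ′ e₁ h₁ dμ dμ′ e≋ h′≋ h≋) with Irreducible.split-∣1 irr (_≋_.at h≋)
    ... | inj₁ e₁∣1 =
      inj₂ (constant-gcd {h} {p} {q} {w} {e} (hasDegree-cong (≋.sym e≋) (hasDegree-* dμ (unit-constant e₁∣1))) e∈ pq≋hw)
    ... | inj₂ h₁∣1 =
      inj₁ (constant-cofactor {h} {p} {e} {κ} {h′} (hasDegree-cong (≋.sym h′≋) (hasDegree-* dμ′ (unit-constant h₁∣1))) κh≋ e∣p)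

  ∣ₚ-degree : ∀ {h p m n} → HasDegree h m → HasDegree p n → h ∣ₚ p → m ≤ n
  ∣ₚ-degree {h} {p} {m} {n} dh dp (κ , p′ , dκ , eq) with hasDegree-factor h p′ (hasDegree-* dκ dp) eq
  ... | a , b , da , db , a+b≡n with refl ← hasDegree-unique dh da =
    ℕ.≤-trans (ℕ.m≤m+n a b) (ℕ.≤-reflexive a+b≡n)

  -- The constant κ is there for the induction: h divides the product of the remaining factors over
  -- ℚ only. It is counted with the first factor, whose degree it does not change.
  irreducible-factor-degree : ∀ {h n D κ B m} (p : Fin m → Poly) w →
    Irreducible h → HasDegree h n → NonzeroConstant κ → HasDegree (∏ᵖ p) D →
    κ *ᵖ ∏ᵖ p ≋ h *ᵖ w → (∀ i → deg (p i) ≤ B) → n ≤ B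
  irreducible-factor-degree {κ = κ} {m = zero} p w irr dh dκ dp eq bound =
    ℕ.≤-trans (∣ₚ-degree {p = C 1ℤ} dh hasDegree-1 (κ , w , dκ , eq)) z≤n
  irreducible-factor-degree {h} {n} {D} {κ} {B} {suc m} p w irr dh dκ dp eq bound =
    step (hasDegree-factor (p zero) (∏ᵖ (p ∘ suc)) dp ≋.refl)
         (irreducible-∣-* (κ *ᵖ p zero) (∏ᵖ (p ∘ suc)) w irr dh
           (≋.trans (*ᵖ-assoc κ (p zero) (∏ᵖ (p ∘ suc))) eq))
    where
    step : ∃[ a ] ∃[ b ] HasDegree (p zero) a × HasDegree (∏ᵖ (p ∘ suc)) b × a ℕ.+ b ≡ D →
      h ∣ₚ κ *ᵖ p zero ⊎ h ∣ₚ ∏ᵖ (p ∘ suc) → n ≤ B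
    step (a , b , da , db , _) (inj₁ h∣) =
      ℕ.≤-trans (∣ₚ-degree {p = κ *ᵖ p zero} dh (hasDegree-* dκ da) h∣)
                (subst (_≤ B) (hasDegree⇒deg (p zero) da) (bound zero))
    step (a , b , da , db , _) (inj₂ (κ′ , w′ , dκ′ , eq′)) =
      irreducible-factor-degree {κ = κ′} (p ∘ suc) w′ irr dh dκ′ db eq′ (bound ∘ suc)

-- Cyclotomic factors of yᴺ - 1 by exact division in ℤ[t]

module CyclotomicFactors where
  open import Defs
  open PolynomialRing
  open Degree
  open import Data.Integer.Base as ℤ using (ℤ; 1ℤ)
  open import Data.List.Base using (List; []; _∷_; map; foldr; _++_)
  open import Data.List.Relation.Unary.All as All using (All; []; _∷_)
  import Data.List.Relation.Unary.All.Properties as All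
  import Data.Nat.ListAction as List
  open import Data.Nat.Base as ℕ using (ℕ; zero; suc; pred; _≤_; z≤n; s≤s)
  open import Data.Nat.Coprimality as Coprime using (Coprime; coprime-Bézout)
  open import Data.Nat.Divisibility as ℕ∣ using ()
  open import Data.Nat.GCD using (module Bézout)
  import Data.Nat.Properties as ℕ
  open import Data.Nat.Tactic.RingSolver using () renaming (solve-∀ to solveℕ)
  open import Data.Product.Base using (∃-syntax; _×_; _,_; proj₁; proj₂)
  open import Relation.Binary.PropositionalEquality
  import Tactic.RingSolver as Solver

  ^-homo-+ : ∀ p m n → p ^ (m ℕ.+ n) ≋ (p ^ m) *ᵖ (p ^ n)
  ^-homo-+ p zero    n = ≋.sym (*ᵖ-identityˡ (p ^ n))
  ^-homo-+ p (suc m) n = ≋.trans (*ᵖ-congˡ p (^-homo-+ p m n)) (≋.sym (*ᵖ-assoc p (p ^ m) (p ^ n)))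

  ^-*-assoc : ∀ p m n → (p ^ m) ^ n ≋ p ^ (m ℕ.* n)
  ^-*-assoc p m zero    = ≋.trans ≋.refl (≋.reflexive (cong (p ^_) (sym (ℕ.*-zeroʳ m))))
  ^-*-assoc p m (suc n) = ≋.trans (*ᵖ-congˡ (p ^ m) (^-*-assoc p m n))
    (≋.trans (≋.sym (^-homo-+ p m (m ℕ.* n))) (≋.reflexive (cong (p ^_) (sym (ℕ.*-suc m n)))))

  geometric : Poly → ℕ → Poly
  geometric z zero    = []
  geometric z (suc n) = C 1ℤ +ᵖ z *ᵖ geometric z n

  geometric-cong : ∀ {z z′} n → z ≋ z′ → geometric z n ≋ geometric z′ n
  geometric-cong zero    e = ≋.refl
  geometric-cong (suc n) e = +ᵖ-congˡ (C 1ℤ) (*ᵖ-cong e (geometric-cong n e))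

  geometric-+ : ∀ z m n → geometric z (m ℕ.+ n) ≋ geometric z m +ᵖ z ^ m *ᵖ geometric z n
  geometric-+ z zero    n = ≋.sym (*ᵖ-identityˡ (geometric z n))
  geometric-+ z (suc m) n = ≋.trans
    (+ᵖ-congˡ (C 1ℤ) (*ᵖ-congˡ z (geometric-+ z m n)))
    (regroup (C 1ℤ) z (geometric z m) (z ^ m) (geometric z n))
    where
    regroup : ∀ o z g w h → o +ᵖ z *ᵖ (g +ᵖ w *ᵖ h) ≋ o +ᵖ z *ᵖ g +ᵖ z *ᵖ w *ᵖ h
    regroup = Solver.solve-∀ polySolverRing

  geometric-* : ∀ z m n → geometric z (m ℕ.* n) ≋ geometric (z ^ n) m *ᵖ geometric z n
  geometric-* z zero    n = ≋.refl
  geometric-* z (suc m) n = ≋.trans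
    (geometric-+ z n (m ℕ.* n))
    (≋.trans (+ᵖ-cong (≋.sym (*ᵖ-identityˡ (geometric z n))) (*ᵖ-congˡ (z ^ n) (geometric-* z m n)))
             (regroup (C 1ℤ) (z ^ n) (geometric (z ^ n) m) (geometric z n)))
    where
    regroup : ∀ o w h g → o *ᵖ g +ᵖ w *ᵖ (h *ᵖ g) ≋ (o +ᵖ w *ᵖ h) *ᵖ g
    regroup = Solver.solve-∀ polySolverRing

  _−1 : Poly → Poly
  p −1 = p +ᵖ C (ℤ.- 1ℤ)

  geometric-sum : ∀ z n → (z −1) *ᵖ geometric z n ≋ (z ^ n) −1
  geometric-sum z zero    = ≋.trans (*ᵖ-zeroʳ (z −1)) (≋.sym 0∷[]≋[])
  geometric-sum z (suc n) = begin
    (z −1) *ᵖ (C 1ℤ +ᵖ z *ᵖ geometric z n)            ≈⟨ expand z (geometric z n) ⟩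
    z *ᵖ ((z −1) *ᵖ geometric z n) +ᵖ (z −1)          ≈⟨ +ᵖ-cong (*ᵖ-congˡ z (geometric-sum z n)) ≋.refl ⟩
    z *ᵖ ((z ^ n) −1) +ᵖ (z −1)                       ≈⟨ collect z (z ^ n) ⟩
    (z *ᵖ z ^ n) −1                                   ∎
    where
    open ≋-Reasoning
    expand : ∀ z g → (z +ᵖ C (ℤ.- 1ℤ)) *ᵖ (C 1ℤ +ᵖ z *ᵖ g) ≋
                     z *ᵖ ((z +ᵖ C (ℤ.- 1ℤ)) *ᵖ g) +ᵖ (z +ᵖ C (ℤ.- 1ℤ))
    expand = Solver.solve-∀ polySolverRing
    collect : ∀ z w → z *ᵖ (w +ᵖ C (ℤ.- 1ℤ)) +ᵖ (z +ᵖ C (ℤ.- 1ℤ)) ≋ z *ᵖ w +ᵖ C (ℤ.- 1ℤ)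
    collect = Solver.solve-∀ polySolverRing

  -- Stronger than having no common factor: if p and q are comaximal and q divides p r, then q
  -- divides r with an integral cofactor.
  Comaximal : Poly → Poly → Set
  Comaximal p q = ∃[ U ] ∃[ V ] U *ᵖ p +ᵖ V *ᵖ q ≋ C 1ℤ

  comaximal-sym : ∀ {p q} → Comaximal p q → Comaximal q p
  comaximal-sym {p} {q} (U , V , e) = V , U , ≋.trans (+ᵖ-comm (V *ᵖ q) (U *ᵖ p)) e

  comaximal-cong : ∀ {p p′ q q′} → p ≋ p′ → q ≋ q′ → Comaximal p q → Comaximal p′ q′
  comaximal-cong e f (U , V , eq) =
    U , V , ≋.trans (+ᵖ-cong (*ᵖ-congˡ U (≋.sym e)) (*ᵖ-congˡ V (≋.sym f))) eq

  comaximal-divisors : ∀ {p p′ q q′ x y} → x *ᵖ p ≋ p′ → y *ᵖ q ≋ q′ → Comaximal p′ q′ → Comaximal p q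
  comaximal-divisors {p} {p′} {q} {q′} {x} {y} e f (U , V , eq) =
    U *ᵖ x , V *ᵖ y ,
    ≋.trans (+ᵖ-cong (≋.trans (*ᵖ-assoc U x p) (*ᵖ-congˡ U e)) (≋.trans (*ᵖ-assoc V y q) (*ᵖ-congˡ V f))) eq

  -- Splitting off the first term of the sum of length xa = 1 + yb leaves z times the sum of length
  -- yb. These two sums are multiples of those of lengths a and b, and they differ, up to the factor
  -- z, by 1.
  geometric-Bézout : ∀ z a b x y → 1 ℕ.+ y ℕ.* b ≡ x ℕ.* a → Comaximal (geometric z a) (geometric z b)
  geometric-Bézout z a b x y eq =
    geometric (z ^ a) x , -ᵖ (z *ᵖ geometric (z ^ b) y) , (begin
      geometric (z ^ a) x *ᵖ geometric z a +ᵖ -ᵖ (z *ᵖ geometric (z ^ b) y) *ᵖ geometric z b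
        ≈⟨ +ᵖ-cong (≋.sym (geometric-* z x a)) (regroup z (geometric (z ^ b) y) (geometric z b)) ⟩
      geometric z (x ℕ.* a) +ᵖ -ᵖ (z *ᵖ (geometric (z ^ b) y *ᵖ geometric z b))
        ≈⟨ +ᵖ-cong (≋.reflexive (cong (geometric z) (sym eq))) (-ᵖ-cong (*ᵖ-congˡ z (≋.sym (geometric-* z y b)))) ⟩
      (C 1ℤ +ᵖ z *ᵖ geometric z (y ℕ.* b)) +ᵖ -ᵖ (z *ᵖ geometric z (y ℕ.* b))
        ≈⟨ drop (C 1ℤ) (z *ᵖ geometric z (y ℕ.* b)) ⟩
      C 1ℤ ∎)
    where
    open ≋-Reasoning
    regroup : ∀ z g h → -ᵖ (z *ᵖ g) *ᵖ h ≋ -ᵖ (z *ᵖ (g *ᵖ h))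
    regroup = Solver.solve-∀ polySolverRing
    drop : ∀ o w → (o +ᵖ w) +ᵖ -ᵖ w ≋ o
    drop = Solver.solve-∀ polySolverRing

  geometric-comaximal : ∀ z a b → Coprime a b → Comaximal (geometric z a) (geometric z b)
  geometric-comaximal z a b c with coprime-Bézout c
  ... | Bézout.+- x y eq = geometric-Bézout z a b x y eq
  ... | Bézout.-+ x y eq = comaximal-sym (geometric-Bézout z b a y x eq)

  coprime-∣ : ∀ {a b d} → d ℕ∣.∣ b → Coprime a b → Coprime a d
  coprime-∣ d∣b c (x∣a , x∣d) = c (x∣a , ℕ∣.∣-trans x∣d d∣b)

  coprime-* : ∀ {a b c} → Coprime a b → Coprime a c → Coprime a (b ℕ.* c)
  coprime-* {a} {b} {c} cb cc {x} (x∣a , x∣bc) =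
    cc (x∣a , Coprime.coprime-divisor (λ (y∣x , y∣b) → cb (ℕ∣.∣-trans y∣x x∣a , y∣b)) x∣bc)

  -- For F(n) = yⁿ − 1 and F′(n) = F(np)/F(n), iterated over p₁, …, pᵣ, one
  -- obtains for y = t and n = 1 the cyclotomic polynomial of p₁⋯pᵣ.  Both
  -- the divisibility and the comaximality pass from F to F′.
  record Family (D δ : ℕ) (F : ℕ → Poly) : Set where
    field
      degree    : ∀ {n} → 1 ≤ n → HasDegree (F n) (δ ℕ.* n)
      quotient  : ∀ {n a} → 1 ≤ n → 1 ≤ a → Coprime a D → ∃[ u ] F n *ᵖ u ≋ F (n ℕ.* a)
      comaximal : ∀ {n a b u v} → 1 ≤ n → 1 ≤ a → 1 ≤ b → Coprime a D → Coprime b D → Coprime a b →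
                  F n *ᵖ u ≋ F (n ℕ.* a) → F n *ᵖ v ≋ F (n ℕ.* b) → Comaximal u v

  family-weaken : ∀ {D E δ F} → D ℕ∣.∣ E → Family D δ F → Family E δ F
  family-weaken D∣E fam = record
    { degree    = degree
    ; quotient  = λ n a c → quotient n a (coprime-∣ D∣E c)
    ; comaximal = λ n a b c d → comaximal n a b (coprime-∣ D∣E c) (coprime-∣ D∣E d)
    }
    where open Family fam

  power-family : ∀ {y s} → 1 ≤ s → HasDegree y s → Family 1 s (λ n → (y ^ n) −1)
  power-family {y} {s} 1≤s d = record
    { degree    = degree
    ; quotient  = λ {n} {a} _ _ _ → geometric (y ^ n) a , quotient n a
    -- u and v are arbitrary quotients; by cancellation they are the geometric sums in yⁿ.
    ; comaximal = λ {n} {a} {b} {u} {v} 1≤n _ _ _ _ c eu ev → comaximal-cong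
        (≋.sym (*ᵖ-cancelˡ u (geometric (y ^ n) a) (degree 1≤n) (≋.trans eu (≋.sym (quotient n a)))))
        (≋.sym (*ᵖ-cancelˡ v (geometric (y ^ n) b) (degree 1≤n) (≋.trans ev (≋.sym (quotient n b)))))
        (geometric-comaximal (y ^ n) a b c)
    }
    where
    degree : ∀ {n} → 1 ≤ n → HasDegree ((y ^ n) −1) (s ℕ.* n)
    degree {n} 1≤n with s ℕ.* n in eq | ℕ.*-mono-≤ 1≤s 1≤n
    ... | suc k | _ = hasDegree-+C (ℤ.- 1ℤ) (subst (HasDegree (y ^ n)) (trans (ℕ.*-comm n s) eq) (hasDegree-^ n d))
    quotient : ∀ n a → ((y ^ n) −1) *ᵖ geometric (y ^ n) a ≋ (y ^ (n ℕ.* a)) −1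
    quotient n a = ≋.trans (geometric-sum (y ^ n) a) (+ᵖ-cong (^-*-assoc y n a) (≋.refl {C (ℤ.- 1ℤ)}))

  module _ {D δ F} (fam : Family D δ F) {p} (c : Coprime (suc p) D) where
    private
      open Family fam

      P : ℕ
      P = suc p

    -- The next family F′. Its value at 0 is a default: all properties are stated for 1 ≤ n.
    quotients : ℕ → Poly
    quotients zero    = []
    quotients (suc n) = proj₁ (quotient {suc n} (s≤s z≤n) (s≤s z≤n) c)

    quotients-* : ∀ {n} → 1 ≤ n → F n *ᵖ quotients n ≋ F (n ℕ.* P)
    quotients-* {suc n} _ = proj₂ (quotient {suc n} (s≤s z≤n) (s≤s z≤n) c)

    private
      quotients-degree : ∀ {n} → 1 ≤ n → HasDegree (quotients n) (δ ℕ.* p ℕ.* n)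
      quotients-degree {n} 1≤n
        with hasDegree-factor (F n) (quotients n) (degree (ℕ.*-mono-≤ 1≤n (s≤s z≤n))) (≋.sym (quotients-* 1≤n))
      ... | a , b , da , db , a+b with refl ← hasDegree-unique da (degree 1≤n) =
        subst (HasDegree (quotients n))
          (ℕ.+-cancelˡ-≡ (δ ℕ.* n) b (δ ℕ.* p ℕ.* n) (trans a+b (split δ n p))) db
        where
        split : ∀ δ n p → δ ℕ.* (n ℕ.* suc p) ≡ δ ℕ.* n ℕ.+ δ ℕ.* p ℕ.* n
        split = solveℕ

      module _ {n a} (1≤n : 1 ≤ n) (1≤a : 1 ≤ a) (ca : Coprime a D) where
        1≤na : 1 ≤ n ℕ.* a
        1≤na = ℕ.*-mono-≤ 1≤n 1≤a

        1≤nP : 1 ≤ n ℕ.* P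
        1≤nP = ℕ.*-mono-≤ 1≤n (s≤s z≤n)

        u w : Poly
        u = proj₁ (quotient 1≤n 1≤a ca)
        w = proj₁ (quotient 1≤nP 1≤a ca)

        -- F(na)/F(n) · F(nap)/F(na) = F(np)/F(n) · F(npa)/F(np)
        square : u *ᵖ quotients (n ℕ.* a) ≋ quotients n *ᵖ w
        square = *ᵖ-cancelˡ _ _ (degree 1≤n) (begin
          F n *ᵖ (u *ᵖ quotients (n ℕ.* a))     ≈⟨ *ᵖ-assoc (F n) u (quotients (n ℕ.* a)) ⟨
          (F n *ᵖ u) *ᵖ quotients (n ℕ.* a)     ≈⟨ *ᵖ-congʳ (quotients (n ℕ.* a)) (proj₂ (quotient 1≤n 1≤a ca)) ⟩
          F (n ℕ.* a) *ᵖ quotients (n ℕ.* a)    ≈⟨ quotients-* 1≤na ⟩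
          F (n ℕ.* a ℕ.* P)                     ≡⟨ cong F (swap n a P) ⟩
          F (n ℕ.* P ℕ.* a)                     ≈⟨ proj₂ (quotient 1≤nP 1≤a ca) ⟨
          F (n ℕ.* P) *ᵖ w                      ≈⟨ *ᵖ-congʳ w (quotients-* 1≤n) ⟨
          (F n *ᵖ quotients n) *ᵖ w             ≈⟨ *ᵖ-assoc (F n) (quotients n) w ⟩
          F n *ᵖ (quotients n *ᵖ w)             ∎)
          where
          open ≋-Reasoning
          swap : ∀ n a P → n ℕ.* a ℕ.* P ≡ n ℕ.* P ℕ.* a
          swap = solveℕ

      -- By `square`, F′(n) divides u F′(na), where u = F(na)/F(n). As a and P are coprime, u and
      -- F′(n) are comaximal, so F′(n) divides F′(na).
      quotients-quotient : ∀ {n a} → 1 ≤ n → 1 ≤ a → Coprime a (D ℕ.* P) →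
        ∃[ q ] quotients n *ᵖ q ≋ quotients (n ℕ.* a)
      quotients-quotient {n} {a} 1≤n 1≤a cDP
        with comaximal 1≤n 1≤a (s≤s z≤n) ca c (coprime-∣ (ℕ∣.n∣m*n D) cDP)
               (proj₂ (quotient 1≤n 1≤a ca)) (quotients-* 1≤n)
        where ca = coprime-∣ (ℕ∣.m∣m*n P) cDP
      ... | U , V , one = U *ᵖ w′ +ᵖ V *ᵖ Q , (begin
          quotients n *ᵖ (U *ᵖ w′ +ᵖ V *ᵖ Q)          ≈⟨ expand (quotients n) U w′ V Q ⟩
          U *ᵖ (quotients n *ᵖ w′) +ᵖ V *ᵖ quotients n *ᵖ Q
            ≈⟨ +ᵖ-cong (*ᵖ-congˡ U (≋.sym (square 1≤n 1≤a ca))) ≋.refl ⟩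
          U *ᵖ (u′ *ᵖ Q) +ᵖ V *ᵖ quotients n *ᵖ Q     ≈⟨ collect U u′ Q V (quotients n) ⟩
          (U *ᵖ u′ +ᵖ V *ᵖ quotients n) *ᵖ Q          ≈⟨ *ᵖ-congʳ Q one ⟩
          C 1ℤ *ᵖ Q                                   ≈⟨ *ᵖ-identityˡ Q ⟩
          Q                                           ∎)
        where
        open ≋-Reasoning
        ca : Coprime a D
        ca = coprime-∣ (ℕ∣.m∣m*n P) cDP
        u′ = u 1≤n 1≤a ca
        w′ = w 1≤n 1≤a ca
        Q = quotients (n ℕ.* a)
        expand : ∀ q U w V Q → q *ᵖ (U *ᵖ w +ᵖ V *ᵖ Q) ≋ U *ᵖ (q *ᵖ w) +ᵖ V *ᵖ q *ᵖ Q
        expand = Solver.solve-∀ polySolverRing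
        collect : ∀ U u Q V q → U *ᵖ (u *ᵖ Q) +ᵖ V *ᵖ q *ᵖ Q ≋ (U *ᵖ u +ᵖ V *ᵖ q) *ᵖ Q
        collect = Solver.solve-∀ polySolverRing

      -- Since F′(na)/F′(n) divides F(nPa)/F(nP), comaximality for F′ at n is inherited from
      -- comaximality for F at nP.
      divides-w : ∀ {n a x} (1≤n : 1 ≤ n) (1≤a : 1 ≤ a) (ca : Coprime a D) →
        quotients n *ᵖ x ≋ quotients (n ℕ.* a) → u 1≤n 1≤a ca *ᵖ x ≋ w 1≤n 1≤a ca
      divides-w {n} {a} {x} 1≤n 1≤a ca eq = *ᵖ-cancelˡ _ _ (quotients-degree 1≤n)
        (≋.trans (swap (quotients n) (u 1≤n 1≤a ca) x)
          (≋.trans (*ᵖ-congˡ (u 1≤n 1≤a ca) eq) (square 1≤n 1≤a ca)))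
        where
        swap : ∀ q u x → q *ᵖ (u *ᵖ x) ≋ u *ᵖ (q *ᵖ x)
        swap = Solver.solve-∀ polySolverRing

    quotient-family : Family (D ℕ.* P) (δ ℕ.* p) quotients
    quotient-family = record
      { degree    = quotients-degree
      ; quotient  = quotients-quotient
      ; comaximal = λ {n} {a} {b} {x} {y} 1≤n 1≤a 1≤b cDa cDb cab ex ey →
          let ca = coprime-∣ (ℕ∣.m∣m*n P) cDa
              cb = coprime-∣ (ℕ∣.m∣m*n P) cDb
              1≤nP = ℕ.*-mono-≤ 1≤n (s≤s z≤n)
          in comaximal-divisors {x = u 1≤n 1≤a ca} {y = u 1≤n 1≤b cb} (divides-w 1≤n 1≤a ca ex) (divides-w 1≤n 1≤b cb ey)
               (comaximal 1≤nP 1≤a 1≤b ca cb cab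
                 (proj₂ (quotient 1≤nP 1≤a ca)) (proj₂ (quotient 1≤nP 1≤b cb)))
      }

  product-of : List Poly → Poly
  product-of = foldr _*ᵖ_ (C 1ℤ)

  record Factored (P : ℕ → Set) (f : Poly) : Set where
    constructor factored
    field
      factors  : List Poly
      product≋ : product-of factors ≋ f
      bounded  : All (λ p → P (deg p)) factors

  product-++ : ∀ ps qs → product-of (ps ++ qs) ≋ product-of ps *ᵖ product-of qs
  product-++ []       qs = ≋.sym (*ᵖ-identityˡ (product-of qs))
  product-++ (p ∷ ps) qs =
    ≋.trans (*ᵖ-congˡ p (product-++ ps qs)) (≋.sym (*ᵖ-assoc p (product-of ps) (product-of qs)))

  factored-* : ∀ {P f g} → Factored P f → Factored P g → Factored P (f *ᵖ g)
  factored-* (factored ps e bp) (factored qs e′ bq) =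
    factored (ps ++ qs) (≋.trans (product-++ ps qs) (*ᵖ-cong e e′)) (All.++⁺ bp bq)

  factored-cong : ∀ {P f g} → f ≋ g → Factored P f → Factored P g
  factored-cong e (factored ps e′ b) = factored ps (≋.trans e′ e) b

  factored-map : ∀ {P Q f} → (∀ {n} → P n → Q n) → Factored P f → Factored Q f
  factored-map f (factored ps e b) = factored ps e (All.map f b)

  factored-single : ∀ {P f} → P (deg f) → Factored P f
  factored-single {f = f} b = factored (f ∷ []) (*ᵖ-identityʳ f) (b ∷ [])

  factored-^ : ∀ {P f} n → Factored P f → Factored P (f ^ n)
  factored-^ zero    _ = factored [] ≋.refl []
  factored-^ (suc n) x = factored-* x (factored-^ n x)

  data PairwiseCoprime : List ℕ → Set where
    []  : PairwiseCoprime []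
    _∷_ : ∀ {q qs} → 2 ≤ q × Coprime q (List.product qs) → PairwiseCoprime qs → PairwiseCoprime (q ∷ qs)

  -- For distinct primes this is φ of their product. The sieve also contains composite numbers;
  -- there it serves as the numerator of the product of the 1 - 1/q.
  totient : List ℕ → ℕ
  totient qs = List.product (map pred qs)

  -- For the head p of the list and the product Q of the rest, F(npQ) = F(nQ) F′(nQ), and both
  -- factors are split further along the rest. Each divisor of the whole product contributes one
  -- factor. The degree is largest for the product itself, since p - 1 ≥ 1.
  factored-family : ∀ {D δ F n qs} → Family D δ F → 1 ≤ n → PairwiseCoprime qs → Coprime (List.product qs) D →
    Factored (_≤ δ ℕ.* n ℕ.* totient qs) (F (n ℕ.* List.product qs))
  factored-family {D} {δ} {F} {n} fam 1≤n [] _ = factored-single (ℕ.≤-reflexive (trans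
    (hasDegree⇒deg (F (n ℕ.* 1)) (Family.degree fam (ℕ.*-mono-≤ 1≤n (s≤s z≤n)))) (sym (ℕ.*-assoc δ n 1))))
  factored-family {D} {δ} {F} {n} {suc q ∷ qs} fam 1≤n ((s≤s 1≤q , cq) ∷ pc) cD =
    factored-cong
      (≋.trans (quotients-* fam q⊥D 1≤nQ) (≋.reflexive (cong F (swap n Q q))))
      (factored-* (factored-map (λ le → ℕ.≤-trans le bound) (factored-family (family-weaken (ℕ∣.m∣m*n (suc q)) fam) 1≤n pc Q⊥Dq))
                  (factored-map (λ le → ℕ.≤-trans le (ℕ.≤-reflexive (swap′ δ q n (totient qs))))
                    (factored-family (quotient-family fam q⊥D) 1≤n pc Q⊥Dq)))
    where
    Q = List.product qs
    q⊥D : Coprime (suc q) D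
    q⊥D = Coprime.sym (coprime-∣ (ℕ∣.m∣m*n Q) (Coprime.sym cD))
    Q⊥Dq : Coprime Q (D ℕ.* suc q)
    Q⊥Dq = coprime-* (Coprime.sym (coprime-∣ (ℕ∣.n∣m*n (suc q)) (Coprime.sym cD))) (Coprime.sym cq)
    1≤product : ∀ {qs} → PairwiseCoprime qs → 1 ≤ List.product qs
    1≤product []             = s≤s z≤n
    1≤product ((2≤q , _) ∷ p) = ℕ.*-mono-≤ (ℕ.≤-trans (s≤s z≤n) 2≤q) (1≤product p)
    1≤nQ : 1 ≤ n ℕ.* Q
    1≤nQ = ℕ.*-mono-≤ 1≤n (1≤product pc)
    swap : ∀ n Q q → n ℕ.* Q ℕ.* suc q ≡ n ℕ.* (suc q ℕ.* Q)
    swap = solveℕ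
    swap′ : ∀ δ q n φ → δ ℕ.* q ℕ.* n ℕ.* φ ≡ δ ℕ.* n ℕ.* (q ℕ.* φ)
    swap′ = solveℕ
    bound : δ ℕ.* n ℕ.* totient qs ≤ δ ℕ.* n ℕ.* (q ℕ.* totient qs)
    bound = ℕ.*-monoʳ-≤ (δ ℕ.* n) (ℕ.m≤n*m (totient qs) q ⦃ ℕ.>-nonZero 1≤q ⦄)

-- A lower bound for Euler's product by sieving the harmonic sum

module EulerProduct where
  open CyclotomicFactors using (totient)
  open import Data.List.Base using (List; []; _∷_)
  open import Data.List.Relation.Unary.Any using (Any; here; there)
  open import Data.List.Relation.Unary.All using (All; []; _∷_)
  import Data.Nat.ListAction as List
  open import Data.Nat.Base as ℕ using (ℕ; zero; suc; pred; _+_; _*_; _^_; _≤_; _<_; z≤n; s≤s)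
  open import Data.Nat.Divisibility
  open import Data.Nat.DivMod
  open import Data.Nat.Properties
  open import Data.Nat.Tactic.RingSolver using () renaming (solve-∀ to solveℕ)
  open import Relation.Binary.PropositionalEquality
  open import Relation.Nullary using (yes; no; contradiction)

  sumTo : (ℕ → ℕ) → ℕ → ℕ
  sumTo f zero    = 0
  sumTo f (suc n) = sumTo f n + f (suc n)

  sumTo-mono : ∀ f {m n} → m ≤ n → sumTo f m ≤ sumTo f n
  sumTo-mono f {m} m≤n with ≤⇒≤′ m≤n
  ... | m≤′n = go m≤′n
    where
    go : ∀ {n} → m ℕ.≤′ n → sumTo f m ≤ sumTo f n
    go (ℕ.≤′-reflexive refl) = ≤-refl
    go (ℕ.≤′-step le)        = ≤-trans (go le) (m≤m+n _ _)

  sieve keep : ℕ → (ℕ → ℕ) → ℕ → ℕ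
  sieve m f n with m ∣? n
  ... | yes _ = 0
  ... | no  _ = f n
  keep m f n with m ∣? n
  ... | yes _ = f n
  ... | no  _ = 0

  -- The property of n ↦ 1/n that sieving exploits. It survives scaling with rounding down, as well
  -- as sieving.
  Submultiplicative : (ℕ → ℕ) → Set
  Submultiplicative f = ∀ m n → 1 ≤ m → 1 ≤ n → m * f (m * n) ≤ f n

  -- Whatever is removed at n is removed at every multiple of n too.
  sieve-submultiplicative : ∀ q {f} → Submultiplicative f → Submultiplicative (sieve q f)
  sieve-submultiplicative q {f} sub m n 1≤m 1≤n with q ∣? n | q ∣? m * n
  ... | yes q∣n | yes _   = ≤-reflexive (*-zeroʳ m)
  ... | yes q∣n | no q∤mn = contradiction (∣n⇒∣m*n m q∣n) q∤mn
  ... | no _    | yes _   = ≤-trans (≤-reflexive (*-zeroʳ m)) z≤n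
  ... | no _    | no _    = sub m n 1≤m 1≤n

  -- Each multiple mj ≤ Y contributes m f(mj) ≤ f(j) with j ≤ c. The bound c is kept apart from Y so
  -- that after the multiple mj the induction can go on with j - 1.
  keep-sum : ∀ m {f} → 1 ≤ m → Submultiplicative f → ∀ Y c → Y < m * suc c → m * sumTo (keep m f) Y ≤ sumTo f c
  keep-sum m 1≤m sub zero c lt = ≤-trans (≤-reflexive (*-zeroʳ m)) z≤n
  keep-sum m {f} 1≤m sub (suc Y) c lt with m ∣? suc Y
  ... | no _ = ≤-trans (≤-reflexive (cong (m *_) (+-identityʳ _)))
                 (keep-sum m 1≤m sub Y c (<-trans (n<1+n Y) lt))
  ... | yes (divides (suc q) eq) = begin
    m * (sumTo (keep m f) Y + f (suc Y))           ≡⟨ *-distribˡ-+ m _ _ ⟩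
    m * sumTo (keep m f) Y + m * f (suc Y)         ≤⟨ +-mono-≤ (keep-sum m 1≤m sub Y q Y<) hit ⟩
    sumTo f (suc q)                                ≤⟨ sumTo-mono f q<c ⟩
    sumTo f c                                      ∎
    where
    open ≤-Reasoning
    eq′ : suc Y ≡ m * suc q
    eq′ = trans eq (*-comm (suc q) m)
    Y< : Y < m * suc q
    Y< = ≤-reflexive eq′
    hit : m * f (suc Y) ≤ f (suc q)
    hit = subst (λ n → m * f n ≤ f (suc q)) (sym eq′) (sub m (suc q) 1≤m (s≤s z≤n))
    q<c : suc q ≤ c
    q<c = ℕ.s≤s⁻¹ (*-cancelˡ-< m (suc q) (suc c) (subst (_< m * suc c) eq′ lt))

  keep+sieve : ∀ m f n → sumTo (keep m f) n + sumTo (sieve m f) n ≡ sumTo f n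
  keep+sieve m f zero = refl
  keep+sieve m f (suc n) with m ∣? suc n
  ... | yes _ = trans (move (sumTo (keep m f) n) (f (suc n)) (sumTo (sieve m f) n))
                      (cong (_+ f (suc n)) (keep+sieve m f n))
    where
    move : ∀ a b c → a + b + (c + 0) ≡ a + c + b
    move = solveℕ
  ... | no _  = trans (move (sumTo (keep m f) n) (f (suc n)) (sumTo (sieve m f) n))
                      (cong (_+ f (suc n)) (keep+sieve m f n))
    where
    move : ∀ a b c → a + 0 + (c + b) ≡ a + c + b
    move = solveℕ

  -- By submultiplicativity the multiples of m contribute at most 1/m of the sum.
  sieve-bound : ∀ m {f} → 1 ≤ m → Submultiplicative f → ∀ Y → pred m * sumTo f Y ≤ m * sumTo (sieve m f) Y
  sieve-bound (suc m) {f} 1≤m sub Y = +-cancelˡ-≤ (sumTo f Y) _ _ (begin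
    sumTo f Y + m * sumTo f Y                              ≡⟨ cong (suc m *_) (keep+sieve (suc m) f Y) ⟨
    suc m * (sumTo (keep (suc m) f) Y + sumTo (sieve (suc m) f) Y)
      ≡⟨ *-distribˡ-+ (suc m) (sumTo (keep (suc m) f) Y) _ ⟩
    suc m * sumTo (keep (suc m) f) Y + suc m * sumTo (sieve (suc m) f) Y
      ≤⟨ +-monoˡ-≤ _ (keep-sum (suc m) 1≤m sub Y Y (m≤m+n (suc Y) (m * suc Y))) ⟩
    sumTo f Y + suc m * sumTo (sieve (suc m) f) Y          ∎)
    where open ≤-Reasoning

  sieves : List ℕ → (ℕ → ℕ) → ℕ → ℕ
  sieves []      f = f
  sieves (m ∷ L) f = sieves L (sieve m f)

  -- Each sieving retains at least the proportion 1 - 1/m of what was left, for composite m as well;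
  -- the latter allows integers to take the place of small primes.
  sieves-bound : ∀ L {f} → All (1 ≤_) L → Submultiplicative f → ∀ Y →
    totient L * sumTo f Y ≤ List.product L * sumTo (sieves L f) Y
  sieves-bound [] _ sub Y = ≤-refl
  sieves-bound (m ∷ L) {f} (1≤m ∷ pos) sub Y = begin
    pred m * totient L * sumTo f Y            ≡⟨ move (pred m) (totient L) (sumTo f Y) ⟩
    totient L * (pred m * sumTo f Y)          ≤⟨ *-monoʳ-≤ (totient L) (sieve-bound m 1≤m sub Y) ⟩
    totient L * (m * sumTo (sieve m f) Y)     ≡⟨ move′ m (totient L) (sumTo (sieve m f) Y) ⟩
    m * (totient L * sumTo (sieve m f) Y)     ≤⟨ *-monoʳ-≤ m (sieves-bound L pos (sieve-submultiplicative m sub) Y) ⟩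
    m * (List.product L * sumTo (sieves (m ∷ L) f) Y)  ≡⟨ *-assoc m (List.product L) _ ⟨
    m * List.product L * sumTo (sieves (m ∷ L) f) Y  ∎
    where
    open ≤-Reasoning
    move : ∀ a b c → a * b * c ≡ b * (a * c)
    move = solveℕ
    move′ : ∀ a b c → b * (a * c) ≡ a * (b * c)
    move′ = solveℕ

  sieve-≤ : ∀ m f n → sieve m f n ≤ f n
  sieve-≤ m f n with m ∣? n
  ... | yes _ = z≤n
  ... | no _  = ≤-refl

  sieves-≤ : ∀ L f n → sieves L f n ≤ f n
  sieves-≤ []      f n = ≤-refl
  sieves-≤ (m ∷ L) f n = ≤-trans (sieves-≤ L (sieve m f) n) (sieve-≤ m f n)

  sieves-0 : ∀ L f n → Any (_∣ n) L → sieves L f n ≡ 0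
  sieves-0 (m ∷ L) f n (there a) = sieves-0 L (sieve m f) n a
  sieves-0 (m ∷ L) f n (here m∣n) = n≤0⇒n≡0 (≤-trans (sieves-≤ L (sieve m f) n) (≤-reflexive gone))
    where
    gone : sieve m f n ≡ 0
    gone with m ∣? n
    ... | yes _  = refl
    ... | no m∤n = contradiction m∣n m∤n

  sieves-sum : ∀ L f Y → (∀ n → 2 ≤ n → n ≤ Y → Any (_∣ n) L) → sumTo (sieves L f) Y ≤ f 1
  sieves-sum L f zero cover = z≤n
  sieves-sum L f (suc zero) cover = sieves-≤ L f 1
  sieves-sum L f (suc (suc Y)) cover = begin
    sumTo (sieves L f) (suc Y) + sieves L f (2 + Y)
      ≡⟨ cong (sumTo (sieves L f) (suc Y) +_) (sieves-0 L f (2 + Y) (cover (2 + Y) (s≤s (s≤s z≤n)) ≤-refl)) ⟩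
    sumTo (sieves L f) (suc Y) + 0
      ≡⟨ +-identityʳ _ ⟩
    sumTo (sieves L f) (suc Y)
      ≤⟨ sieves-sum L f (suc Y) (λ n 2≤n n≤Y → cover n 2≤n (m≤n⇒m≤1+n n≤Y)) ⟩
    f 1 ∎
    where open ≤-Reasoning

  -- Reciprocals scaled by D and rounded down, to stay within ℕ. The value at 0 is a default, as
  -- `sumTo` starts at 1.
  recip : ℕ → ℕ → ℕ
  recip D zero    = 0
  recip D (suc n) = D / suc n

  recip-submultiplicative : ∀ D → Submultiplicative (recip D)
  recip-submultiplicative D (suc m) (suc n) _ _ = begin
    suc m * (D / (suc m * suc n))    ≡⟨ cong (suc m *_) (/-congʳ {m = D} (*-comm (suc m) (suc n))) ⟩
    suc m * (D / (suc n * suc m))    ≡⟨ cong (suc m *_) (m/n/o≡m/[n*o] D (suc n) (suc m)) ⟨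
    suc m * (D / suc n / suc m)      ≡⟨ *-comm (suc m) _ ⟩
    D / suc n / suc m * suc m        ≤⟨ m/n*n≤m (D / suc n) (suc m) ⟩
    D / suc n                        ∎
    where open ≤-Reasoning

  sumTo-block : ∀ f c n k → (∀ i → n < i → i ≤ n + k → c ≤ f i) → sumTo f n + k * c ≤ sumTo f (n + k)
  sumTo-block f c n zero    h = ≤-reflexive (trans (+-identityʳ _) (cong (sumTo f) (sym (+-identityʳ n))))
  sumTo-block f c n (suc k) h rewrite +-suc n k = begin
    sumTo f n + (c + k * c)            ≡⟨ move (sumTo f n) c (k * c) ⟩
    sumTo f n + k * c + c              ≤⟨ +-mono-≤ (sumTo-block f c n k (λ i l u → h i l (m≤n⇒m≤1+n u)))
                                                   (h (suc (n + k)) (s≤s (m≤m+n n k)) ≤-refl) ⟩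
    sumTo f (n + k) + f (suc (n + k))  ∎
    where
    open ≤-Reasoning
    move : ∀ a b c → a + (b + c) ≡ a + c + b
    move = solveℕ

  -- Oresme's bound: each block 2ⁱ < n ≤ 2ⁱ⁺¹ contributes at least one half.
  harmonic-bound : ∀ E i → i ≤ E → i * 2 ^ E ≤ 2 * sumTo (recip (2 ^ E)) (2 ^ i)
  harmonic-bound E zero    _   = z≤n
  harmonic-bound E (suc i) i<E = begin
    D + i * D                                  ≡⟨ +-comm D (i * D) ⟩
    i * D + D                                  ≤⟨ +-mono-≤ (harmonic-bound E i (<⇒≤ i<E)) (≤-reflexive whole) ⟩
    2 * sumTo f (2 ^ i) + 2 * (2 ^ i * c)      ≡⟨ *-distribˡ-+ 2 (sumTo f (2 ^ i)) _ ⟨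
    2 * (sumTo f (2 ^ i) + 2 ^ i * c)          ≤⟨ *-monoʳ-≤ 2 (sumTo-block f c (2 ^ i) (2 ^ i) below) ⟩
    2 * sumTo f (2 ^ i + 2 ^ i)                ≡⟨ cong (λ n → 2 * sumTo f n) (double (2 ^ i)) ⟩
    2 * sumTo f (2 ^ suc i)                    ∎
    where
    open ≤-Reasoning
    D = 2 ^ E
    f = recip D
    -- The value of f at the end 2ⁱ⁺¹ of the block, its smallest one there. As D is a power of 2 it
    -- is exact, and nothing is lost by rounding.
    c = 2 ^ (E ℕ.∸ suc i)
    double : ∀ n → n + n ≡ 2 * n
    double = solveℕ
    D≡ : D ≡ c * 2 ^ suc i
    D≡ = trans (cong (2 ^_) (sym (m∸n+n≡m i<E))) (^-distribˡ-+-* 2 (E ℕ.∸ suc i) (suc i))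
    whole : D ≡ 2 * (2 ^ i * c)
    whole = trans D≡ (trans (*-comm c (2 ^ suc i)) (*-assoc 2 (2 ^ i) c))
    below : ∀ n → 2 ^ i < n → n ≤ 2 ^ i + 2 ^ i → c ≤ f n
    below (suc n) _ n≤ = ≤-trans (≤-reflexive (sym (m*n/n≡m c (suc n)))) (/-monoˡ-≤ (suc n)
      (≤-trans (*-monoʳ-≤ c (≤-trans n≤ (≤-reflexive (double (2 ^ i))))) (≤-reflexive (sym D≡))))

  -- The scaled harmonic sum up to D = 2ᴱ is at least E D / 2. Sieving by all of L removes every n ≥
  -- 2 and leaves at most the term D of n = 1.
  euler-product : ∀ E L → All (1 ≤_) L → (∀ n → 2 ≤ n → n ≤ 2 ^ E → Any (_∣ n) L) →
    E * totient L ≤ 2 * List.product L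
  euler-product E L pos cover = *-cancelʳ-≤ (E * totient L) (2 * List.product L) D ⦃ m^n≢0 2 E ⦄ (begin
    E * totient L * D                     ≡⟨ move E (totient L) D ⟩
    totient L * (E * D)                   ≤⟨ *-monoʳ-≤ (totient L) (harmonic-bound E E ≤-refl) ⟩
    totient L * (2 * sumTo f D)           ≡⟨ move′ (totient L) (sumTo f D) ⟩
    2 * (totient L * sumTo f D)           ≤⟨ *-monoʳ-≤ 2 (sieves-bound L pos (recip-submultiplicative D) D) ⟩
    2 * (List.product L * sumTo (sieves L f) D)
      ≤⟨ *-monoʳ-≤ 2 (*-monoʳ-≤ (List.product L) (sieves-sum L f D cover)) ⟩
    2 * (List.product L * (D / 1))        ≡⟨ cong (λ n → 2 * (List.product L * n)) (n/1≡n D) ⟩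
    2 * (List.product L * D)              ≡⟨ *-assoc 2 (List.product L) D ⟨
    2 * List.product L * D                ∎)
    where
    open ≤-Reasoning
    D = 2 ^ E
    f = recip D
    move : ∀ a b c → a * b * c ≡ b * (a * c)
    move = solveℕ
    move′ : ∀ a b → a * (2 * b) ≡ 2 * (a * b)
    move′ = solveℕ

-- Greedy distribution of the primes into balanced groups

module PrimeGroups where
  open CyclotomicFactors using (PairwiseCoprime; []; _∷_; totient; coprime-*)
  open EulerProduct
  import Algebra.Definitions.RawMonoid as RawMonoidDefs
  open import Data.Fin.Base using (Fin; zero; suc)
  import Data.Fin.Properties as Fin
  open import Data.List.Base using (List; []; _∷_; map)
  open import Data.List.Relation.Unary.Any using (Any; here; there)
  import Data.List.Relation.Unary.Any as Any
  open import Data.List.Relation.Unary.All as All using (All; []; _∷_)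
  import Data.Nat.ListAction as List
  open import Data.Nat.Base as ℕ using (ℕ; zero; suc; _+_; _*_; _^_; _!; _≤_; _<_; z≤n; s≤s)
  open import Data.Nat.Coprimality as Coprime using (Coprime)
  open import Data.Nat.Divisibility
  open import Data.Nat.Primality using (Prime; prime?; ¬prime⇒composite; composite)
  open import Data.Nat.Properties
  open import Data.Nat.Tactic.RingSolver using () renaming (solve-∀ to solveℕ)
  open import Data.Product.Base using (∃-syntax; _×_; _,_)
  open import Data.Sum.Base using (inj₁; inj₂; [_,_]′)
  open import Data.Vec.Functional using (updateAt)
  open import Data.Vec.Functional.Properties using (updateAt-updates; updateAt-minimal)
  open import Function.Base using (_∘_)
  open import Relation.Binary.PropositionalEquality
  open import Relation.Nullary using (¬_; yes; no; contradiction)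

  open RawMonoidDefs *-1-rawMonoid public using () renaming (sum to ∏ᴺ)

  ∏ᴺ-cong : ∀ {l} {f g : Fin l → ℕ} → (∀ i → f i ≡ g i) → ∏ᴺ f ≡ ∏ᴺ g
  ∏ᴺ-cong {zero}  e = refl
  ∏ᴺ-cong {suc l} e = cong₂ _*_ (e zero) (∏ᴺ-cong (e ∘ suc))

  ∏ᴺ-scale : ∀ {l} {f g : Fin l → ℕ} j q → g j ≡ q * f j → (∀ i → i ≢ j → g i ≡ f i) → ∏ᴺ g ≡ q * ∏ᴺ f
  ∏ᴺ-scale {suc l} {f} zero q e e′ =
    trans (cong₂ _*_ e (∏ᴺ-cong λ i → e′ (suc i) λ ())) (*-assoc q (f zero) _)
  ∏ᴺ-scale {suc l} {f} (suc j) q e e′ =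
    trans (cong₂ _*_ (e′ zero λ ()) (∏ᴺ-scale {f = f ∘ suc} j q e λ i i≢j → e′ (suc i) (i≢j ∘ Fin.suc-injective)))
          (swap (f zero) q (∏ᴺ (f ∘ suc)))
    where
    swap : ∀ a b c → a * (b * c) ≡ b * (a * c)
    swap = solveℕ

  ∣-∏ᴺ : ∀ {l} (f : Fin l → ℕ) j → f j ∣ ∏ᴺ f
  ∣-∏ᴺ f zero    = m∣m*n _
  ∣-∏ᴺ f (suc j) = ∣-trans (∣-∏ᴺ (f ∘ suc) j) (n∣m*n (f zero))

  ∏ᴺ-positive : ∀ {l} (f : Fin l → ℕ) → (∀ i → 1 ≤ f i) → 1 ≤ ∏ᴺ f
  ∏ᴺ-positive {zero}  f p = s≤s z≤n
  ∏ᴺ-positive {suc l} f p = *-mono-≤ (p zero) (∏ᴺ-positive (f ∘ suc) (p ∘ suc))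

  ∏ᴺ-ratio : ∀ {l} (f g : Fin l → ℕ) a b c → (∀ i → f i * a ≤ c * (b * g i)) →
    ∏ᴺ f * a ^ l ≤ c ^ l * (b ^ l * ∏ᴺ g)
  ∏ᴺ-ratio {zero}  f g a b c h = s≤s z≤n
  ∏ᴺ-ratio {suc l} f g a b c h = begin
    f zero * F * (a * a ^ l)                      ≡⟨ interchange (f zero) F a (a ^ l) ⟩
    f zero * a * (F * a ^ l)                      ≤⟨ *-mono-≤ (h zero) (∏ᴺ-ratio (f ∘ suc) (g ∘ suc) a b c (h ∘ suc)) ⟩
    c * (b * g zero) * (c ^ l * (b ^ l * G))      ≡⟨ regroup c b (g zero) (c ^ l) (b ^ l) G ⟩
    c * c ^ l * (b * b ^ l * (g zero * G))        ∎
    where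
    open ≤-Reasoning
    F = ∏ᴺ (f ∘ suc)
    G = ∏ᴺ (g ∘ suc)
    interchange : ∀ x y z w → x * y * (z * w) ≡ x * z * (y * w)
    interchange = solveℕ
    regroup : ∀ c b g C B G → c * (b * g) * (C * (B * G)) ≡ c * C * (b * B * (g * G))
    regroup = solveℕ

  -- Transitivity of a/b ≤ c/d ≤ e/f with the denominators cleared; only d is cancelled.
  ratio-trans : ∀ a b c {d e f} → 1 ≤ d → a * d ≤ c * b → c * f ≤ e * d → a * f ≤ e * b
  ratio-trans a b c {d} {e} {f} 1≤d p q = *-cancelʳ-≤ (a * f) (e * b) d ⦃ ℕ.>-nonZero 1≤d ⦄ (begin
    a * f * d      ≡⟨ swap a f d ⟩
    a * d * f      ≤⟨ *-monoˡ-≤ f p ⟩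
    c * b * f      ≡⟨ swap c b f ⟩
    c * f * b      ≤⟨ *-monoˡ-≤ b q ⟩
    e * d * b      ≡⟨ swap e d b ⟩
    e * b * d      ∎)
    where
    open ≤-Reasoning
    swap : ∀ x y z → x * y * z ≡ x * z * y
    swap = solveℕ

  smallest-ratio : ∀ {l} (N φ : Fin (suc l) → ℕ) → (∀ i → 1 ≤ φ i) → ∃[ j ] ∀ i → N j * φ i ≤ N i * φ j
  smallest-ratio {zero}  N φ pos = zero , λ { zero → ≤-refl }
  smallest-ratio {suc l} N φ pos with smallest-ratio (N ∘ suc) (φ ∘ suc) (pos ∘ suc)
  ... | j , least with ≤-total (N zero * φ (suc j)) (N (suc j) * φ zero)
  ...   | inj₁ le = zero , λ where
    zero    → ≤-refl
    (suc i) → ratio-trans (N zero) (φ zero) (N (suc j)) {e = N (suc i)} (pos (suc j)) le (least i)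
  ...   | inj₂ ge = suc j , λ where
    zero    → ge
    (suc i) → least i

  product-positive : ∀ {qs} → PairwiseCoprime qs → 1 ≤ List.product qs
  product-positive []              = s≤s z≤n
  product-positive ((2≤q , _) ∷ p) = *-mono-≤ (≤-trans (s≤s z≤n) 2≤q) (product-positive p)

  totient-positive : ∀ {qs} → PairwiseCoprime qs → 1 ≤ totient qs
  totient-positive []                    = s≤s z≤n
  totient-positive ((s≤s 1≤q , _) ∷ p) = *-mono-≤ 1≤q (totient-positive p)

  coprime-product : ∀ {k} qs → All (λ q → Coprime q k) qs → Coprime (List.product qs) k
  coprime-product []       []       = Coprime.1-coprimeTo _
  coprime-product (q ∷ qs) (c ∷ cs) = Coprime.sym (coprime-* (Coprime.sym c) (Coprime.sym (coprime-product qs cs)))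

  -- The integers K+1, ..., 2 replace the primes up to K+1 in the sieve: their product of m/(m - 1)
  -- telescopes to K+1.
  countdown : ℕ → List ℕ
  countdown zero    = []
  countdown (suc n) = suc (suc n) ∷ countdown n

  product-countdown : ∀ n → List.product (countdown n) ≡ suc n !
  product-countdown zero    = refl
  product-countdown (suc n) = cong (suc (suc n) *_) (product-countdown n)

  totient-countdown : ∀ n → totient (countdown n) ≡ n !
  totient-countdown zero    = refl
  totient-countdown (suc n) = cong (suc n *_) (totient-countdown n)

  countdown-positive : ∀ n → All (1 ≤_) (countdown n)
  countdown-positive zero    = []
  countdown-positive (suc n) = s≤s z≤n ∷ countdown-positive n

  countdown-cover : ∀ K n → 2 ≤ n → n ≤ suc K → Any (_∣ n) (countdown K)
  countdown-cover zero    n 2≤n n≤1 = contradiction (≤-trans 2≤n n≤1) λ { (s≤s ()) }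
  countdown-cover (suc K) n 2≤n n≤K with m≤n⇒m<n∨m≡n n≤K
  ... | inj₁ n<   = there (countdown-cover K n 2≤n (ℕ.s≤s⁻¹ n<))
  ... | inj₂ refl = here ∣-refl

  module _ (l K : ℕ) where

    -- The primes in (K, y] are distributed over suc l groups; the ratios
    -- N/φ of any two groups differ by a factor of at most 2.  The sieve
    -- consists of all these primes and the numbers 2, …, K.
    record Groups (y : ℕ) : Set where
      field
        group       : Fin (suc l) → List ℕ
        sieving     : List ℕ

      N : Fin (suc l) → ℕ
      N j = List.product (group j)

      φ : Fin (suc l) → ℕ
      φ j = totient (group j)

      field
        pairwise    : ∀ j → PairwiseCoprime (group j)
        separate    : ∀ {i j} → i ≢ j → Coprime (N i) (N j)
        primes      : ∀ j → All (λ q → Prime q × suc K < q × q ≤ y) (group j)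
        balanced    : ∀ i j → N i * φ j ≤ 2 * (N j * φ i)
        ∏N∣y!       : ∏ᴺ N ∣ y !
        positive    : All (1 ≤_) sieving
        product≡    : List.product sieving ≡ suc K ! * ∏ᴺ N
        totient≡    : totient sieving ≡ K ! * ∏ᴺ φ
        cover       : ∀ n → 2 ≤ n → n ≤ y → Any (_∣ n) sieving

    ∏ᴺ-1 : ∀ l → ∏ᴺ {l} (λ _ → 1) ≡ 1
    ∏ᴺ-1 zero    = refl
    ∏ᴺ-1 (suc l) = trans (+-identityʳ _) (∏ᴺ-1 l)

    no-groups : Groups (suc K)
    no-groups = record
      { group    = λ _ → []
      ; sieving  = countdown K
      ; pairwise = λ _ → []
      ; separate = λ _ → Coprime.1-coprimeTo 1
      ; primes   = λ _ → []
      ; balanced = λ _ _ → s≤s z≤n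
      ; ∏N∣y!    = subst (_∣ suc K !) (sym (∏ᴺ-1 (suc l))) (1∣ (suc K !))
      ; positive = countdown-positive K
      ; product≡ = trans (product-countdown K) (sym (trans (cong (suc K ! *_) (∏ᴺ-1 (suc l))) (*-identityʳ _)))
      ; totient≡ = trans (totient-countdown K) (sym (trans (cong (K ! *_) (∏ᴺ-1 (suc l))) (*-identityʳ _)))
      ; cover    = countdown-cover K
      }

    composite-step : ∀ {y} → suc K ≤ y → ¬ Prime (suc y) → Groups y → Groups (suc y)
    composite-step {y} K<y ¬p G = record
      { group    = group
      ; sieving  = sieving
      ; pairwise = pairwise
      ; separate = separate
      ; primes   = λ j → All.map (λ (p , k , u) → p , k , m≤n⇒m≤1+n u) (primes j)
      ; balanced = balanced
      ; ∏N∣y!    = ∣n⇒∣m*n (suc y) ∏N∣y!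
      ; positive = positive
      ; product≡ = product≡
      ; totient≡ = totient≡
      ; cover    = λ n 2≤n n≤y → [ (λ n<y → cover n 2≤n (ℕ.s≤s⁻¹ n<y)) , (λ { refl → last }) ]′ (m≤n⇒m<n∨m≡n n≤y)
      }
      where
      open Groups G
      last : Any (_∣ suc y) sieving
      last with ¬prime⇒composite ⦃ ℕ.n>1⇒nonTrivial (s≤s (≤-trans (s≤s z≤n) K<y)) ⦄ ¬p
      ... | composite {d} d<y d∣y =
        Any.map (λ m∣d → ∣-trans m∣d d∣y) (cover d (ℕ.nonTrivial⇒n>1 d) (ℕ.s≤s⁻¹ d<y))

    -- The new prime q joins a group whose ratio N/φ is smallest. That ratio grows by q/(q - 1) ≤ 2,
    -- hence stays within twice every other one; and growing only helps it as an upper bound for the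
    -- others.
    prime-step : ∀ {y} → suc K ≤ y → Prime (suc y) → Groups y → Groups (suc y)
    prime-step {y} K<y p G with smallest-ratio (Groups.N G) (Groups.φ G) (totient-positive ∘ Groups.pairwise G)
    ... | m , least = record
      { group    = group′
      ; sieving  = q ∷ sieving
      ; pairwise = pairwise′
      ; separate = separate′
      ; primes   = primes′
      ; balanced = balanced′
      ; ∏N∣y!    = subst (_∣ q * y !) (sym ∏N′) (*-monoʳ-∣ q ∏N∣y!)
      ; positive = s≤s z≤n ∷ positive
      ; product≡ = trans (cong (q *_) product≡) (trans (swap q (suc K !) (∏ᴺ N)) (cong (suc K ! *_) (sym ∏N′)))
      ; totient≡ = trans (cong (y *_) totient≡) (trans (swap y (K !) (∏ᴺ φ)) (cong (K ! *_) (sym ∏φ′)))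
      ; cover    = λ n 2≤n n≤y →
          [ (λ n<y → there (cover n 2≤n (ℕ.s≤s⁻¹ n<y))) , (λ { refl → here ∣-refl }) ]′ (m≤n⇒m<n∨m≡n n≤y)
      }
      where
      open Groups G
      open ≤-Reasoning
      q = suc y
      group′ : Fin (suc l) → List ℕ
      group′ = updateAt group m (q ∷_)
      swap : ∀ a b c → a * (b * c) ≡ b * (a * c)
      swap = solveℕ
      new : group′ m ≡ q ∷ group m
      new = updateAt-updates m group
      old : ∀ {i} → i ≢ m → group′ i ≡ group i
      old {i} i≢m = updateAt-minimal i m group i≢m
      Nnew : List.product (group′ m) ≡ q * N m
      Nnew = cong List.product new
      φnew : totient (group′ m) ≡ y * φ m
      φnew = cong totient new
      ∏N′ : ∏ᴺ (List.product ∘ group′) ≡ q * ∏ᴺ N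
      ∏N′ = ∏ᴺ-scale m q Nnew (λ i i≢m → cong List.product (old i≢m))
      ∏φ′ : ∏ᴺ (totient ∘ group′) ≡ y * ∏ᴺ φ
      ∏φ′ = ∏ᴺ-scale m y φnew (λ i i≢m → cong totient (old i≢m))
      N⊥q : ∀ j → Coprime (N j) q
      N⊥q j = coprime-product (group j) (All.map r⊥q (primes j))
        where
        r⊥q : ∀ {r} → Prime r × suc K < r × r ≤ y → Coprime r q
        r⊥q (_ , K<r , r≤y) =
          Coprime.sym (Coprime.prime⇒coprime p ⦃ ℕ.>-nonZero (≤-trans (s≤s z≤n) K<r) ⦄ (s≤s r≤y))
      pairwise′ : ∀ j → PairwiseCoprime (group′ j)
      pairwise′ j with j Fin.≟ m
      ... | yes refl = subst PairwiseCoprime (sym new)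
                         ((s≤s (≤-trans (s≤s z≤n) K<y) , Coprime.sym (N⊥q m)) ∷ pairwise m)
      ... | no j≢m   = subst PairwiseCoprime (sym (old j≢m)) (pairwise j)
      separate-new : ∀ {i} → i ≢ m → Coprime (List.product (group′ i)) (List.product (group′ m))
      separate-new {i} i≢m = subst₂ Coprime (sym (cong List.product (old i≢m))) (sym Nnew)
        (coprime-* (N⊥q i) (separate i≢m))
      separate′ : ∀ {i j} → i ≢ j → Coprime (List.product (group′ i)) (List.product (group′ j))
      separate′ {i} {j} i≢j with i Fin.≟ m | j Fin.≟ m
      ... | yes refl | yes refl = contradiction refl i≢j
      ... | yes refl | no j≢m   = Coprime.sym (separate-new j≢m)
      ... | no i≢m   | yes refl = separate-new i≢m
      ... | no i≢m   | no j≢m   = subst₂ Coprime (sym (cong List.product (old i≢m))) (sym (cong List.product (old j≢m))) (separate i≢j)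
      primes′ : ∀ j → All (λ r → Prime r × suc K < r × r ≤ q) (group′ j)
      primes′ j with j Fin.≟ m
      ... | yes refl = subst (All _) (sym new)
                         ((p , s≤s K<y , ≤-refl) ∷ All.map (λ (p , k , u) → p , k , m≤n⇒m≤1+n u) (primes m))
      ... | no j≢m   = subst (All _) (sym (old j≢m)) (All.map (λ (p , k , u) → p , k , m≤n⇒m≤1+n u) (primes j))
      q≤2y : q ≤ 2 * y
      q≤2y = ≤-trans (≤-reflexive (+-comm 1 y)) (+-monoʳ-≤ y (≤-trans (≤-trans (s≤s z≤n) K<y) (m≤m+n y 0)))
      balanced′ : ∀ i j → List.product (group′ i) * totient (group′ j) ≤ 2 * (List.product (group′ j) * totient (group′ i))
      balanced′ i j with i Fin.≟ m | j Fin.≟ m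
      ... | yes refl | yes refl = m≤n*m _ 2
      ... | no i≢m   | no j≢m   rewrite old i≢m | old j≢m = balanced i j
      ... | yes refl | no j≢m   rewrite new | old j≢m = begin
        q * N m * φ j              ≡⟨ *-assoc q (N m) (φ j) ⟩
        q * (N m * φ j)            ≤⟨ *-mono-≤ q≤2y (least j) ⟩
        2 * y * (N j * φ m)        ≡⟨ regroup y (N j) (φ m) ⟩
        2 * (N j * (y * φ m))      ∎
        where
        regroup : ∀ y n f → 2 * y * (n * f) ≡ 2 * (n * (y * f))
        regroup = solveℕ
      ... | no i≢m   | yes refl rewrite old i≢m | new = begin
        N i * (y * φ m)            ≡⟨ swap (N i) y (φ m) ⟩
        y * (N i * φ m)            ≤⟨ *-mono-≤ (n≤1+n y) (balanced i m) ⟩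
        q * (2 * (N m * φ i))      ≡⟨ regroup q (N m) (φ i) ⟩
        2 * (q * N m * φ i)        ∎
        where
        regroup : ∀ q n f → q * (2 * (n * f)) ≡ 2 * (q * n * f)
        regroup = solveℕ

    groups : ∀ i → Groups (i + suc K)
    groups zero    = no-groups
    groups (suc i) with prime? (suc (i + suc K))
    ... | yes p = prime-step (m≤n+m (suc K) i) p (groups i)
    ... | no ¬p = composite-step (m≤n+m (suc K) i) ¬p (groups i)

    module _ (E : ℕ) (G : Groups (2 ^ E)) where
      open Groups G
      open ≤-Reasoning

      -- Balance bounds each ratio Nᵢ/φᵢ by 2Nⱼ/φⱼ, hence their product by (2Nⱼ/φⱼ)ˡ⁺¹. Euler's
      -- product bounds the same product below by E/(2(K+1)).
      group-bound : ∀ j → E * φ j ^ suc l ≤ 2 ^ suc l * (2 * suc K) * N j ^ suc l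
      group-bound j = *-cancelʳ-≤ _ _ (∏ᴺ N) ⦃ ℕ.>-nonZero (∏ᴺ-positive N (product-positive ∘ pairwise)) ⦄ (begin
        E * φ j ^ suc l * ∏ᴺ N                             ≡⟨ swap E (φ j ^ suc l) (∏ᴺ N) ⟩
        E * (∏ᴺ N * φ j ^ suc l)                           ≤⟨ *-monoʳ-≤ E (∏ᴺ-ratio N φ (φ j) (N j) 2 (λ i → balanced i j)) ⟩
        E * (2 ^ suc l * (N j ^ suc l * ∏ᴺ φ))             ≡⟨ pull E (2 ^ suc l) (N j ^ suc l) (∏ᴺ φ) ⟩
        2 ^ suc l * N j ^ suc l * (E * ∏ᴺ φ)               ≤⟨ *-monoʳ-≤ (2 ^ suc l * N j ^ suc l) euler ⟩
        2 ^ suc l * N j ^ suc l * (2 * suc K * ∏ᴺ N)       ≡⟨ pull′ (2 ^ suc l) (N j ^ suc l) (2 * suc K) (∏ᴺ N) ⟩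
        2 ^ suc l * (2 * suc K) * N j ^ suc l * ∏ᴺ N       ∎)
        where
        swap : ∀ e f n → e * f * n ≡ e * (n * f)
        swap = solveℕ
        pull : ∀ e a b c → e * (a * (b * c)) ≡ a * b * (e * c)
        pull = solveℕ
        pull′ : ∀ a b c d → a * b * (c * d) ≡ a * c * b * d
        pull′ = solveℕ
        -- The integers 2, ..., K+1 of the sieve contribute (K+1)! and K!; after cancelling, K+1
        -- remains.
        euler : E * ∏ᴺ φ ≤ 2 * suc K * ∏ᴺ N
        euler = *-cancelˡ-≤ (K !) ⦃ K !≢0 ⦄ (begin
          K ! * (E * ∏ᴺ φ)                 ≡⟨ exchange (K !) E (∏ᴺ φ) ⟩
          E * (K ! * ∏ᴺ φ)                 ≡⟨ cong (E *_) totient≡ ⟨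
          E * totient sieving              ≤⟨ euler-product E sieving positive cover ⟩
          2 * List.product sieving         ≡⟨ cong (2 *_) product≡ ⟩
          2 * (suc K ! * ∏ᴺ N)             ≡⟨ exchange′ K (K !) (∏ᴺ N) ⟩
          K ! * (2 * suc K * ∏ᴺ N)         ∎)
          where
          exchange : ∀ a b c → a * (b * c) ≡ b * (a * c)
          exchange = solveℕ
          exchange′ : ∀ k f n → 2 * (suc k * f * n) ≡ f * (2 * suc k * n)
          exchange′ = solveℕ

      group-coprime : ∀ {k} j → 1 ≤ k → k ≤ suc K → Coprime (N j) k
      group-coprime {k} j 1≤k k≤K = coprime-product (group j) (All.map q⊥k (primes j))
        where
        q⊥k : ∀ {q} → Prime q × suc K < q × q ≤ 2 ^ E → Coprime q k
        q⊥k (p , K<q , _) = Coprime.prime⇒coprime p ⦃ ℕ.>-nonZero 1≤k ⦄ (≤-<-trans k≤K K<q)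

      group-divides : ∀ j → N j ∣ (2 ^ E) !
      group-divides j = ∣-trans (∣-∏ᴺ N j) ∏N∣y!

    prime-groups : ∀ E → suc K ≤ 2 ^ E → Groups (2 ^ E)
    prime-groups E le = subst Groups (m∸n+n≡m le) (groups (2 ^ E ℕ.∸ suc K))

-- The multiplier γ and the factorisation of f(g(t))

module Factorisation where
  open import Defs
  open PolynomialRing
  open Degree
  open CyclotomicFactors
  open PrimeGroups
  import Algebra.Properties.CommutativeSemiring.Exp as Exp
  open import Data.Fin.Base using (Fin; zero; suc)
  import Data.Fin.Properties as Fin
  open import Data.Integer.Base as ℤ using (ℤ; 0ℤ; 1ℤ)
  import Data.Integer.Properties as ℤ
  open import Data.Integer.Tactic.RingSolver using () renaming (solve-∀ to solveℤ)
  open import Data.List.Base using (List; [])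
  open import Data.List.Relation.Unary.All using ([])
  import Data.Nat.ListAction as List
  open import Data.Nat.Base as ℕ using (ℕ; zero; suc; _≤_; z≤n; s≤s; _!)

  open import Data.Nat.Coprimality as Coprime using (Coprime; coprime-Bézout)
  open import Data.Nat.Divisibility as ℕ∣ using (divides)
  open import Data.Nat.GCD using (module Bézout)
  import Data.Nat.Properties as ℕ
  open import Data.Nat.Properties using (_!≢0)
  open import Data.Nat.Tactic.RingSolver using () renaming (solve-∀ to solveℕ)
  open import Data.Product.Base using (∃-syntax; _×_; _,_; proj₁; proj₂)
  open import Data.Sum.Base using ([_,_]′)
  open import Function.Base using (_∘_)
  open import Relation.Binary.PropositionalEquality
  open import Relation.Nullary using (yes; no)
  import Tactic.RingSolver as Solver

  module ℤ^ = Exp ℤ.+-*-commutativeSemiring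
  open ℤ^ using () renaming (_^_ to _^ᶻ_)

  -- The inverse of M modulo N and its negative are both wanted with natural coefficients, since
  -- these become exponents of integers. `coprime-Bézout` provides only one of the two; multiplying
  -- it by a number congruent to -1 modulo N gives the other.
  bézout⁺ : ∀ {N M} → Coprime N M → 1 ≤ N → 1 ≤ M →
    (∃[ u ] ∃[ s ] 1 ℕ.+ u ℕ.* M ≡ s ℕ.* N) × (∃[ v ] ∃[ t ] v ℕ.* M ≡ 1 ℕ.+ t ℕ.* N)
  bézout⁺ {suc n} {M} c _ 1≤M with coprime-Bézout c
  ... | Bézout.-+ x y eq =
    (y ℕ.* n , 1 ℕ.+ x ℕ.* n , trans (regroup y n M) (trans (cong (λ w → 1 ℕ.+ w ℕ.* n) (sym eq)) (collect x n))) ,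
    (y , x , sym eq)
    where
    regroup : ∀ y n M → 1 ℕ.+ y ℕ.* n ℕ.* M ≡ 1 ℕ.+ y ℕ.* M ℕ.* n
    regroup = solveℕ
    collect : ∀ x n → 1 ℕ.+ (1 ℕ.+ x ℕ.* suc n) ℕ.* n ≡ (1 ℕ.+ x ℕ.* n) ℕ.* suc n
    collect = solveℕ
  bézout⁺ {suc n} {suc m} c _ _ | Bézout.+- (suc x) y eq =
    (y , suc x , eq) ,
    -- Here yM ≡ -1 modulo N. The factor 1 + 2n = 2N - 1 is again -1 modulo N; taking it instead of
    -- N - 1, and y + N instead of y, keeps t ≥ 0 even for N = 1.
    ((y ℕ.+ suc n) ℕ.* (1 ℕ.+ 2 ℕ.* n) , t , ℕ.+-cancelˡ-≡ (1 ℕ.+ 2 ℕ.* n) _ _ (begin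
      1 ℕ.+ 2 ℕ.* n ℕ.+ (y ℕ.+ suc n) ℕ.* (1 ℕ.+ 2 ℕ.* n) ℕ.* suc m      ≡⟨ regroup y n m ⟩
      (1 ℕ.+ 2 ℕ.* n) ℕ.* (1 ℕ.+ y ℕ.* suc m ℕ.+ suc n ℕ.* suc m)        ≡⟨ cong (λ w → (1 ℕ.+ 2 ℕ.* n) ℕ.* (w ℕ.+ suc n ℕ.* suc m)) eq ⟩
      (1 ℕ.+ 2 ℕ.* n) ℕ.* (suc x ℕ.* suc n ℕ.+ suc n ℕ.* suc m)          ≡⟨ collect x n m ⟩
      1 ℕ.+ 2 ℕ.* n ℕ.+ (1 ℕ.+ t ℕ.* suc n)                              ∎))
    where
    open ≡-Reasoning
    t = (x ℕ.+ m) ℕ.* (1 ℕ.+ 2 ℕ.* n) ℕ.+ 4 ℕ.* n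
    regroup : ∀ y n m → 1 ℕ.+ 2 ℕ.* n ℕ.+ (y ℕ.+ suc n) ℕ.* (1 ℕ.+ 2 ℕ.* n) ℕ.* suc m ≡
                        (1 ℕ.+ 2 ℕ.* n) ℕ.* (1 ℕ.+ y ℕ.* suc m ℕ.+ suc n ℕ.* suc m)
    regroup = solveℕ
    collect : ∀ x n m → (1 ℕ.+ 2 ℕ.* n) ℕ.* (suc x ℕ.* suc n ℕ.+ suc n ℕ.* suc m) ≡
                        1 ℕ.+ 2 ℕ.* n ℕ.+ (1 ℕ.+ ((x ℕ.+ m) ℕ.* (1 ℕ.+ 2 ℕ.* n) ℕ.+ 4 ℕ.* n) ℕ.* suc n)
    collect = solveℕ

  *-≢0 : ∀ {i j} → i ≢ 0ℤ → j ≢ 0ℤ → i ℤ.* j ≢ 0ℤ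
  *-≢0 {i} i≢0 j≢0 = [ i≢0 , j≢0 ]′ ∘ ℤ.i*j≡0⇒i≡0∨j≡0 i

  ^ᶻ-≢0 : ∀ {i} n → i ≢ 0ℤ → i ^ᶻ n ≢ 0ℤ
  ^ᶻ-≢0 zero    i≢0 = λ ()
  ^ᶻ-≢0 (suc n) i≢0 = *-≢0 i≢0 (^ᶻ-≢0 n i≢0)

  coprime-∏ᴺ : ∀ {l n} (N : Fin l → ℕ) → (∀ j → Coprime n (N j)) → Coprime n (∏ᴺ N)
  coprime-∏ᴺ {zero}  N c = Coprime.sym (Coprime.1-coprimeTo _)
  coprime-∏ᴺ {suc l} N c = coprime-* (c zero) (coprime-∏ᴺ (N ∘ suc) (c ∘ suc))

  -- δ = Aᵘ bᵛ with 1 + uM = sN and vM = 1 + tN.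
  power-multiplier : ∀ {N M} A b → Coprime N M → 1 ≤ N → 1 ≤ M → A ≢ 0ℤ → b ≢ 0ℤ →
    ∃[ δ ] δ ≢ 0ℤ × ∃[ β ] β ≢ 0ℤ × A ℤ.* δ ^ᶻ M ≡ b ℤ.* β ^ᶻ N
  power-multiplier {N} {M} A b c 1≤N 1≤M A≢0 b≢0 with bézout⁺ c 1≤N 1≤M
  ... | (u , s , eu) , (v , t , ev) =
    A ^ᶻ u ℤ.* b ^ᶻ v , *-≢0 (^ᶻ-≢0 u A≢0) (^ᶻ-≢0 v b≢0) ,
    A ^ᶻ s ℤ.* b ^ᶻ t , *-≢0 (^ᶻ-≢0 s A≢0) (^ᶻ-≢0 t b≢0) , (begin
      A ℤ.* (A ^ᶻ u ℤ.* b ^ᶻ v) ^ᶻ M             ≡⟨ cong (A ℤ.*_) (ℤ^.^-distrib-* (A ^ᶻ u) (b ^ᶻ v) M) ⟩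
      A ℤ.* ((A ^ᶻ u) ^ᶻ M ℤ.* (b ^ᶻ v) ^ᶻ M)    ≡⟨ cong₂ (λ x y → A ℤ.* (x ℤ.* y)) (ℤ^.^-assocʳ A u M) (ℤ^.^-assocʳ b v M) ⟩
      A ℤ.* (A ^ᶻ (u ℕ.* M) ℤ.* b ^ᶻ (v ℕ.* M))  ≡⟨ ℤ.*-assoc A _ _ ⟨
      A ^ᶻ (1 ℕ.+ u ℕ.* M) ℤ.* b ^ᶻ (v ℕ.* M)    ≡⟨ cong₂ (λ x y → A ^ᶻ x ℤ.* b ^ᶻ y) eu ev ⟩
      A ^ᶻ (s ℕ.* N) ℤ.* (b ℤ.* b ^ᶻ (t ℕ.* N))  ≡⟨ cong₂ (λ x y → x ℤ.* (b ℤ.* y)) (ℤ^.^-assocʳ A s N) (ℤ^.^-assocʳ b t N) ⟨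
      (A ^ᶻ s) ^ᶻ N ℤ.* (b ℤ.* (b ^ᶻ t) ^ᶻ N)    ≡⟨ swap ((A ^ᶻ s) ^ᶻ N) b _ ⟩
      b ℤ.* ((A ^ᶻ s) ^ᶻ N ℤ.* (b ^ᶻ t) ^ᶻ N)    ≡⟨ cong (b ℤ.*_) (ℤ^.^-distrib-* (A ^ᶻ s) (b ^ᶻ t) N) ⟨
      b ℤ.* (A ^ᶻ s ℤ.* b ^ᶻ t) ^ᶻ N             ∎)
    where
    open ≡-Reasoning
    swap : ∀ x y z → x ℤ.* (y ℤ.* z) ≡ y ℤ.* (x ℤ.* z)
    swap = solveℤ

  -- γ = γ′ δᴰ, where γ′ serves all indices but the first and D is the product
  -- of their Nⱼ.
  simultaneous-powers : ∀ {l} (N k : Fin l → ℕ) (a b : Fin l → ℤ) →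
    (∀ j → 1 ≤ N j) → (∀ j → 1 ≤ k j) → (∀ j → Coprime (N j) (k j)) →
    (∀ {i j} → i ≢ j → Coprime (N i) (N j)) → (∀ j → a j ≢ 0ℤ) → (∀ j → b j ≢ 0ℤ) →
    ∃[ γ ] γ ≢ 0ℤ × (∀ j → ∃[ β ] β ≢ 0ℤ × a j ℤ.* γ ^ᶻ k j ≡ b j ℤ.* β ^ᶻ N j)
  simultaneous-powers {zero}  N k a b _ _ _ _ _ _ = 1ℤ , (λ ()) , λ ()
  simultaneous-powers {suc l} N k a b 1≤N 1≤k N⊥k N⊥N a≢0 b≢0 =
    extend
      (simultaneous-powers (N ∘ suc) (k ∘ suc) (a ∘ suc) (b ∘ suc) (1≤N ∘ suc) (1≤k ∘ suc)
        (N⊥k ∘ suc) (λ i≢j → N⊥N (i≢j ∘ Fin.suc-injective)) (a≢0 ∘ suc) (b≢0 ∘ suc))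
    where
    open ≡-Reasoning
    D = ∏ᴺ (N ∘ suc)
    Result : Set
    Result = ∃[ γ ] γ ≢ 0ℤ × (∀ j → ∃[ β ] β ≢ 0ℤ × a j ℤ.* γ ^ᶻ k j ≡ b j ℤ.* β ^ᶻ N j)
    expand : ∀ a γ δ k → a ℤ.* (γ ℤ.* δ ^ᶻ D) ^ᶻ k ≡ a ℤ.* γ ^ᶻ k ℤ.* δ ^ᶻ (D ℕ.* k)
    expand a γ δ k = begin
      a ℤ.* (γ ℤ.* δ ^ᶻ D) ^ᶻ k               ≡⟨ cong (a ℤ.*_) (ℤ^.^-distrib-* γ (δ ^ᶻ D) k) ⟩
      a ℤ.* (γ ^ᶻ k ℤ.* (δ ^ᶻ D) ^ᶻ k)        ≡⟨ ℤ.*-assoc a _ _ ⟨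
      a ℤ.* γ ^ᶻ k ℤ.* (δ ^ᶻ D) ^ᶻ k          ≡⟨ cong (a ℤ.* γ ^ᶻ k ℤ.*_) (ℤ^.^-assocʳ δ D k) ⟩
      a ℤ.* γ ^ᶻ k ℤ.* δ ^ᶻ (D ℕ.* k)         ∎
    extend : ∃[ γ ] γ ≢ 0ℤ × (∀ j → ∃[ β ] β ≢ 0ℤ × a (suc j) ℤ.* γ ^ᶻ k (suc j) ≡ b (suc j) ℤ.* β ^ᶻ N (suc j)) → Result
    extend (γ , γ≢0 , tail)
      -- In the first equation δ has exponent D times the first k, which is coprime to the first N.
      -- The other equations survive: their Nⱼ divides D, so the power of δ is an Nⱼ-th power and is
      -- absorbed into β.
      with power-multiplier (a zero ℤ.* γ ^ᶻ k zero) (b zero)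
             (coprime-* (coprime-∏ᴺ (N ∘ suc) (λ j → N⊥N {zero} {suc j} λ ())) (N⊥k zero))
             (1≤N zero) (ℕ.*-mono-≤ (∏ᴺ-positive (N ∘ suc) (1≤N ∘ suc)) (1≤k zero))
             (*-≢0 (a≢0 zero) (^ᶻ-≢0 (k zero) γ≢0)) (b≢0 zero)
    ... | δ , δ≢0 , β , β≢0 , eq =
      γ ℤ.* δ ^ᶻ D , *-≢0 γ≢0 (^ᶻ-≢0 D δ≢0) , λ where
        zero    → β , β≢0 , trans (expand (a zero) γ δ (k zero)) eq
        (suc j) → scaled j (tail j) (∣-∏ᴺ (N ∘ suc) j)
      where
      scaled : ∀ j → (∃[ β ] β ≢ 0ℤ × a (suc j) ℤ.* γ ^ᶻ k (suc j) ≡ b (suc j) ℤ.* β ^ᶻ N (suc j)) → N (suc j) ℕ∣.∣ D →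
        ∃[ β ] β ≢ 0ℤ × a (suc j) ℤ.* (γ ℤ.* δ ^ᶻ D) ^ᶻ k (suc j) ≡ b (suc j) ℤ.* β ^ᶻ N (suc j)
      scaled j (β′ , β′≢0 , eq′) (divides q D≡) =
        β′ ℤ.* δ ^ᶻ (q ℕ.* k′) , *-≢0 β′≢0 (^ᶻ-≢0 (q ℕ.* k′) δ≢0) , (begin
          a (suc j) ℤ.* (γ ℤ.* δ ^ᶻ D) ^ᶻ k′                   ≡⟨ expand (a (suc j)) γ δ k′ ⟩
          a (suc j) ℤ.* γ ^ᶻ k′ ℤ.* δ ^ᶻ (D ℕ.* k′)            ≡⟨ cong₂ ℤ._*_ eq′ (cong (δ ^ᶻ_) (trans (cong (ℕ._* k′) D≡) (swap q N′ k′))) ⟩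
          b (suc j) ℤ.* β′ ^ᶻ N′ ℤ.* δ ^ᶻ (q ℕ.* k′ ℕ.* N′)    ≡⟨ cong (b (suc j) ℤ.* β′ ^ᶻ N′ ℤ.*_) (ℤ^.^-assocʳ δ (q ℕ.* k′) N′) ⟨
          b (suc j) ℤ.* β′ ^ᶻ N′ ℤ.* (δ ^ᶻ (q ℕ.* k′)) ^ᶻ N′   ≡⟨ ℤ.*-assoc (b (suc j)) _ _ ⟩
          b (suc j) ℤ.* (β′ ^ᶻ N′ ℤ.* (δ ^ᶻ (q ℕ.* k′)) ^ᶻ N′) ≡⟨ cong (b (suc j) ℤ.*_) (ℤ^.^-distrib-* β′ (δ ^ᶻ (q ℕ.* k′)) N′) ⟨
          b (suc j) ℤ.* (β′ ℤ.* δ ^ᶻ (q ℕ.* k′)) ^ᶻ N′         ∎)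
        where
        k′ = k (suc j)
        N′ = N (suc j)
        swap : ∀ q n k → q ℕ.* n ℕ.* k ≡ q ℕ.* k ℕ.* n
        swap = solveℕ

  ^-distrib-*ᵖ : ∀ p q n → (p *ᵖ q) ^ n ≋ p ^ n *ᵖ q ^ n
  ^-distrib-*ᵖ p q zero    = ≋.sym (*ᵖ-identityˡ (C 1ℤ))
  ^-distrib-*ᵖ p q (suc n) = ≋.trans (*ᵖ-congˡ (p *ᵖ q) (^-distrib-*ᵖ p q n)) (interchange′ p q (p ^ n) (q ^ n))
    where
    interchange′ : ∀ p q r s → (p *ᵖ q) *ᵖ (r *ᵖ s) ≋ (p *ᵖ r) *ᵖ (q *ᵖ s)
    interchange′ = Solver.solve-∀ polySolverRing

  C-^ : ∀ a n → C a ^ n ≋ C (a ^ᶻ n)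
  C-^ a zero    = ≋.refl
  C-^ a (suc n) = ≋.trans (*ᵖ-congˡ (C a) (C-^ a n)) (≋.sym (C-*C a (a ^ᶻ n)))

  monomial-^ : ∀ a n k → (C a *ᵖ X ^ n) ^ k ≋ C (a ^ᶻ k) *ᵖ X ^ (n ℕ.* k)
  monomial-^ a n k = ≋.trans (^-distrib-*ᵖ (C a) (X ^ n) k) (*ᵖ-cong (C-^ a k) (^-*-assoc X n k))

  binomial : ℤ → ℤ → ℕ → Poly → Poly
  binomial a b k g = C a *ᵖ g ^ k +ᵖ C (ℤ.- b)

  binomial-⟨⟩ : ∀ a b k g → binomial a b k X ⟨ g ⟩ ≋ binomial a b k g
  binomial-⟨⟩ a b k g = ≋.trans (⟨⟩-+ (C a *ᵖ X ^ k) (C (ℤ.- b)) g) (+ᵖ-cong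
    (≋.trans (⟨⟩-* (C a) (X ^ k) g) (*ᵖ-cong (⟨⟩-C a g) (≋.trans (⟨⟩-^ X k g) (^-cong k (⟨⟩-X g)))))
    (⟨⟩-C (ℤ.- b) g))

  ∏ᵖ-cong : ∀ {l} {p q : Fin l → Poly} → (∀ j → p j ≋ q j) → ∏ᵖ p ≋ ∏ᵖ q
  ∏ᵖ-cong {zero}  e = ≋.refl
  ∏ᵖ-cong {suc l} e = *ᵖ-cong (e zero) (∏ᵖ-cong (e ∘ suc))

  binomialProduct-⟨⟩ : ∀ {l} a b (k : Fin l → ℕ) g →
    binomialProduct a b k ⟨ g ⟩ ≋ ∏ᵖ (λ j → binomial (a j) (b j) (k j) g)
  binomialProduct-⟨⟩ a b k g =
    ≋.trans (⟨⟩-∏ (λ j → binomial (a j) (b j) (k j) X) g) (∏ᵖ-cong λ j → binomial-⟨⟩ (a j) (b j) (k j) g)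

  binomial-degree : ∀ {a g d k} b → a ≢ 0ℤ → 1 ≤ k → 1 ≤ d → HasDegree g d → HasDegree (binomial a b k g) (k ℕ.* d)
  binomial-degree {a} {g} {d} {k} b a≢0 1≤k 1≤d dg with k ℕ.* d in eq | ℕ.*-mono-≤ 1≤k 1≤d
  ... | suc n | _ = hasDegree-+C (ℤ.- b)
    (subst (HasDegree (C a *ᵖ g ^ k)) eq (hasDegree-* (hasDegree-C a≢0) (hasDegree-^ k dg)))

  ∏ᵖ-degree : ∀ {l} (p : Fin l → Poly) → (∀ j → ∃[ n ] 1 ≤ n × HasDegree (p j) n) →
    ∃[ n ] l ≤ n × HasDegree (∏ᵖ p) n
  ∏ᵖ-degree {zero}  p d = 0 , z≤n , hasDegree-1
  ∏ᵖ-degree {suc l} p d with d zero | ∏ᵖ-degree (p ∘ suc) (d ∘ suc)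
  ... | m , 1≤m , dm | n , l≤n , dn = m ℕ.+ n , ℕ.+-mono-≤ 1≤m l≤n , hasDegree-* dm dn

  factored-∏ : ∀ {P l} (p : Fin l → Poly) → (∀ j → Factored P (p j)) → Factored P (∏ᵖ p)
  factored-∏ {l = zero}  p f = factored [] ≋.refl []
  factored-∏ {l = suc l} p f = factored-* (f zero) (factored-∏ (p ∘ suc) (f ∘ suc))

  ∏ᶻ-≢0 : ∀ {l} (a : Fin l → ℤ) → ∏ᶻ a ≢ 0ℤ → ∀ j → a j ≢ 0ℤ
  ∏ᶻ-≢0 a ∏≢0 zero    a≡0 = ∏≢0 (cong (ℤ._* ∏ᶻ (a ∘ suc)) a≡0)
  ∏ᶻ-≢0 a ∏≢0 (suc j) = ∏ᶻ-≢0 (a ∘ suc) (λ z → ∏≢0 (trans (cong (a zero ℤ.*_) z) (ℤ.*-zeroʳ (a zero)))) j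

  -- The constant with which a is made a perfect power: for b = 0 the factor
  -- a t^k is already a product of linear ones, and any constant will do.
  target : ℤ → ℤ
  target b with b ℤ.≟ 0ℤ
  ... | yes _ = 1ℤ
  ... | no  _ = b

  target-≢0 : ∀ b → target b ≢ 0ℤ
  target-≢0 b with b ℤ.≟ 0ℤ
  ... | yes _  = λ ()
  ... | no b≢0 = b≢0

  binomial-factored : ∀ {a b γ β k e qs} → PairwiseCoprime qs → 1 ≤ k → 1 ≤ e → β ≢ 0ℤ →
    a ℤ.* γ ^ᶻ k ≡ target b ℤ.* β ^ᶻ List.product qs →
    Factored (_≤ e ℕ.* k ℕ.* totient qs) (binomial a b k (C γ *ᵖ X ^ (e ℕ.* List.product qs)))
  binomial-factored {a} {b} {γ} {β} {k} {e} {qs} pc 1≤k 1≤e β≢0 eq with b ℤ.≟ 0ℤ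
  -- With target 1 the factor becomes yᴺ: N copies of y, whose degree ek is within the bound because
  -- φ ≥ 1.
  ... | yes refl = factored-cong (≋.sym power) (factored-^ N (factored-single
      (subst (_≤ e ℕ.* k ℕ.* totient qs) (sym (hasDegree⇒deg y dy))
        (ℕ.m≤m*n (e ℕ.* k) (totient qs) ⦃ ℕ.>-nonZero (totient-positive pc) ⦄))))
    where
    open ≋-Reasoning
    N = List.product qs
    y = C β *ᵖ X ^ (e ℕ.* k)
    dy : HasDegree y (e ℕ.* k)
    dy = hasDegree-* (hasDegree-C β≢0) (hasDegree-X^ (e ℕ.* k))
    swap : ∀ e n k → e ℕ.* n ℕ.* k ≡ e ℕ.* k ℕ.* n
    swap = solveℕ
    power : binomial a 0ℤ k (C γ *ᵖ X ^ (e ℕ.* N)) ≋ y ^ N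
    power = begin
      C a *ᵖ (C γ *ᵖ X ^ (e ℕ.* N)) ^ k +ᵖ C 0ℤ          ≈⟨ +ᵖ-cong (*ᵖ-congˡ (C a) (monomial-^ γ (e ℕ.* N) k)) 0∷[]≋[] ⟩
      C a *ᵖ (C (γ ^ᶻ k) *ᵖ X ^ (e ℕ.* N ℕ.* k)) +ᵖ []   ≈⟨ +ᵖ-identityʳ _ ⟩
      C a *ᵖ (C (γ ^ᶻ k) *ᵖ X ^ (e ℕ.* N ℕ.* k))         ≈⟨ *ᵖ-assoc (C a) (C (γ ^ᶻ k)) _ ⟨
      (C a *ᵖ C (γ ^ᶻ k)) *ᵖ X ^ (e ℕ.* N ℕ.* k)         ≈⟨ *ᵖ-cong (≋.sym (C-*C a (γ ^ᶻ k))) (≋.reflexive (cong (X ^_) (swap e N k))) ⟩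
      C (a ℤ.* γ ^ᶻ k) *ᵖ X ^ (e ℕ.* k ℕ.* N)            ≡⟨ cong (λ c → C c *ᵖ X ^ (e ℕ.* k ℕ.* N)) (trans eq (ℤ.*-identityˡ (β ^ᶻ N))) ⟩
      C (β ^ᶻ N) *ᵖ X ^ (e ℕ.* k ℕ.* N)                  ≈⟨ monomial-^ β (e ℕ.* k) N ⟨
      y ^ N                                              ∎
  ... | no b≢0 = factored-cong (≋.sym power) (factored-* {f = C b} (factored-single {f = C b} constant) family)
    where
    open ≋-Reasoning
    N = List.product qs
    y = C β *ᵖ X ^ (e ℕ.* k)
    dy : HasDegree y (e ℕ.* k)
    dy = hasDegree-* (hasDegree-C β≢0) (hasDegree-X^ (e ℕ.* k))
    swap : ∀ e n k → e ℕ.* n ℕ.* k ≡ e ℕ.* k ℕ.* n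
    swap = solveℕ
    collect : ∀ a g w b m → a *ᵖ (g *ᵖ w) +ᵖ b *ᵖ m ≋ (a *ᵖ g) *ᵖ w +ᵖ b *ᵖ m
    collect = Solver.solve-∀ polySolverRing
    pull : ∀ b c w m → (b *ᵖ c) *ᵖ w +ᵖ b *ᵖ m ≋ b *ᵖ (c *ᵖ w +ᵖ m)
    pull = Solver.solve-∀ polySolverRing
    negate : C (ℤ.- b) ≋ C b *ᵖ C (ℤ.- 1ℤ)
    negate = ≋.trans (≋.reflexive (cong C (neg b))) (C-*C b (ℤ.- 1ℤ))
      where
      neg : ∀ b → ℤ.- b ≡ b ℤ.* ℤ.- 1ℤ
      neg = solveℤ
    power : binomial a b k (C γ *ᵖ X ^ (e ℕ.* N)) ≋ C b *ᵖ ((y ^ N) −1)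
    power = begin
      C a *ᵖ (C γ *ᵖ X ^ (e ℕ.* N)) ^ k +ᵖ C (ℤ.- b)
        ≈⟨ +ᵖ-cong (*ᵖ-congˡ (C a) (monomial-^ γ (e ℕ.* N) k)) negate ⟩
      C a *ᵖ (C (γ ^ᶻ k) *ᵖ X ^ (e ℕ.* N ℕ.* k)) +ᵖ C b *ᵖ C (ℤ.- 1ℤ)
        ≈⟨ collect (C a) (C (γ ^ᶻ k)) (X ^ (e ℕ.* N ℕ.* k)) (C b) (C (ℤ.- 1ℤ)) ⟩
      (C a *ᵖ C (γ ^ᶻ k)) *ᵖ X ^ (e ℕ.* N ℕ.* k) +ᵖ C b *ᵖ C (ℤ.- 1ℤ)
        ≈⟨ +ᵖ-cong (*ᵖ-cong coefficient (≋.reflexive (cong (X ^_) (swap e N k)))) ≋.refl ⟩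
      (C b *ᵖ C (β ^ᶻ N)) *ᵖ X ^ (e ℕ.* k ℕ.* N) +ᵖ C b *ᵖ C (ℤ.- 1ℤ)
        ≈⟨ pull (C b) (C (β ^ᶻ N)) (X ^ (e ℕ.* k ℕ.* N)) (C (ℤ.- 1ℤ)) ⟩
      C b *ᵖ (C (β ^ᶻ N) *ᵖ X ^ (e ℕ.* k ℕ.* N) +ᵖ C (ℤ.- 1ℤ))
        ≈⟨ *ᵖ-congˡ (C b) (+ᵖ-cong (monomial-^ β (e ℕ.* k) N) (≋.refl {C (ℤ.- 1ℤ)})) ⟨
      C b *ᵖ ((y ^ N) −1)
        ∎
      where
      coefficient : C a *ᵖ C (γ ^ᶻ k) ≋ C b *ᵖ C (β ^ᶻ N)
      coefficient = ≋.trans (≋.sym (C-*C a (γ ^ᶻ k))) (≋.trans (≋.reflexive (cong C eq)) (C-*C b (β ^ᶻ N)))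
    constant : deg (C b) ≤ e ℕ.* k ℕ.* totient qs
    constant = subst (_≤ e ℕ.* k ℕ.* totient qs) (sym (hasDegree⇒deg (C b) (hasDegree-C b≢0))) z≤n
    family : Factored (_≤ e ℕ.* k ℕ.* totient qs) ((y ^ N) −1)
    family = factored-cong
      (≋.reflexive (cong (λ n → (y ^ n) −1) (ℕ.*-identityˡ N)))
      (factored-map (λ le → ℕ.≤-trans le (ℕ.≤-reflexive (cong (ℕ._* totient qs) (ℕ.*-identityʳ (e ℕ.* k)))))
        (factored-family {n = 1} (power-family (ℕ.*-mono-≤ 1≤e 1≤k) dy) (s≤s z≤n) pc (Coprime.sym (Coprime.1-coprimeTo N))))

  bound-above : ∀ {l} (k : Fin l → ℕ) → ∃[ K ] ∀ j → k j ≤ suc K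
  bound-above {zero}  k = 0 , λ ()
  bound-above {suc l} k with bound-above (k ∘ suc)
  ... | K , k≤ = k zero ℕ.⊔ K , λ where
    zero    → ℕ.≤-trans (ℕ.m≤m⊔n (k zero) K) (ℕ.n≤1+n _)
    (suc j) → ℕ.≤-trans (k≤ j) (s≤s (ℕ.m≤n⊔m (k zero) K))

  -- n is at most K+1 times d φ/N for one of the groups of primes, whose
  -- ratio N/φ is of order E^(1/(l+1)).
  SmallDegree : (l K E d n : ℕ) → Set
  SmallDegree l K E d n = ∃[ N ] ∃[ φ ] 1 ≤ N × 1 ≤ φ ×
    n ℕ.* N ≤ suc K ℕ.* φ ℕ.* d × E ℕ.* φ ℕ.^ suc l ≤ 2 ℕ.^ suc l ℕ.* (2 ℕ.* suc K) ℕ.* N ℕ.^ suc l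

  module _ (l K E : ℕ) (G : Groups l K (2 ℕ.^ E)) (k : Fin (suc l) → ℕ) (1≤k : ∀ j → 1 ≤ k j) (k≤K : ∀ j → k j ≤ suc K)
           (a b : Fin (suc l) → ℤ) (∏a≢0 : ∏ᶻ a ≢ 0ℤ) where
    private
      open Groups G

      D : ℕ
      D = (2 ℕ.^ E) !

      a≢0 : ∀ j → a j ≢ 0ℤ
      a≢0 = ∏ᶻ-≢0 a ∏a≢0

      powers : ∃[ γ ] γ ≢ 0ℤ × (∀ j → ∃[ β ] β ≢ 0ℤ × a j ℤ.* γ ^ᶻ k j ≡ target (b j) ℤ.* β ^ᶻ N j)
      powers = simultaneous-powers N k a (target ∘ b) (product-positive ∘ pairwise) 1≤k
        (λ j → group-coprime l K E G j (1≤k j) (k≤K j)) separate a≢0 (target-≢0 ∘ b)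

      g : Poly
      g = C (proj₁ powers) *ᵖ X ^ D

      g-degree : HasDegree g D
      g-degree = hasDegree-* (hasDegree-C (proj₁ (proj₂ powers))) (hasDegree-X^ D)

      1≤D : 1 ≤ D
      1≤D = ℕ.n≢0⇒n>0 (ℕ.≢-nonZero⁻¹ D ⦃ (2 ℕ.^ E) !≢0 ⦄)

      small : ∀ j → Factored (SmallDegree l K E D) (binomial (a j) (b j) (k j) g)
      small j with group-divides l K E G j
      ... | divides e D≡ = factored-cong
        (≋.reflexive (cong (λ n → binomial (a j) (b j) (k j) (C (proj₁ powers) *ᵖ X ^ n)) (sym D≡)))
        (factored-map (λ {n} le → N j , φ j , product-positive (pairwise j) , totient-positive (pairwise j) , bound n le , group-bound l K E G j)
          (binomial-factored {a j} {b j} {proj₁ powers} {proj₁ β} {k j} {e} {group j} (pairwise j) (1≤k j) 1≤e (proj₁ (proj₂ β)) (proj₂ (proj₂ β))))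
        where
        β = proj₂ (proj₂ powers) j
        1≤e : 1 ≤ e
        1≤e = ℕ.n≢0⇒n>0 λ { refl → ℕ.n≮0 (ℕ.<-≤-trans 1≤D (ℕ.≤-reflexive D≡)) }
        open ℕ.≤-Reasoning
        swap : ∀ e k f n → e ℕ.* k ℕ.* f ℕ.* n ≡ k ℕ.* f ℕ.* (e ℕ.* n)
        swap = solveℕ
        bound : ∀ n → n ≤ e ℕ.* k j ℕ.* φ j → n ℕ.* N j ≤ suc K ℕ.* φ j ℕ.* D
        bound n le = begin
          n ℕ.* N j                          ≤⟨ ℕ.*-monoˡ-≤ (N j) le ⟩
          e ℕ.* k j ℕ.* φ j ℕ.* N j          ≡⟨ swap e (k j) (φ j) (N j) ⟩
          k j ℕ.* φ j ℕ.* (e ℕ.* N j)        ≡⟨ cong (k j ℕ.* φ j ℕ.*_) D≡ ⟨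
          k j ℕ.* φ j ℕ.* D                  ≤⟨ ℕ.*-monoˡ-≤ D (ℕ.*-monoˡ-≤ (φ j) (k≤K j)) ⟩
          suc K ℕ.* φ j ℕ.* D                ∎

    -- The last component says that f(g) is nonzero. Polysmoothness depends on it, as every h
    -- divides the zero polynomial.
    factorisation : ∃[ g ] HasDegree g ((2 ℕ.^ E) !) ×
      Factored (SmallDegree l K E ((2 ℕ.^ E) !)) (binomialProduct a b k ⟨ g ⟩) ×
      ∃[ n ] HasDegree (binomialProduct a b k ⟨ g ⟩) n
    factorisation = g , g-degree ,
      factored-cong (≋.sym (binomialProduct-⟨⟩ a b k g)) (factored-∏ _ small) ,
      (let n , _ , d = ∏ᵖ-degree (λ j → binomial (a j) (b j) (k j) g)
                         (λ j → k j ℕ.* D , ℕ.*-mono-≤ (1≤k j) 1≤D , binomial-degree (b j) (a≢0 j) (1≤k j) 1≤D g-degree)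
       in n , hasDegree-cong (≋.sym (binomialProduct-⟨⟩ a b k g)) d)

  binomialProduct-degree : ∀ {l} (a b : Fin l → ℤ) k → (∀ j → 1 ≤ k j) → ∏ᶻ a ≢ 0ℤ → l ≤ deg (binomialProduct a b k)
  binomialProduct-degree a b k 1≤k ∏a≢0
    with ∏ᵖ-degree (λ j → binomial (a j) (b j) (k j) X)
           (λ j → k j ℕ.* 1 , ℕ.*-mono-≤ (1≤k j) ℕ.≤-refl ,
                  binomial-degree (b j) (∏ᶻ-≢0 a ∏a≢0 j) (1≤k j) ℕ.≤-refl hasDegree-X)
  ... | n , l≤n , d = subst (_ ≤_) (sym (hasDegree⇒deg (binomialProduct a b k) d)) l≤n

-- Embedding ℕ into ℚ and an upper bound for log log d

module Logarithm where
  open import Defs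
  open import Algebra.Bundles using (CommutativeRing)
  import Algebra.Properties.CommutativeSemiring.Exp as Exp
  open import Data.Integer.Base as ℤ using (ℤ)
  import Data.Integer.Properties as ℤ
  open import Data.Nat.Base as ℕ using (ℕ; zero; suc; z≤n; s≤s; _!)
  import Data.Nat.Properties as ℕ
  import Data.Nat.Coprimality as Coprime
  open import Data.Nat.Properties using (_!≢0)
  open import Data.Nat.Tactic.RingSolver using () renaming (solve-∀ to solveℕ)
  open import Data.Product.Base using (_,_)
  open import Data.Rational.Base as ℚ using (ℚ; 0ℚ; 1ℚ; mkℚ; *≤*; *<*)
  import Data.Rational.Properties as ℚ
  import Data.Rational.Unnormalised.Base as ℚᵘ
  import Data.Rational.Unnormalised.Properties as ℚᵘ
  open import Data.Sum.Base using (inj₁; inj₂)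
  open import Relation.Binary.PropositionalEquality

  open Exp (CommutativeRing.commutativeSemiring ℚ.+-*-commutativeRing) public using () renaming (^-distrib-* to ^ℚ-distrib-*)

  ι : ℕ → ℚ
  ι n = ℤ.+ n ℚ./ 1

  -- `ι n` is normalised by a gcd, which does not compute for a variable n. The explicit fraction
  -- makes comparison and multiplication available.
  ι-normal : ∀ n → ι n ≡ mkℚ (ℤ.+ n) 0 (Coprime.sym (Coprime.1-coprimeTo n))
  ι-normal n = ℚ.↥p/↧p≡p (mkℚ (ℤ.+ n) 0 (Coprime.sym (Coprime.1-coprimeTo n)))

  ι-mono-≤ : ∀ {m n} → m ℕ.≤ n → ι m ℚ.≤ ι n
  ι-mono-≤ {m} {n} m≤n = subst₂ ℚ._≤_ (sym (ι-normal m)) (sym (ι-normal n))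
    (*≤* (subst₂ ℤ._≤_ (sym (ℤ.*-identityʳ (ℤ.+ m))) (sym (ℤ.*-identityʳ (ℤ.+ n))) (ℤ.+≤+ m≤n)))

  ι-mono-< : ∀ {m n} → m ℕ.< n → ι m ℚ.< ι n
  ι-mono-< {m} {n} m<n = subst₂ ℚ._<_ (sym (ι-normal m)) (sym (ι-normal n))
    (*<* (subst₂ ℤ._<_ (sym (ℤ.*-identityʳ (ℤ.+ m))) (sym (ℤ.*-identityʳ (ℤ.+ n))) (ℤ.+<+ m<n)))

  ι-* : ∀ m n → ι (m ℕ.* n) ≡ ι m ℚ.* ι n
  ι-* m n = trans (cong (ℚ._/ 1) (ℤ.pos-* m n)) (sym (cong₂ ℚ._*_ (ι-normal m) (ι-normal n)))

  ι-^ : ∀ m n → ι (m ℕ.^ n) ≡ ι m ^ℚ n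
  ι-^ m zero    = refl
  ι-^ m (suc n) = trans (ι-* m (m ℕ.^ n)) (cong (ι m ℚ.*_) (ι-^ m n))

  0≤ι : ∀ n → 0ℚ ℚ.≤ ι n
  0≤ι n = ι-mono-≤ {0} {n} z≤n

  0<ι : ∀ {n} → 1 ℕ.≤ n → 0ℚ ℚ.< ι n
  0<ι {n} p = ι-mono-< {0} {n} p

  recip-* : ∀ n .⦃ _ : ℕ.NonZero n ⦄ → ι n ℚ.* (ℤ.+ 1 ℚ./ n) ≡ 1ℚ
  recip-* (suc n) = ℚ.toℚᵘ-injective (begin
    ℚ.toℚᵘ (ι (suc n) ℚ.* (ℤ.+ 1 ℚ./ suc n))                  ≈⟨ ℚ.toℚᵘ-homo-* (ι (suc n)) (ℤ.+ 1 ℚ./ suc n) ⟩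
    ℚ.toℚᵘ (ι (suc n)) ℚᵘ.* ℚ.toℚᵘ (ℤ.+ 1 ℚ./ suc n)
      ≈⟨ ℚᵘ.*-cong (ℚ.toℚᵘ-fromℚᵘ (ℚᵘ.mkℚᵘ (ℤ.+ suc n) 0)) (ℚ.toℚᵘ-fromℚᵘ (ℚᵘ.mkℚᵘ (ℤ.+ 1) n)) ⟩
    ℚᵘ.mkℚᵘ (ℤ.+ suc n) 0 ℚᵘ.* ℚᵘ.mkℚᵘ (ℤ.+ 1) n             ≈⟨ ℚᵘ.*≡* (cong ℤ.+_ (unit n)) ⟩
    ℚᵘ.1ℚᵘ                                                     ∎)
    where
    open ℚᵘ.≃-Reasoning
    unit : ∀ n → suc n ℕ.* 1 ℕ.* 1 ≡ 1 ℕ.* (1 ℕ.* suc n)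
    unit = solveℕ

  *-mono-≤ : ∀ {p q r s} → 0ℚ ℚ.≤ p → 0ℚ ℚ.≤ s → p ℚ.≤ q → r ℚ.≤ s → p ℚ.* r ℚ.≤ q ℚ.* s
  *-mono-≤ {p} {q} {r} {s} 0≤p 0≤s p≤q r≤s = ℚ.≤-trans
    (ℚ.*-monoˡ-≤-nonNeg p ⦃ ℚ.nonNegative 0≤p ⦄ r≤s) (ℚ.*-monoʳ-≤-nonNeg s ⦃ ℚ.nonNegative 0≤s ⦄ p≤q)

  0≤* : ∀ {p q} → 0ℚ ℚ.≤ p → 0ℚ ℚ.≤ q → 0ℚ ℚ.≤ p ℚ.* q
  0≤* {p} {q} 0≤p 0≤q = subst (ℚ._≤ p ℚ.* q) (ℚ.*-zeroˡ 0ℚ) (*-mono-≤ ℚ.≤-refl 0≤q 0≤p 0≤q)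

  0<* : ∀ {p q} → 0ℚ ℚ.< p → 0ℚ ℚ.< q → 0ℚ ℚ.< p ℚ.* q
  0<* {p} {q} 0<p 0<q = subst (ℚ._< p ℚ.* q) (ℚ.*-zeroˡ q) (ℚ.*-monoˡ-<-pos q ⦃ ℚ.positive 0<q ⦄ 0<p)

  0≤^ : ∀ {p} n → 0ℚ ℚ.≤ p → 0ℚ ℚ.≤ p ^ℚ n
  0≤^ zero    0≤p = 0≤ι 1
  0≤^ (suc n) 0≤p = 0≤* 0≤p (0≤^ n 0≤p)

  ^ℚ-mono-≤ : ∀ {p q} n → 0ℚ ℚ.≤ p → p ℚ.≤ q → p ^ℚ n ℚ.≤ q ^ℚ n
  ^ℚ-mono-≤ zero    0≤p p≤q = ℚ.≤-refl
  ^ℚ-mono-≤ (suc n) 0≤p p≤q = *-mono-≤ 0≤p (0≤^ n (ℚ.≤-trans 0≤p p≤q)) p≤q (^ℚ-mono-≤ n 0≤p p≤q)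

  0<recip : ∀ n .⦃ _ : ℕ.NonZero n ⦄ → 0ℚ ℚ.< ℤ.+ 1 ℚ./ n
  0<recip n = ℚ.positive⁻¹ (ℤ.+ 1 ℚ./ n) ⦃ ℚ.normalize-pos 1 n ⦄

  expTerm : ℚ → ℕ → ℚ
  expTerm q m = q ^ℚ m ℚ.* ((ℤ.+ 1 ℚ./ (m !)) ⦃ m !≢0 ⦄)

  expTerm-≥0 : ∀ {q} m → 0ℚ ℚ.≤ q → 0ℚ ℚ.≤ expTerm q m
  expTerm-≥0 m 0≤q = 0≤* (0≤^ m 0≤q) (ℚ.<⇒≤ (0<recip (m !) ⦃ m !≢0 ⦄))

  expPartialSum-≥0 : ∀ {q} n → 0ℚ ℚ.≤ q → 0ℚ ℚ.≤ expPartialSum q n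
  expPartialSum-≥0 zero    0≤q = ℚ.≤-refl
  expPartialSum-≥0 {q} (suc n) 0≤q = subst (ℚ._≤ expPartialSum q (suc n)) (ℚ.+-identityˡ 0ℚ)
    (ℚ.+-mono-≤ (expPartialSum-≥0 n 0≤q) (expTerm-≥0 n 0≤q))

  expTerm≤expPartialSum : ∀ {q} m n → 0ℚ ℚ.≤ q → m ℕ.< n → expTerm q m ℚ.≤ expPartialSum q n
  expTerm≤expPartialSum {q} m (suc n) 0≤q (s≤s m≤n) with ℕ.m≤n⇒m<n∨m≡n m≤n
  ... | inj₂ refl = subst (ℚ._≤ expPartialSum q (suc n)) (ℚ.+-identityˡ (expTerm q n))
                      (ℚ.+-monoˡ-≤ (expTerm q n) (expPartialSum-≥0 n 0≤q))
  ... | inj₁ m<n  = subst (ℚ._≤ expPartialSum q (suc n)) (ℚ.+-identityʳ (expTerm q m))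
                      (ℚ.+-mono-≤ (expTerm≤expPartialSum m n 0≤q m<n) (expTerm-≥0 n 0≤q))

  -- Needed for n = m; the base is kept fixed while the induction lowers the exponent.
  2^m*m!≤[2n]^m : ∀ m n → m ℕ.≤ n → 2 ℕ.^ m ℕ.* m ! ℕ.≤ (2 ℕ.* n) ℕ.^ m
  2^m*m!≤[2n]^m zero    n _   = s≤s z≤n
  2^m*m!≤[2n]^m (suc m) n m<n = ℕ.≤-trans (ℕ.≤-reflexive (regroup (2 ℕ.^ m) m (m !)))
    (ℕ.*-mono-≤ (ℕ.*-monoʳ-≤ 2 m<n) (2^m*m!≤[2n]^m m n (ℕ.<⇒≤ m<n)))
    where
    regroup : ∀ p m f → 2 ℕ.* p ℕ.* (suc m ℕ.* f) ≡ 2 ℕ.* suc m ℕ.* (p ℕ.* f)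
    regroup = solveℕ

  -- The single term (2m)ᵐ/m! of exp(2m) is already at least 2ᵐ.
  2^m≤expTerm : ∀ {q} m → ι (2 ℕ.* m) ℚ.≤ q → ι (2 ℕ.^ m) ℚ.≤ expTerm q m
  2^m≤expTerm {q} m 2m≤q = ℚ.*-cancelʳ-≤-pos (ι (m !)) ⦃ ℚ.positive (0<ι (ℕ.1≤n! m)) ⦄ (begin
    ι (2 ℕ.^ m) ℚ.* ι (m !)         ≡⟨ ι-* (2 ℕ.^ m) (m !) ⟨
    ι (2 ℕ.^ m ℕ.* m !)             ≤⟨ ι-mono-≤ (2^m*m!≤[2n]^m m m ℕ.≤-refl) ⟩
    ι ((2 ℕ.* m) ℕ.^ m)             ≡⟨ ι-^ (2 ℕ.* m) m ⟩
    ι (2 ℕ.* m) ^ℚ m                ≤⟨ ^ℚ-mono-≤ m (0≤ι (2 ℕ.* m)) 2m≤q ⟩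
    q ^ℚ m                          ≡⟨ ℚ.*-identityʳ (q ^ℚ m) ⟨
    q ^ℚ m ℚ.* 1ℚ                   ≡⟨ cong (q ^ℚ m ℚ.*_) (trans (sym (recip-* (m !) ⦃ m !≢0 ⦄)) (ℚ.*-comm (ι (m !)) ρ)) ⟩
    q ^ℚ m ℚ.* (ρ ℚ.* ι (m !))      ≡⟨ ℚ.*-assoc (q ^ℚ m) ρ (ι (m !)) ⟨
    expTerm q m ℚ.* ι (m !)         ∎)
    where
    open ℚ.≤-Reasoning
    ρ = (ℤ.+ 1 ℚ./ (m !)) ⦃ m !≢0 ⦄

  exp-lower : ∀ {q r} m → ι (2 ℕ.* m) ℚ.≤ q → r ℚ.< ι (2 ℕ.^ m) → lower (exp q) r
  exp-lower {q} m 2m≤q r< = ι (2 ℕ.^ m) , r< , suc m , λ n m<n →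
    ℚ.≤-trans (2^m≤expTerm m 2m≤q) (expTerm≤expPartialSum m n (ℚ.≤-trans (0≤ι (2 ℕ.* m)) 2m≤q) m<n)

  -- Everything rests on 2ᵐ ≤ exp(2m). With M = 4ᴱ, the bound d < 2ᴹ gives log d < 2M. Then 2M < 4M
  -- = 2²ᴱ⁺² gives log log d < 4E + 4, and this is at most 8E because E ≥ 1.
  log-log-upper : ∀ {E d x} → 1 ℕ.≤ E → d ℕ.< 2 ℕ.^ (2 ℕ.^ E ℕ.* 2 ℕ.^ E) → ι (8 ℕ.* E) ℚ.≤ x →
    upper (log (log (fromℕ d))) x
  log-log-upper {suc e} {d} {x} _ d< 8E≤x =
    let r , d<r , r< = ℚ.<-dense (ι-mono-< d<)
    in ι (2 ℕ.* M) , (r , d<r , exp-lower M ℚ.≤-refl r<) ,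
       exp-lower (2 ℕ.+ (E ℕ.+ E)) (ℚ.≤-trans (ι-mono-≤ 2m≤8E) 8E≤x) (ι-mono-< 2M<)
    where
    E = suc e
    M = 2 ℕ.^ E ℕ.* 2 ℕ.^ E
    2m≤8E : 2 ℕ.* (2 ℕ.+ (E ℕ.+ E)) ℕ.≤ 8 ℕ.* E
    2m≤8E = ℕ.≤-trans (ℕ.m≤m+n _ (4 ℕ.* e)) (ℕ.≤-reflexive (slack e))
      where
      slack : ∀ e → 2 ℕ.* (2 ℕ.+ (suc e ℕ.+ suc e)) ℕ.+ 4 ℕ.* e ≡ 8 ℕ.* suc e
      slack = solveℕ
    2M< : 2 ℕ.* M ℕ.< 2 ℕ.^ (2 ℕ.+ (E ℕ.+ E))
    2M< = subst (2 ℕ.* M ℕ.<_)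
      (trans (double M) (cong (λ n → 2 ℕ.* (2 ℕ.* n)) (sym (ℕ.^-distribˡ-+-* 2 E E))))
      (ℕ.m<m+n (2 ℕ.* M) (ℕ.*-mono-≤ {1} {2} (s≤s z≤n) (ℕ.*-mono-≤ (ℕ.m^n>0 2 E) (ℕ.m^n>0 2 E))))
      where
      double : ∀ n → 2 ℕ.* n ℕ.+ 2 ℕ.* n ≡ 2 ℕ.* (2 ℕ.* n)
      double = solveℕ

  n!≤n^n : ∀ m n → m ℕ.≤ n → m ! ℕ.≤ n ℕ.^ m
  n!≤n^n zero    n _   = s≤s z≤n
  n!≤n^n (suc m) n m<n = ℕ.*-mono-≤ m<n (n!≤n^n m n (ℕ.<⇒≤ m<n))

  n<2^n : ∀ n → n ℕ.< 2 ℕ.^ n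
  n<2^n zero    = s≤s z≤n
  n<2^n (suc n) = ℕ.≤-trans (ℕ.+-mono-≤ (ℕ.m^n>0 2 n) (n<2^n n)) (ℕ.+-monoʳ-≤ (2 ℕ.^ n) (ℕ.m≤m+n (2 ℕ.^ n) 0))

  -- From n! ≤ nⁿ the exponent of 2 is at most E times 2ᴱ, and E < 2ᴱ.
  2^E!-upper : ∀ E → (2 ℕ.^ E) ! ℕ.< 2 ℕ.^ (2 ℕ.^ E ℕ.* 2 ℕ.^ E)
  2^E!-upper E = ℕ.≤-<-trans (n!≤n^n (2 ℕ.^ E) (2 ℕ.^ E) ℕ.≤-refl)
    (subst (ℕ._< 2 ℕ.^ (2 ℕ.^ E ℕ.* 2 ℕ.^ E)) (sym (ℕ.^-*-assoc 2 E (2 ℕ.^ E)))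
      (ℕ.^-monoʳ-< 2 (s≤s (s≤s z≤n)) (ℕ.*-monoˡ-< (2 ℕ.^ E) ⦃ ℕ.m^n≢0 2 E ⦄ (n<2^n E))))

  ^-distribʳ-* : ∀ m n k → (m ℕ.* n) ℕ.^ k ≡ m ℕ.^ k ℕ.* n ℕ.^ k
  ^-distribʳ-* m n zero    = refl
  ^-distribʳ-* m n (suc k) = trans (cong (m ℕ.* n ℕ.*_) (^-distribʳ-* m n k)) (swap m n (m ℕ.^ k) (n ℕ.^ k))
    where
    swap : ∀ m n p q → m ℕ.* n ℕ.* (p ℕ.* q) ≡ m ℕ.* p ℕ.* (n ℕ.* q)
    swap = solveℕ

  m≤m^[1+n] : ∀ m n → m ℕ.≤ m ℕ.^ suc n
  m≤m^[1+n] zero    n = z≤n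
  m≤m^[1+n] (suc m) n = ℕ.m≤m*n (suc m) (suc m ℕ.^ n) ⦃ ℕ.m^n≢0 (suc m) n ⦄

-- The degree bound in terms of log log d, and polysmoothness

module DegreeBounds where
  open import Defs
  open PolynomialRing
  open Degree
  open IrreducibleFactors
  open CyclotomicFactors
  open PrimeGroups
  open Factorisation
  open Logarithm
  open import Algebra.Definitions.RawMagma using (_,_)
  open import Data.Fin.Base using (Fin; zero; suc)
  open import Data.Integer.Base as ℤ using (ℤ; 0ℤ; 1ℤ)
  import Data.Integer.Properties as ℤ
  open import Data.List.Base using ([]; _∷_; length; lookup)
  import Data.List.Relation.Unary.All as All
  open import Data.List.Membership.Propositional.Properties using (∈-lookup)
  open import Data.Nat.Base as ℕ using (ℕ; zero; suc; _≤_; z≤n; s≤s; _!)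
  import Data.Nat.Coprimality as Coprime
  open import Data.Nat.DivMod using (m/n*n≤m; /-monoˡ-≤; m*n/n≡m)
  import Data.Nat.Properties as ℕ
  open import Data.Nat.Tactic.RingSolver using () renaming (solve-∀ to solveℕ)
  open import Data.Product.Base using (∃-syntax; _×_; _,_)
  open import Data.Rational.Base as ℚ using (ℚ; 0ℚ; 1ℚ; ½; mkℚ; *≤*; *<*)
  import Data.Rational.Properties as ℚ
  import Data.Rational.Solver as ℚ-Solver
  open ℚ-Solver.+-*-Solver using (_:*_; _:=_) renaming (solve to solveℚ)
  open import Data.Sum.Base using (inj₂)
  open import Function.Bundles using (Equivalence)
  open import Relation.Binary.PropositionalEquality

  -- With B = 32(K+1)² one has n s ≤ B d for the s of `small-degree-bound`. A lower bound for the
  -- product of cuts c and d needs rationals strictly below both: 2B + 1 < c and d - 1 < d satisfy B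
  -- d < (2B + 1)(d - 1) once d ≥ 2.
  bound-constant : ℕ → ℕ
  bound-constant K = 2 ℕ.* (32 ℕ.* suc K ℕ.* suc K) ℕ.+ 2

  bound-constant-positive : ∀ K → 0ᶜ <ᶜ fromℕ (bound-constant K)
  bound-constant-positive K = 1ℚ , ℚ.positive⁻¹ 1ℚ ,
    ι-mono-< {1} {bound-constant K} (ℕ.m≤n+m 2 (2 ℕ.* (32 ℕ.* suc K ℕ.* suc K)))

  -- The factor 8 of `log-log-upper` and 2(K+1) combine to 16(K+1), which is at most its own power
  -- with exponent l+1. Together with the base 2 this gives 32(K+1).
  ratio-power-bound : ∀ {l K E φ N} → E ℕ.* φ ℕ.^ suc l ≤ 2 ℕ.^ suc l ℕ.* (2 ℕ.* suc K) ℕ.* N ℕ.^ suc l →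
    8 ℕ.* E ℕ.* φ ℕ.^ suc l ≤ (32 ℕ.* suc K ℕ.* N) ℕ.^ suc l
  ratio-power-bound {l} {K} {E} {φ} {N} le = begin
    8 ℕ.* E ℕ.* φ ℕ.^ L                               ≡⟨ ℕ.*-assoc 8 E (φ ℕ.^ L) ⟩
    8 ℕ.* (E ℕ.* φ ℕ.^ L)                             ≤⟨ ℕ.*-monoʳ-≤ 8 le ⟩
    8 ℕ.* (2 ℕ.^ L ℕ.* (2 ℕ.* suc K) ℕ.* N ℕ.^ L)     ≡⟨ regroup (2 ℕ.^ L) (suc K) (N ℕ.^ L) ⟩
    2 ℕ.^ L ℕ.* (16 ℕ.* suc K) ℕ.* N ℕ.^ L            ≤⟨ ℕ.*-monoˡ-≤ (N ℕ.^ L) (ℕ.*-monoʳ-≤ (2 ℕ.^ L) (m≤m^[1+n] (16 ℕ.* suc K) l)) ⟩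
    2 ℕ.^ L ℕ.* (16 ℕ.* suc K) ℕ.^ L ℕ.* N ℕ.^ L      ≡⟨ cong (ℕ._* N ℕ.^ L) (^-distribʳ-* 2 (16 ℕ.* suc K) L) ⟨
    (2 ℕ.* (16 ℕ.* suc K)) ℕ.^ L ℕ.* N ℕ.^ L          ≡⟨ ^-distribʳ-* (2 ℕ.* (16 ℕ.* suc K)) N L ⟨
    (2 ℕ.* (16 ℕ.* suc K) ℕ.* N) ℕ.^ L                ≡⟨ cong (λ n → (n ℕ.* N) ℕ.^ L) (ℕ.*-assoc 2 16 (suc K)) ⟨
    (32 ℕ.* suc K ℕ.* N) ℕ.^ L                        ∎
    where
    open ℕ.≤-Reasoning
    L = suc l
    regroup : ∀ p k n → 8 ℕ.* (p ℕ.* (2 ℕ.* k) ℕ.* n) ≡ p ℕ.* (16 ℕ.* k) ℕ.* n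
    regroup = solveℕ

  -- The (l+1)-st root of log log d is at most s = 32(K+1)N/φ.
  small-degree-bound : ∀ {l K E d n} → 1 ≤ E → 2 ≤ d → d ℕ.< 2 ℕ.^ (2 ℕ.^ E ℕ.* 2 ℕ.^ E) → SmallDegree l K E d n →
    fromℕ n ≤ᶜ fromℕ (bound-constant K) *ᶜ fromℕ d /ᶜ root (suc l) (log (log (fromℕ d)))
  small-degree-bound {l} {K} {E} {suc (suc d)} {n} 1≤E (s≤s (s≤s _)) d< (N , φ@(suc _) , 1≤N , 1≤φ , nN≤ , EφL≤) q q<n =
    -- The quotient exceeds q by way of the pair n s and s: the first lies below c d, the second
    -- above the root, and q s < n s.
    ι n ℚ.* s , s ,
    inj₂ (ι (2 ℕ.* B ℕ.+ 1) , ι (suc d) , 0<ι (ℕ.m≤n+m 1 (2 ℕ.* B)) , 0<ι {suc d} (s≤s z≤n) ,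
          ι-mono-< (ℕ.+-monoʳ-< (2 ℕ.* B) {1} {2} (s≤s (s≤s z≤n))) , ι-mono-< {suc d} {suc (suc d)} ℕ.≤-refl , product-bound) ,
    0<s , (0<s , log-log-upper {E} {suc (suc d)} 1≤E d< 8E≤s^L) ,
    ℚ.*-monoˡ-<-pos s ⦃ ℚ.positive 0<s ⦄ q<n
    where
    open ℚ.≤-Reasoning
    L = suc l
    α = 32 ℕ.* suc K
    B = α ℕ.* suc K
    ρ = ℤ.+ 1 ℚ./ φ
    s = ι (α ℕ.* N) ℚ.* ρ
    0<s : 0ℚ ℚ.< s
    0<s = 0<* (0<ι {α ℕ.* N} (ℕ.*-mono-≤ {1} {α} (s≤s z≤n) 1≤N)) (0<recip φ)
    sφ : s ℚ.* ι φ ≡ ι (α ℕ.* N)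
    sφ = trans (ℚ.*-assoc (ι (α ℕ.* N)) ρ (ι φ))
      (trans (cong (ι (α ℕ.* N) ℚ.*_) (trans (ℚ.*-comm ρ (ι φ)) (recip-* φ))) (ℚ.*-identityʳ (ι (α ℕ.* N))))
    8E≤s^L : ι (8 ℕ.* E) ℚ.≤ s ^ℚ L
    8E≤s^L = ℚ.*-cancelʳ-≤-pos (ι (φ ℕ.^ L)) ⦃ ℚ.positive (0<ι (ℕ.m^n>0 φ L)) ⦄ (begin
      ι (8 ℕ.* E) ℚ.* ι (φ ℕ.^ L)        ≡⟨ ι-* (8 ℕ.* E) (φ ℕ.^ L) ⟨
      ι (8 ℕ.* E ℕ.* φ ℕ.^ L)            ≤⟨ ι-mono-≤ (ratio-power-bound {l} {K} {E} {φ} {N} EφL≤) ⟩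
      ι ((α ℕ.* N) ℕ.^ L)                ≡⟨ ι-^ (α ℕ.* N) L ⟩
      ι (α ℕ.* N) ^ℚ L                   ≡⟨ cong (_^ℚ L) sφ ⟨
      (s ℚ.* ι φ) ^ℚ L                   ≡⟨ ^ℚ-distrib-* s (ι φ) L ⟩
      s ^ℚ L ℚ.* ι φ ^ℚ L                ≡⟨ cong (s ^ℚ L ℚ.*_) (ι-^ φ L) ⟨
      s ^ℚ L ℚ.* ι (φ ℕ.^ L)             ∎)
    nαN≤ : n ℕ.* (α ℕ.* N) ≤ B ℕ.* suc (suc d) ℕ.* φ
    nαN≤ = ℕ.≤-trans (ℕ.≤-reflexive (swap n α N))
      (ℕ.≤-trans (ℕ.*-monoʳ-≤ α nN≤) (ℕ.≤-reflexive (regroup α (suc K) φ (suc (suc d)))))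
      where
      swap : ∀ n α N → n ℕ.* (α ℕ.* N) ≡ α ℕ.* (n ℕ.* N)
      swap = solveℕ
      regroup : ∀ α k φ d → α ℕ.* (k ℕ.* φ ℕ.* d) ≡ α ℕ.* k ℕ.* d ℕ.* φ
      regroup = solveℕ
    ns≤ : ι n ℚ.* s ℚ.≤ ι (B ℕ.* suc (suc d))
    ns≤ = ℚ.*-cancelʳ-≤-pos (ι φ) ⦃ ℚ.positive (0<ι 1≤φ) ⦄ (begin
      ι n ℚ.* s ℚ.* ι φ                  ≡⟨ ℚ.*-assoc (ι n) s (ι φ) ⟩
      ι n ℚ.* (s ℚ.* ι φ)                ≡⟨ cong (ι n ℚ.*_) sφ ⟩
      ι n ℚ.* ι (α ℕ.* N)                ≡⟨ ι-* n (α ℕ.* N) ⟨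
      ι (n ℕ.* (α ℕ.* N))                ≤⟨ ι-mono-≤ nαN≤ ⟩
      ι (B ℕ.* suc (suc d) ℕ.* φ)        ≡⟨ ι-* (B ℕ.* suc (suc d)) φ ⟩
      ι (B ℕ.* suc (suc d)) ℚ.* ι φ      ∎)
    Bd< : B ℕ.* suc (suc d) ℕ.< (2 ℕ.* B ℕ.+ 1) ℕ.* suc d
    Bd< = subst (B ℕ.* suc (suc d) ℕ.<_) (slack B d) (ℕ.m<m+n (B ℕ.* suc (suc d)) {suc (d ℕ.+ B ℕ.* d)} (s≤s z≤n))
      where
      slack : ∀ B d → B ℕ.* suc (suc d) ℕ.+ suc (d ℕ.+ B ℕ.* d) ≡ (2 ℕ.* B ℕ.+ 1) ℕ.* suc d
      slack = solveℕ
    product-bound : ι n ℚ.* s ℚ.< ι (2 ℕ.* B ℕ.+ 1) ℚ.* ι (suc d)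
    product-bound = ℚ.≤-<-trans ns≤ (subst (ι (B ℕ.* suc (suc d)) ℚ.<_) (ι-* (2 ℕ.* B ℕ.+ 1) (suc d)) (ι-mono-< Bd<))

  -- A is the denominator of q, as the numerator is at least 1.
  positive⇒reciprocal : ∀ {q} → 0ℚ ℚ.< q → ∃[ A ] 1ℚ ℚ.≤ ι A ℚ.* q
  positive⇒reciprocal {mkℚ (ℤ.+ suc n) d c} _ = suc d , (begin
    1ℚ                                                 ≡⟨ recip-* (suc d) ⟨
    ι (suc d) ℚ.* (ℤ.+ 1 ℚ./ suc d)                    ≤⟨ ℚ.*-monoˡ-≤-nonNeg (ι (suc d)) ⦃ ℚ.nonNegative (0≤ι (suc d)) ⦄ below ⟩
    ι (suc d) ℚ.* mkℚ (ℤ.+ suc n) d c                  ∎)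
    where
    open ℚ.≤-Reasoning
    below : ℤ.+ 1 ℚ./ suc d ℚ.≤ mkℚ (ℤ.+ suc n) d c
    below = subst (ℚ._≤ mkℚ (ℤ.+ suc n) d c) (sym (ℚ.↥p/↧p≡p (mkℚ (ℤ.+ 1) d (Coprime.1-coprimeTo (suc d)))))
      (*≤* (ℤ.*-monoʳ-≤-nonNeg (ℤ.+ suc d) (ℤ.+≤+ {1} {suc n} (s≤s z≤n))))
  positive⇒reciprocal {mkℚ (ℤ.+ 0) d c} (*<* (ℤ.+<+ ()))
  positive⇒reciprocal {mkℚ ℤ.-[1+ n ] d c} (*<* ())

  -- The 8 pays for strictness in the product of three cuts: ½ lies below F, q₀/4 below q₀/2, and
  -- d/2 below d. What remains is q₀ d / 8, which is at least d/(8A).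
  ε-degree-bound : ∀ {θ q₀ A F d n} → 0ℚ ℚ.< q₀ → lower θ q₀ → 1ℚ ℚ.≤ ι A ℚ.* q₀ → 1 ≤ F → 1 ≤ d →
    n ℕ.* (8 ℕ.* A) ≤ d → fromℕ n ≤ᶜ θ *ᶜ fromℕ F *ᶜ fromℕ d
  ε-degree-bound {θ} {q₀} {A} {F} {d} {n} 0<q₀ lower-q₀ 1≤Aq₀ 1≤F 1≤d n8A≤d q q<n =
    inj₂ (r , s , 0<* 0<q₀ 0<¼ , 0<* (0<ι 1≤d) 0<½ ,
      inj₂ (q₀ , ½ , 0<q₀ , 0<½ , lower-q₀ , ℚ.<-≤-trans ½<1 (ι-mono-≤ 1≤F) ,
            ℚ.*-monoʳ-<-pos q₀ ⦃ ℚ.positive 0<q₀ ⦄ ¼<½) ,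
      subst (s ℚ.<_) (ℚ.*-identityʳ (ι d)) (ℚ.*-monoʳ-<-pos (ι d) ⦃ ℚ.positive (0<ι 1≤d) ⦄ ½<1) ,
      ℚ.<-≤-trans q<n n≤rs)
    where
    open ℚ.≤-Reasoning
    ¼ = ½ ℚ.* ½
    r = q₀ ℚ.* ¼
    s = ι d ℚ.* ½
    0<½ : 0ℚ ℚ.< ½
    0<½ = *<* (ℤ.+<+ (s≤s z≤n))
    0<¼ : 0ℚ ℚ.< ¼
    0<¼ = *<* (ℤ.+<+ (s≤s z≤n))
    ½<1 : ½ ℚ.< 1ℚ
    ½<1 = *<* (ℤ.+<+ (s≤s (s≤s z≤n)))
    ¼<½ : ¼ ℚ.< ½
    ¼<½ = *<* (ℤ.+<+ (s≤s (s≤s (s≤s z≤n))))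
    n≤rs : ι n ℚ.≤ r ℚ.* s
    n≤rs = ℚ.*-cancelʳ-≤-pos (ι 8) (begin
      ι n ℚ.* ι 8                          ≡⟨ ℚ.*-identityʳ _ ⟨
      ι n ℚ.* ι 8 ℚ.* 1ℚ                   ≤⟨ *-mono-≤ (0≤* (0≤ι n) (0≤ι 8)) (ℚ.≤-trans (0≤ι 1) 1≤Aq₀) ℚ.≤-refl 1≤Aq₀ ⟩
      ι n ℚ.* ι 8 ℚ.* (ι A ℚ.* q₀)         ≡⟨ regroup (ι n) (ι 8) (ι A) q₀ ⟩
      ι n ℚ.* (ι 8 ℚ.* ι A) ℚ.* q₀         ≡⟨ cong (ℚ._* q₀) (trans (ι-* n (8 ℕ.* A)) (cong (ι n ℚ.*_) (ι-* 8 A))) ⟨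
      ι (n ℕ.* (8 ℕ.* A)) ℚ.* q₀           ≤⟨ ℚ.*-monoʳ-≤-nonNeg q₀ ⦃ ℚ.nonNegative (ℚ.<⇒≤ 0<q₀) ⦄ (ι-mono-≤ n8A≤d) ⟩
      ι d ℚ.* q₀                           ≡⟨ ℚ.*-identityʳ (ι d ℚ.* q₀) ⟨
      ι d ℚ.* q₀ ℚ.* (¼ ℚ.* ½ ℚ.* ι 8)     ≡⟨ regroup′ (ι d) q₀ ¼ ½ (ι 8) ⟩
      r ℚ.* s ℚ.* ι 8                      ∎)
      where
      regroup : ∀ n e a q → n ℚ.* e ℚ.* (a ℚ.* q) ≡ n ℚ.* (e ℚ.* a) ℚ.* q
      regroup = solveℚ 4 (λ n e a q → n :* e :* (a :* q) := n :* (e :* a) :* q) refl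
      regroup′ : ∀ d q x y e → d ℚ.* q ℚ.* (x ℚ.* y ℚ.* e) ≡ q ℚ.* x ℚ.* (d ℚ.* y) ℚ.* e
      regroup′ = solveℚ 5 (λ d q x y e → d :* q :* (x :* y :* e) := q :* x :* (d :* y) :* e) refl

  ^-cancelˡ-≤ : ∀ {m n} l → m ℕ.^ suc l ≤ n ℕ.^ suc l → m ≤ n
  ^-cancelˡ-≤ l le = ℕ.≮⇒≥ λ n<m → ℕ.<⇒≱ (ℕ.^-monoˡ-< (suc l) n<m) le

  -- Once E is that large, cancelling the common constant and taking roots gives (K+1)Tφ ≤ N, that
  -- is, the ratio N/φ outweighs (K+1)T. No logarithm enters.
  small-degree-ratio : ∀ {l K E d n T} → 2 ℕ.^ suc l ℕ.* (2 ℕ.* suc K) ℕ.* (suc K ℕ.* T) ℕ.^ suc l ≤ E →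
    SmallDegree l K E d n → n ℕ.* T ≤ d
  small-degree-ratio {l} {K} {E} {d} {n} {T} cT≤E (N , φ , 1≤N , 1≤φ , nN≤ , EφL≤) =
    ℕ.*-cancelʳ-≤ (n ℕ.* T) d (suc K ℕ.* φ) ⦃ ℕ.>-nonZero (ℕ.*-mono-≤ {1} {suc K} (s≤s z≤n) 1≤φ) ⦄ (begin
      n ℕ.* T ℕ.* (suc K ℕ.* φ)      ≡⟨ regroup n T (suc K) φ ⟩
      n ℕ.* (suc K ℕ.* T ℕ.* φ)      ≤⟨ ℕ.*-monoʳ-≤ n (^-cancelˡ-≤ l ratio) ⟩
      n ℕ.* N                        ≤⟨ nN≤ ⟩
      suc K ℕ.* φ ℕ.* d              ≡⟨ ℕ.*-comm (suc K ℕ.* φ) d ⟩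
      d ℕ.* (suc K ℕ.* φ)            ∎)
    where
    open ℕ.≤-Reasoning
    L = suc l
    c = 2 ℕ.^ L ℕ.* (2 ℕ.* suc K)
    regroup : ∀ n t k f → n ℕ.* t ℕ.* (k ℕ.* f) ≡ n ℕ.* (k ℕ.* t ℕ.* f)
    regroup = solveℕ
    ratio : (suc K ℕ.* T ℕ.* φ) ℕ.^ L ≤ N ℕ.^ L
    ratio = ℕ.*-cancelˡ-≤ c ⦃ ℕ.>-nonZero (ℕ.*-mono-≤ (ℕ.m^n>0 2 L) (ℕ.*-mono-≤ {1} {2} {1} {suc K} (s≤s z≤n) (s≤s z≤n))) ⦄ (begin
      c ℕ.* (suc K ℕ.* T ℕ.* φ) ℕ.^ L                ≡⟨ cong (c ℕ.*_) (^-distribʳ-* (suc K ℕ.* T) φ L) ⟩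
      c ℕ.* ((suc K ℕ.* T) ℕ.^ L ℕ.* φ ℕ.^ L)        ≡⟨ ℕ.*-assoc c _ _ ⟨
      c ℕ.* (suc K ℕ.* T) ℕ.^ L ℕ.* φ ℕ.^ L          ≤⟨ ℕ.*-monoˡ-≤ (φ ℕ.^ L) cT≤E ⟩
      E ℕ.* φ ℕ.^ L                                  ≤⟨ EφL≤ ⟩
      c ℕ.* N ℕ.^ L                                  ∎)

  ∏ᵖ-lookup : ∀ ps → ∏ᵖ (lookup ps) ≡ product-of ps
  ∏ᵖ-lookup []       = refl
  ∏ᵖ-lookup (p ∷ ps) = cong (p *ᵖ_) (∏ᵖ-lookup ps)

  factored-irreducible : ∀ {T f D h d} → Factored (λ n → n ℕ.* T ≤ d) f → HasDegree f D → Irreducible h → h ∣ f →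
    deg h ℕ.* T ≤ d
  factored-irreducible {zero} {h = h} _ _ _ _ = ℕ.≤-trans (ℕ.≤-reflexive (ℕ.*-zeroʳ (deg h))) z≤n
  factored-irreducible {T@(suc _)} {f} {D} {h} {d} (factored ps e bounds) df irr (w , wh≈f)
    with hasDegree-factor w h df (≋.sym (mk wh≈f))
  ... | _ , n , _ , dh , _ = begin
    deg h ℕ.* T              ≤⟨ ℕ.*-monoˡ-≤ T (subst (_≤ d ℕ./ T) (sym (hasDegree⇒deg h dh)) bound) ⟩
    (d ℕ./ T) ℕ.* T          ≤⟨ m/n*n≤m d T ⟩
    d                        ∎
    where
    open ℕ.≤-Reasoning
    ∏≋f : ∏ᵖ (lookup ps) ≋ f
    ∏≋f = ≋.trans (≋.reflexive (∏ᵖ-lookup ps)) e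
    -- `irreducible-factor-degree` expects a bound on the degree itself, so the condition n T ≤ d is
    -- turned into n ≤ ⌊d/T⌋.
    bound : n ≤ d ℕ./ T
    bound = irreducible-factor-degree {κ = C 1ℤ} (lookup ps) w irr dh hasDegree-1 (hasDegree-cong (≋.sym ∏≋f) df)
      (≋.trans (*ᵖ-identityˡ (∏ᵖ (lookup ps))) (≋.trans ∏≋f (≋.trans (≋.sym (mk wh≈f)) (*ᵖ-comm w h))))
      (λ i → ℕ.≤-trans (ℕ.≤-reflexive (sym (m*n/n≡m (deg (lookup ps i)) T))) (/-monoˡ-≤ T (All.lookup bounds (∈-lookup i))))

  n≤n! : ∀ n → n ≤ n !
  n≤n! zero    = z≤n
  n≤n! (suc n) = ℕ.≤-trans (ℕ.≤-reflexive (sym (ℕ.*-identityʳ (suc n)))) (ℕ.*-monoʳ-≤ (suc n) (ℕ.1≤n! n))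

  n≤2^n! : ∀ n → n ≤ (2 ℕ.^ n) !
  n≤2^n! n = ℕ.≤-trans (ℕ.<⇒≤ (n<2^n n)) (n≤n! (2 ℕ.^ n))

  module _ {l K : ℕ} (k : Fin (suc l) → ℕ) (1≤k : ∀ j → 1 ≤ k j) (k≤K : ∀ j → k j ≤ suc K)
           (a b : Fin (suc l) → ℤ) (∏a≢0 : ∏ᶻ a ≢ 0ℤ) where
    private
      f : Poly
      f = binomialProduct a b k

      c : ℕ
      c = bound-constant K

      smooth : ∀ E → suc K ≤ E → ∃[ g ] HasDegree g ((2 ℕ.^ E) !) ×
        Factored (SmallDegree l K E ((2 ℕ.^ E) !)) (f ⟨ g ⟩) × ∃[ n ] HasDegree (f ⟨ g ⟩) n
      smooth E K<E = factorisation l K E (prime-groups l K E (ℕ.≤-trans K<E (ℕ.<⇒≤ (n<2^n E)))) k 1≤k k≤K a b ∏a≢0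

    smooth-factorisations : ∀ N → ∃[ g ] N ≤ deg g × 3 ≤ deg g ×
      (∃[ m ] ∃[ p ] ∏ᵖ {m} p ≈ f ⟨ g ⟩ ×
      (∀ i → fromℕ (deg (p i)) ≤ᶜ fromℕ c *ᶜ fromℕ (deg g) /ᶜ root (suc l) (log (log (fromℕ (deg g))))))
    smooth-factorisations N = conclude (smooth E (ℕ.m≤m+n (suc K) (3 ℕ.+ N)))
      where
      -- The summand K+1 ensures that the groups exist. As d ≥ E, the rest gives d ≥ N and d ≥ 3 >
      -- e, so that log log d is positive.
      E = suc K ℕ.+ (3 ℕ.+ N)
      d = (2 ℕ.^ E) !
      3+N≤d : 3 ℕ.+ N ≤ d
      3+N≤d = ℕ.≤-trans (ℕ.m≤n+m (3 ℕ.+ N) (suc K)) (n≤2^n! E)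
      3≤d : 3 ≤ d
      3≤d = ℕ.≤-trans (ℕ.m≤m+n 3 N) 3+N≤d
      Conclusion : ℕ → Poly → Set
      Conclusion n g = N ≤ n × 3 ≤ n × (∃[ m ] ∃[ p ] ∏ᵖ {m} p ≈ f ⟨ g ⟩ ×
        (∀ i → fromℕ (deg (p i)) ≤ᶜ fromℕ c *ᶜ fromℕ n /ᶜ root (suc l) (log (log (fromℕ n)))))
      conclude : (∃[ g ] HasDegree g d × Factored (SmallDegree l K E d) (f ⟨ g ⟩) × ∃[ n ] HasDegree (f ⟨ g ⟩) n) →
        ∃[ g ] Conclusion (deg g) g
      conclude (g , dg , factored ps e small , _) = g , subst (λ n → Conclusion n g) (sym (hasDegree⇒deg g dg))
        ( ℕ.≤-trans (ℕ.m≤n+m N 3) 3+N≤d , 3≤d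
        , length ps , lookup ps , _≋_.at (≋.trans (≋.reflexive (∏ᵖ-lookup ps)) e)
        , λ i → small-degree-bound {l} {K} {E} {d} {deg (lookup ps i)} (s≤s z≤n) (ℕ.<⇒≤ 3≤d) (2^E!-upper E) (All.lookup small (∈-lookup i)))

    polysmoothness : (ε : ℝ) → 0ᶜ <ᶜ ℝ.cut ε → AdmitsPolysmoothness f ε
    polysmoothness ε (q₀ , 0<q₀ , lower-q₀) with positive⇒reciprocal 0<q₀
    ... | A , 1≤Aq₀ = 1≤deg-f , 0≤ε , conclude (smooth E (ℕ.m≤n+m (suc K) _))
      where
      -- T is what `ε-degree-bound` demands, and E is the threshold of `small-degree-ratio` for it,
      -- increased by K+1 so that the groups exist.
      T = 8 ℕ.* A
      E = 2 ℕ.^ suc l ℕ.* (2 ℕ.* suc K) ℕ.* (suc K ℕ.* T) ℕ.^ suc l ℕ.+ suc K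
      d = (2 ℕ.^ E) !
      1≤deg-f : 1 ≤ deg f
      1≤deg-f = ℕ.≤-trans (s≤s z≤n) (binomialProduct-degree a b k 1≤k ∏a≢0)
      0≤ε : 0ᶜ ≤ᶜ ℝ.cut ε
      0≤ε q q<0 = Equivalence.from (ℝ.lower-rounded ε q) (q₀ , ℚ.<-trans q<0 0<q₀ , lower-q₀)
      Conclusion : ℕ → Poly → Set
      Conclusion n g = 1 ≤ n × (∀ h → Irreducible h → h ∣ f ⟨ g ⟩ →
        fromℕ (deg h) ≤ᶜ ℝ.cut ε *ᶜ fromℕ (deg f) *ᶜ fromℕ n)
      conclude : (∃[ g ] HasDegree g d × Factored (SmallDegree l K E d) (f ⟨ g ⟩) × ∃[ n ] HasDegree (f ⟨ g ⟩) n) →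
        ∃[ g ] Conclusion (deg g) g
      conclude (g , dg , fac , _ , df) = g , subst (λ n → Conclusion n g) (sym (hasDegree⇒deg g dg))
        ( ℕ.1≤n! (2 ℕ.^ E)
        , λ h irr h∣ → ε-degree-bound {ℝ.cut ε} {q₀} {A} {deg f} {d} {deg h} 0<q₀ lower-q₀ 1≤Aq₀ 1≤deg-f (ℕ.1≤n! (2 ℕ.^ E))
            (factored-irreducible {T} {f ⟨ g ⟩} (factored-map (λ {n} → small-degree-ratio {l} {K} {E} {d} {n} {T} (ℕ.m≤m+n _ (suc K))) fac)
              df irr h∣))

-- The constant c from a bound on the exponents kⱼ

open import Defs
open import Data.Fin.Base using (Fin)
open import Data.Integer.Base using (ℤ; 0ℤ)
open import Data.Nat.Base using (ℕ; suc; _≤_)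
open import Data.Product.Base using (∃-syntax; _×_; _,_)
open import Relation.Binary.PropositionalEquality using (_≢_)
open Factorisation using (bound-above)
open Logarithm using (ι)
open DegreeBounds

theorem2p1 : (l : ℕ) → 1 ≤ l →
    (k : Fin l → ℕ) → (∀ j → 1 ≤ k j) →
    ∃[ c ] 0ᶜ <ᶜ ℝ.cut c ×
    (∀ (a b : Fin l → ℤ) → ∏ᶻ a ≢ 0ℤ →
    (∀ (N : ℕ) → ∃[ g ] N ≤ deg g × 3 ≤ deg g ×
    (∃[ m ] ∃[ p ] ∏ᵖ {m} p ≈ binomialProduct a b k ⟨ g ⟩ ×
    (∀ i → fromℕ (deg (p i)) ≤ᶜ
    ℝ.cut c *ᶜ fromℕ (deg g) /ᶜ root l (log (log (fromℕ (deg g)))))))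
    × (∀ (ε : ℝ) → 0ᶜ <ᶜ ℝ.cut ε →
    AdmitsPolysmoothness (binomialProduct a b k) ε))
theorem2p1 (suc l) _ k 1≤k with bound-above k
... | K , k≤K = ℚ⇒ℝ (ι (bound-constant K)) , bound-constant-positive K , λ a b ∏a≢0 →
  smooth-factorisations k 1≤k k≤K a b ∏a≢0 , polysmoothness k 1≤k k≤K a b ∏a≢0
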